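{- Let $k \ge 3$ be fixed. For all sufficiently large $n$ with $n \equiv 1 \pmod{2k}$ there is a regular $n$-vertex tournament $T$ such that $\nu_k(T)=\nu^*_k(T)=\frac{n(n-1)}{2k}$ and $\tau_k(T) = \frac{n^2}{4}-o(n^2)$ (where $o(n^2)/n^2\to 0$ as $n\to\infty$).
   Context: A tournament is an orientation of a complete graph; it is regular if all vertices have the same out-degree. $\overrightarrow{C_k}$ is the directed cycle on $k$ vertices. For a directed graph $D$ (unweighted, i.e. all arc weights 1): $\nu_k(D)$ is the maximum number of pairwise arc-disjoint copies of $\overrightarrow{C_k}$ in $D$; $\tau_k(D)$ is the minimum number of arcs whose removal leaves no copy of $\overrightarrow{C_k}$; a fractional $\overrightarrow{C_k}$-packing is a function $m$ from the set of copies of $\overrightarrow{C_k}$ in $D$ to $[0,\infty)$ such that for every arc $e$ the sum of $m(X)$ over copies $X$ containing $e$ is at most $1$, and $\nu_k^*(D)$ is the maximum of $\sum_X m(X)$ over fractional packings.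
   Formalization: Fractional packings take non-negative rational values instead of values in [0,∞), so ν*_k(T) is stated as the maximum over rational fractional packings (which equals the real maximum). -}

module Defs where

open import Data.Bool using (Bool; true; false; not; _∧_; if_then_else_)
open import Data.Nat using (ℕ; zero; suc; _+_; _*_; _≤ᵇ_; _≤_)
open import Data.Fin using (Fin; toℕ)
open import Data.Fin.Properties using () renaming (_≟_ to _≟ᶠ_)
open import Data.List using (List; []; _∷_; [_]; _++_; zip; map; concatMap; filter; length; foldr)
open import Data.Nat.ListAction using (sum)
open import Data.List.Relation.Unary.Unique.Propositional using (Unique)
import Data.List.Relation.Unary.Unique.DecPropositional as UDec
open import Data.List.Relation.Unary.Any using (Any)
open import Data.List.Relation.Unary.All using (All)
open import Data.List.Membership.Propositional using (_∈_)
open import Data.Product using (_×_; _,_; Σ; ∃)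
open import Data.Product.Properties using (≡-dec)
open import Data.Rational using (ℚ; 0ℚ; 1ℚ) renaming (_+_ to _+ℚ_; _≤_ to _≤ℚ_)
open import Relation.Nullary using (does; ¬_)
open import Relation.Binary.PropositionalEquality using (_≡_; _≢_)
open import Data.Vec using () renaming (allFin to allFinV; toList to toListV)

Digraph : ℕ → Set
Digraph n = Fin n → Fin n → Bool

IsTournament : ∀ {n} → Digraph n → Set
IsTournament {n} T = (∀ (i : Fin n) → T i i ≡ false)
                   × (∀ (i j : Fin n) → i ≢ j → T i j ≡ not (T j i))

vertices : (n : ℕ) → List (Fin n)
vertices n = toListV (allFinV n)

outdeg : ∀ {n} → Digraph n → Fin n → ℕ
outdeg {n} T v = sum (map (λ j → if T v j then 1 else 0) (vertices n))

IsRegular : ∀ {n} → Digraph n → Set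
IsRegular {n} T = ∃ λ d → ∀ (v : Fin n) → outdeg T v ≡ d

Arc : ℕ → Set
Arc n = Fin n × Fin n

_≟ᵃ_ : ∀ {n} → (a b : Arc n) → _
_≟ᵃ_ = ≡-dec _≟ᶠ_ _≟ᶠ_

allB : ∀ {A : Set} → (A → Bool) → List A → Bool
allB p [] = true
allB p (x ∷ xs) = p x ∧ allB p xs

cycleArcs : ∀ {n} → List (Fin n) → List (Arc n)
cycleArcs [] = []
cycleArcs (x ∷ xs) = zip (x ∷ xs) (xs ++ [ x ])

-- A copy of the directed k-cycle in D is represented canonically by the
-- cyclic sequence of its k distinct vertices, starting at its smallest vertex.
-- (The map copy ↦ its canonical vertex list is a bijection.)
isCopy : ∀ {n} → Digraph n → ℕ → List (Fin n) → Bool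
isCopy D k [] = false
isCopy {n} D k (x ∷ xs) =
  does (length (x ∷ xs) Data.Nat.≟ k)
  ∧ does (UDec.unique? (_≟ᶠ_ {n}) (x ∷ xs))
  ∧ allB (λ v → toℕ x ≤ᵇ toℕ v) xs
  ∧ allB (λ a → D (Data.Product.proj₁ a) (Data.Product.proj₂ a)) (cycleArcs (x ∷ xs))

IsCopy : ∀ {n} → Digraph n → ℕ → List (Fin n) → Set
IsCopy D k c = isCopy D k c ≡ true

allLists : (n k : ℕ) → List (List (Fin n))
allLists n zero = [] ∷ []
allLists n (suc k) = concatMap (λ v → map (v ∷_) (allLists n k)) (vertices n)

copies : ∀ {n} → Digraph n → ℕ → List (List (Fin n))
copies {n} D k = filter (λ c → isCopy D k c Data.Bool.≟ true) (allLists n k)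

-- ν_k : a C_k-packing is a list of copies that are pairwise arc-disjoint
-- (equivalently: the concatenation of their arc lists has no repetition;
-- this also forces the copies in the list to be distinct).

IsPacking : ∀ {n} → Digraph n → ℕ → List (List (Fin n)) → Set
IsPacking D k P = All (IsCopy D k) P × Unique (concatMap cycleArcs P)

IsNu : ∀ {n} → Digraph n → ℕ → ℕ → Set
IsNu D k v = (Σ _ λ P → IsPacking D k P × length P ≡ v)
           × (∀ P → IsPacking D k P → length P ≤ v)

IsTransversal : ∀ {n} → Digraph n → ℕ → List (Arc n) → Set
IsTransversal D k S =
  All (λ a → D (Data.Product.proj₁ a) (Data.Product.proj₂ a) ≡ true) S
  × Unique S
  × (∀ c → IsCopy D k c → Any (λ a → a ∈ S) (cycleArcs c))

IsTau : ∀ {n} → Digraph n → ℕ → ℕ → Set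
IsTau D k t = (Σ _ λ S → IsTransversal D k S × length S ≡ t)
            × (∀ S → IsTransversal D k S → t ≤ length S)

sumℚ : List ℚ → ℚ
sumℚ = foldr _+ℚ_ 0ℚ

copiesThrough : ∀ {n} → Digraph n → ℕ → Arc n → List (List (Fin n))
copiesThrough D k a =
  filter (λ c → Data.List.Relation.Unary.Any.any? (λ b → b ≟ᵃ a) (cycleArcs c)) (copies D k)

IsFracPacking : ∀ {n} → Digraph n → ℕ → (List (Fin n) → ℚ) → Set
IsFracPacking {n} D k m =
  (∀ c → IsCopy D k c → 0ℚ ≤ℚ m c)
  × (∀ (u v : Fin n) → D u v ≡ true → sumℚ (map m (copiesThrough D k (u , v))) ≤ℚ 1ℚ)

fracValue : ∀ {n} → Digraph n → ℕ → (List (Fin n) → ℚ) → ℚ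
fracValue D k m = sumℚ (map m (copies D k))

IsNuStar : ∀ {n} → Digraph n → ℕ → ℚ → Set
IsNuStar D k q = (Σ _ λ m → IsFracPacking D k m × fracValue D k m ≡ q)
               × (∀ m → IsFracPacking D k m → fracValue D k m ≤ℚ q)

{-# OPTIONS --safe #-}
module Submission where

-- Decompose the edges of Kₙ, n ≡ 1 (mod 2k), into k-cycles and orient each cycle in one of its two directions.
-- Whatever the directions, this is a regular tournament whose arcs are partitioned into directed k-cycles,
-- so ν = ν* = n(n-1)/2k, and 4τ ≤ n² because the ascending arcs, and also the descending arcs, meet every cycle.
--
-- For random directions τ ≥ n²/4 - o(n²).  Suppose that deleting fewer arcs destroys all k-cycles; pass to a set U
-- of vertices in which every vertex lies on (1/2 + ε)|U| surviving arcs.  Then some s vertices of U have about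
-- (1/2 + ε)ˢ|U| common neighbours, whereas each pattern of directions towards them is shared by only a 2⁻ˢ
-- fraction of all vertices.  Hence exponentially many patterns occur, and by the Sauer–Shelah lemma some set P
-- of d vertices is shattered by a set Q of common neighbours.  For even k, the pair (P , Q) contains a k-cycle.
-- For odd k, some vertex w is joined to more than half of P and Q together, and its directions towards P and
-- towards Q are balanced, so w sends arcs to many vertices of P and receives arcs from many vertices of Q, or
-- conversely; shattering then closes a k-cycle through w.  The randomness enters only through two first-moment
-- estimates, for the tuples (x , v) with few patterns and for the moments of the number of unbalanced vertices.

open import Defs
open import Data.Bool using (Bool; true; false; not; _∧_; _∨_; _xor_; if_then_else_)
import Data.Bool.Properties as Bool
open import Data.Nat hiding (_/_)
open import Data.Nat.Properties
open import Data.Nat.Divisibility using (_∣_; _∣?_; divides)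
open import Data.Nat.DivMod using (_%_; m%n<n; m%n%n≡m%n; m≡m%n+[m/n]*n; [m+kn]%n≡m%n; [m+n]%n≡m%n; %-distribˡ-+; m<n⇒m%n≡m)
open import Data.Nat.Tactic.RingSolver using (solve-∀)
open import Data.Fin using (Fin; zero; suc; toℕ; fromℕ<; _↑ˡ_; _↑ʳ_)
import Data.Fin as Fin
import Data.Fin.Properties as Fin
open import Data.List using (List; []; _∷_; [_]; _++_; zip; map; concatMap; length; filter; reverse; applyUpTo; allFin; take; cartesianProduct)
import Data.Nat.ListAction
open import Data.List.Properties using (length-map; ∷-injectiveʳ; ≡-dec; length-++; ++-identityʳ; unfold-reverse; length-applyUpTo; map-cong; concatMap-map; length-tabulate; map-tabulate; length-take)
open import Data.List.Membership.Propositional using (_∈_; _∉_; find)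
open import Data.List.Membership.Propositional.Properties using (∈-++⁺ˡ; ∈-++⁺ʳ; ∈-++⁻; ∈-map⁺; ∈-map⁻; ∈-filter⁺; ∈-filter⁻; ∈-∃++; ∈-applyUpTo⁻; ∈-allFin; ∈-lookup; ∈-cartesianProduct⁺)
open import Data.List.Relation.Unary.Any using (Any; here; there)
import Data.List.Relation.Unary.Any as Any
open import Data.List.Relation.Unary.All using (All; []; _∷_)
import Data.List.Relation.Unary.All as All
import Data.List.Relation.Unary.All.Properties as All
open import Data.List.Relation.Unary.AllPairs using ([]; _∷_)
import Data.List.Relation.Unary.AllPairs as AllPairs
open import Data.List.Relation.Unary.Unique.Propositional using (Unique)
import Data.List.Relation.Unary.Unique.Propositional.Properties as Unique
import Data.List.Relation.Unary.Unique.DecPropositional as UDec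
open import Data.List.Relation.Binary.Permutation.Propositional using (_↭_; ↭-refl; ↭-sym; ↭-trans; ↭-reflexive; prep; ↭⇒↭ₛ)
import Data.List.Relation.Binary.Permutation.Propositional.Properties as Perm
import Data.List.Relation.Binary.Permutation.Setoid.Properties as SetoidPerm
open import Data.List.Relation.Binary.Disjoint.Propositional using (Disjoint)
open import Data.Vec using (Vec; []; _∷_; lookup; _[_]≔_)
import Data.Vec as Vec
import Data.Vec.Properties as Vec
import Data.Vec.Relation.Unary.Any as VAny
import Data.Vec.Relation.Unary.Any.Properties as VAny
import Data.Vec.Membership.Propositional as VMem
import Data.Vec.Membership.Propositional.Properties as VMem
import Data.Integer as ℤ
import Data.Integer.Properties as ℤ
open import Data.Rational using (ℚ; 0ℚ; 1ℚ)
import Data.Rational as ℚ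
import Data.Rational.Properties as ℚ
import Data.Rational.Unnormalised as ℚᵘ
import Data.Rational.Unnormalised.Properties as ℚᵘ
import Algebra.Properties.CommutativeSemigroup
import Algebra.Structures
open import Data.Maybe using (Maybe; just; nothing)
open import Data.Product using (Σ; ∃; _×_; _,_; proj₁; proj₂; swap; uncurry)
import Data.Product as Prod
import Data.Product.Properties as Prod
open import Data.Sum using (_⊎_; inj₁; inj₂)
open import Data.Empty using (⊥; ⊥-elim)
open import Function using (_∘_; id; case_of_)
open import Relation.Nullary using (Dec; yes; no; does; ¬_; contradiction)
open import Relation.Nullary.Decidable using (dec-true; dec-false; _×-dec_; map′)
open import Relation.Binary.PropositionalEquality hiding ([_])
import Data.Nat.DivMod as DivMod

-- The arcs are deleted after the orientation has been chosen, and they may depend on it in any way.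
-- Hence the random estimates concern `T` alone: `fewCount` and `skewMoment` count bad tuples among
-- all vertices, and where they are small they bound the bad tuples inside every dense `U` of linear
-- size at once. Arcs of one cycle are dependent, but among tuples of bounded length those with two
-- pairs on a common cycle form a fraction of order 1/n, which `clash` accounts for. The parameters
-- are fixed in the order e, d, s, t, u, n. A vertex is skewed with probability of order e²/d, while
-- only a fraction λ′/κ of the tuples is complete; this fraction shrinks with s and t, which have to
-- be large in terms of d. With the plain expected number of skewed vertices, d would have to exceed
-- a function of itself. The u-th moment breaks this circle: the probability is raised to the power
-- u, which is chosen after s and t, so d only has to exceed a constant times e⁴.

private variable
  A B : Set

-- Finite sums, tuples and products

∑ : List A → (A → ℕ) → ℕ
∑ []       f = 0
∑ (x ∷ xs) f = f x + ∑ xs f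

∑-cong : ∀ (xs : List A) {f g : A → ℕ} → (∀ x → f x ≡ g x) → ∑ xs f ≡ ∑ xs g
∑-cong []       f≗g = refl
∑-cong (x ∷ xs) f≗g = cong₂ _+_ (f≗g x) (∑-cong xs f≗g)

∑-mono-∈ : ∀ (xs : List A) {f g : A → ℕ} → (∀ x → x ∈ xs → f x ≤ g x) → ∑ xs f ≤ ∑ xs g
∑-mono-∈ []       f≤g = z≤n
∑-mono-∈ (x ∷ xs) f≤g = +-mono-≤ (f≤g x (here refl)) (∑-mono-∈ xs (λ y y∈ → f≤g y (there y∈)))

∑-mono : ∀ (xs : List A) {f g : A → ℕ} → (∀ x → f x ≤ g x) → ∑ xs f ≤ ∑ xs g
∑-mono xs f≤g = ∑-mono-∈ xs (λ x _ → f≤g x)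

∑-+ : ∀ (xs : List A) (f g : A → ℕ) → ∑ xs (λ x → f x + g x) ≡ ∑ xs f + ∑ xs g
∑-+ []       f g = refl
∑-+ (x ∷ xs) f g = trans (cong (f x + g x +_) (∑-+ xs f g)) (interchange (f x) (g x) (∑ xs f) (∑ xs g))
  where
  interchange : ∀ a b c d → a + b + (c + d) ≡ a + c + (b + d)
  interchange = solve-∀

∑-*ˡ : ∀ (xs : List A) c (f : A → ℕ) → ∑ xs (λ x → c * f x) ≡ c * ∑ xs f
∑-*ˡ []       c f = sym (*-zeroʳ c)
∑-*ˡ (x ∷ xs) c f = trans (cong (c * f x +_) (∑-*ˡ xs c f)) (sym (*-distribˡ-+ c (f x) _))

∑-*ʳ : ∀ (xs : List A) (f : A → ℕ) c → ∑ xs (λ x → f x * c) ≡ ∑ xs f * c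
∑-*ʳ []       f c = refl
∑-*ʳ (x ∷ xs) f c = trans (cong (f x * c +_) (∑-*ʳ xs f c)) (sym (*-distribʳ-+ c (f x) _))

∑-const : ∀ (xs : List A) c → ∑ xs (λ _ → c) ≡ length xs * c
∑-const []       c = refl
∑-const (x ∷ xs) c = cong (c +_) (∑-const xs c)

∑-0 : ∀ (xs : List A) → ∑ xs (λ _ → 0) ≡ 0
∑-0 xs = trans (∑-const xs 0) (*-zeroʳ (length xs))

∑-++ : ∀ (xs ys : List A) (f : A → ℕ) → ∑ (xs ++ ys) f ≡ ∑ xs f + ∑ ys f
∑-++ []       ys f = refl
∑-++ (x ∷ xs) ys f = trans (cong (f x +_) (∑-++ xs ys f)) (sym (+-assoc (f x) _ _))

∑-map : ∀ (h : A → B) xs (f : B → ℕ) → ∑ (map h xs) f ≡ ∑ xs (f ∘ h)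
∑-map h []       f = refl
∑-map h (x ∷ xs) f = cong (f (h x) +_) (∑-map h xs f)

∑-concatMap : ∀ (h : A → List B) xs (f : B → ℕ) → ∑ (concatMap h xs) f ≡ ∑ xs (λ x → ∑ (h x) f)
∑-concatMap h []       f = refl
∑-concatMap h (x ∷ xs) f = trans (∑-++ (h x) (concatMap h xs) f) (cong (∑ (h x) f +_) (∑-concatMap h xs f))

∑-swap : ∀ (xs : List A) (ys : List B) (f : A → B → ℕ) →
         ∑ xs (λ x → ∑ ys (f x)) ≡ ∑ ys (λ y → ∑ xs (λ x → f x y))
∑-swap []       ys f = sym (∑-0 ys)
∑-swap (x ∷ xs) ys f = trans (cong (∑ ys (f x) +_) (∑-swap xs ys f)) (sym (∑-+ ys (f x) _))

∑-member : ∀ {xs : List A} {x} (f : A → ℕ) → x ∈ xs → f x ≤ ∑ xs f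
∑-member f (here refl) = m≤m+n _ _
∑-member f (there {x = y} x∈) = ≤-trans (∑-member f x∈) (m≤n+m _ (f y))

∑-≡0 : ∀ {xs : List A} {x} (f : A → ℕ) → ∑ xs f ≡ 0 → x ∈ xs → f x ≡ 0
∑-≡0 f eq x∈ = n≤0⇒n≡0 (≤-trans (∑-member f x∈) (≤-reflexive eq))

∑-average : ∀ (xs : List A) (f : A → ℕ) c → ∑ xs f < length xs * c → ∃ λ x → x ∈ xs × f x < c
∑-average (x ∷ xs) f c lt with f x <? c
... | yes p = x , here refl , p
... | no ¬p with ∑-average xs f c (+-cancelˡ-< c _ _ (≤-<-trans (+-monoˡ-≤ _ (≮⇒≥ ¬p)) lt))
...   | y , y∈ , fy = y , there y∈ , fy

ind : Bool → ℕ
ind b = if b then 1 else 0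

ind≤1 : ∀ b → ind b ≤ 1
ind≤1 true  = ≤-refl
ind≤1 false = z≤n

tuples : List A → (s : ℕ) → List (Vec A s)
tuples xs zero    = [] ∷ []
tuples xs (suc s) = concatMap (λ x → map (x ∷_) (tuples xs s)) xs

∑-tuples-suc : ∀ (xs : List A) s (F : Vec A (suc s) → ℕ) →
               ∑ (tuples xs (suc s)) F ≡ ∑ xs (λ x → ∑ (tuples xs s) (λ v → F (x ∷ v)))
∑-tuples-suc xs s F = trans (∑-concatMap _ xs F) (∑-cong xs (λ x → ∑-map (x ∷_) (tuples xs s) F))

∑-tuples-+ : ∀ (xs : List A) s t (F : Vec A (s + t) → ℕ) →
             ∑ (tuples xs (s + t)) F ≡ ∑ (tuples xs s) (λ x → ∑ (tuples xs t) (λ y → F (x Vec.++ y)))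
∑-tuples-+ xs zero    t F = sym (+-identityʳ _)
∑-tuples-+ xs (suc s) t F = trans (∑-tuples-suc xs (s + t) F)
  (trans (∑-cong xs (λ x → ∑-tuples-+ xs s t (λ v → F (x ∷ v)))) (sym (∑-tuples-suc xs s _)))

length≡∑1 : ∀ (xs : List A) → length xs ≡ ∑ xs (λ _ → 1)
length≡∑1 xs = sym (trans (∑-const xs 1) (*-identityʳ _))

length-tuples : ∀ (xs : List A) s → length (tuples xs s) ≡ length xs ^ s
length-tuples xs zero    = refl
length-tuples xs (suc s) = begin
  length (tuples xs (suc s))                    ≡⟨ length≡∑1 (tuples xs (suc s)) ⟩
  ∑ (tuples xs (suc s)) (λ _ → 1)               ≡⟨ ∑-tuples-suc xs s _ ⟩
  ∑ xs (λ _ → ∑ (tuples xs s) (λ _ → 1))        ≡⟨ ∑-const xs _ ⟩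
  length xs * ∑ (tuples xs s) (λ _ → 1)         ≡⟨ cong (length xs *_) (length≡∑1 (tuples xs s)) ⟨
  length xs * length (tuples xs s)              ≡⟨ cong (length xs *_) (length-tuples xs s) ⟩
  length xs ^ suc s                             ∎
  where open ≡-Reasoning

∈-concatMap : ∀ {h : A → List B} {xs x y} → x ∈ xs → y ∈ h x → y ∈ concatMap h xs
∈-concatMap (here refl) y∈ = ∈-++⁺ˡ y∈
∈-concatMap {h = h} (there {x = z} x∈) y∈ = ∈-++⁺ʳ (h z) (∈-concatMap x∈ y∈)

∈-tuples : ∀ {xs : List A} → (∀ x → x ∈ xs) → ∀ {s} (v : Vec A s) → v ∈ tuples xs s
∈-tuples all∈ []      = here refl
∈-tuples all∈ (x ∷ v) = ∈-concatMap (all∈ x) (∈-map⁺ (x ∷_) (∈-tuples all∈ v))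

∏ : ∀ {s} → Vec A s → (A → ℕ) → ℕ
∏ []      f = 1
∏ (x ∷ v) f = f x * ∏ v f

∑-tuples-∏ : ∀ (xs : List A) s (f : A → ℕ) → ∑ (tuples xs s) (λ v → ∏ v f) ≡ ∑ xs f ^ s
∑-tuples-∏ xs zero    f = refl
∑-tuples-∏ xs (suc s) f = begin
  ∑ (tuples xs (suc s)) (λ v → ∏ v f)               ≡⟨ ∑-tuples-suc xs s _ ⟩
  ∑ xs (λ x → ∑ (tuples xs s) (λ v → f x * ∏ v f))  ≡⟨ ∑-cong xs (λ x → ∑-*ˡ (tuples xs s) (f x) _) ⟩
  ∑ xs (λ x → f x * ∑ (tuples xs s) (λ v → ∏ v f))  ≡⟨ ∑-*ʳ xs f _ ⟩
  ∑ xs f * ∑ (tuples xs s) (λ v → ∏ v f)            ≡⟨ cong (∑ xs f *_) (∑-tuples-∏ xs s f) ⟩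
  ∑ xs f ^ suc s                                    ∎
  where open ≡-Reasoning

-- Redrawing one coordinate keeps the uniform distribution, and `length xs` counts the redraws. This
-- replaces conditioning on the other coordinates, both for one bit of an orientation and for one
-- vertex of a tuple.
∑-resample : ∀ (xs : List A) {h} (l : Fin h) (F : Vec A h → ℕ) →
             length xs * ∑ (tuples xs h) F ≡ ∑ (tuples xs h) (λ φ → ∑ xs (λ z → F (φ [ l ]≔ z)))
∑-resample xs {suc h} zero F = begin
  length xs * ∑ (tuples xs (suc h)) F                              ≡⟨ cong (length xs *_) eq ⟩
  length xs * ∑ (tuples xs h) (λ v → ∑ xs (λ z → F (z ∷ v)))       ≡⟨ ∑-const xs _ ⟨
  ∑ xs (λ _ → ∑ (tuples xs h) (λ v → ∑ xs (λ z → F (z ∷ v))))      ≡⟨ ∑-tuples-suc xs h _ ⟨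
  ∑ (tuples xs (suc h)) (λ φ → ∑ xs (λ z → F (φ [ zero ]≔ z)))     ∎
  where
  open ≡-Reasoning
  eq : ∑ (tuples xs (suc h)) F ≡ ∑ (tuples xs h) (λ v → ∑ xs (λ z → F (z ∷ v)))
  eq = trans (∑-tuples-suc xs h F) (∑-swap xs (tuples xs h) _)
∑-resample xs {suc h} (suc l) F = begin
  length xs * ∑ (tuples xs (suc h)) F                                               ≡⟨ cong (length xs *_) (∑-tuples-suc xs h F) ⟩
  length xs * ∑ xs (λ x → ∑ (tuples xs h) (λ v → F (x ∷ v)))                        ≡⟨ ∑-*ˡ xs (length xs) _ ⟨
  ∑ xs (λ x → length xs * ∑ (tuples xs h) (λ v → F (x ∷ v)))                        ≡⟨ ∑-cong xs (λ x → ∑-resample xs l (λ v → F (x ∷ v))) ⟩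
  ∑ xs (λ x → ∑ (tuples xs h) (λ v → ∑ xs (λ z → F (x ∷ (v [ l ]≔ z)))))            ≡⟨ ∑-tuples-suc xs h _ ⟨
  ∑ (tuples xs (suc h)) (λ φ → ∑ xs (λ z → F (φ [ suc l ]≔ z)))                     ∎
  where open ≡-Reasoning

-- Uniform random bits

bools : List Bool
bools = true ∷ false ∷ []

bitVecs : (q : ℕ) → List (Vec Bool q)
bitVecs = tuples bools

∈-bools : ∀ b → b ∈ bools
∈-bools true  = here refl
∈-bools false = there (here refl)

∑-bools-xor : ∀ f (H : Bool → ℕ) → ∑ bools (λ z → H (f xor z)) ≡ ∑ bools H
∑-bools-xor false H = refl
∑-bools-xor true  H = exchange (H false) (H true)
  where
  exchange : ∀ a b → a + (b + 0) ≡ b + (a + 0)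
  exchange = solve-∀

-- An entry `(c , f)` is a position with a flip: the direction between two vertices is the bit of
-- the cycle through them, flipped or not according to the sense in which that cycle passes them.
readBits : ∀ {L q} → Vec Bool L → Vec (Fin L × Bool) q → Vec Bool q
readBits b = Vec.map (λ (c , f) → f xor lookup b c)

readBits-≔ : ∀ {L q} (b : Vec Bool L) c z (cs : Vec (Fin L × Bool) q) →
             (∀ i → proj₁ (lookup cs i) ≢ c) → readBits (b [ c ]≔ z) cs ≡ readBits b cs
readBits-≔ b c z []             c∉ = refl
readBits-≔ b c z ((c′ , f) ∷ cs) c∉ =
  cong₂ _∷_ (cong (f xor_) (Vec.lookup∘updateAt′ c′ c (c∉ zero) b)) (readBits-≔ b c z cs (c∉ ∘ suc))

-- Bits at distinct positions are uniform and independent of everything else: `G` may look at all of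
-- `b`, provided that by `inv` it ignores the positions being read. Each position in turn is
-- resampled, and a flip only permutes the two values.
readBits-uniform : ∀ {L q} (cs : Vec (Fin L × Bool) q) (G : Vec Bool q → Vec Bool L → ℕ) →
  (∀ i j → proj₁ (lookup cs i) ≡ proj₁ (lookup cs j) → i ≡ j) →
  (∀ i a b z → G a (b [ proj₁ (lookup cs i) ]≔ z) ≡ G a b) →
  2 ^ q * ∑ (bitVecs L) (λ b → G (readBits b cs) b) ≡ ∑ (bitVecs L) (λ b → ∑ (bitVecs q) (λ a → G a b))
readBits-uniform {L} [] G inj inv =
  trans (+-identityʳ _) (∑-cong (bitVecs L) (λ b → sym (+-identityʳ _)))
readBits-uniform {L} {suc q} ((c , f) ∷ cs) G inj inv = begin
  2 * 2 ^ q * ∑ (bitVecs L) (λ b → G (readBits b ((c , f) ∷ cs)) b)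
    ≡⟨ assoc (2 ^ q) _ ⟩
  2 ^ q * (2 * ∑ (bitVecs L) (λ b → G (readBits b ((c , f) ∷ cs)) b))
    ≡⟨ cong (2 ^ q *_) (∑-resample bools c _) ⟩
  2 ^ q * ∑ (bitVecs L) (λ b → ∑ bools (λ z → G (readBits (b [ c ]≔ z) ((c , f) ∷ cs)) (b [ c ]≔ z)))
    ≡⟨ cong (2 ^ q *_) (∑-cong (bitVecs L) (λ b → trans (∑-cong bools (step b)) (∑-bools-xor f (λ z → G (z ∷ readBits b cs) b)))) ⟩
  2 ^ q * ∑ (bitVecs L) (λ b → G′ (readBits b cs) b)
    ≡⟨ readBits-uniform cs G′ inj′ inv′ ⟩
  ∑ (bitVecs L) (λ b → ∑ (bitVecs q) (λ a → G′ a b))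
    ≡⟨ ∑-cong (bitVecs L) (λ b → trans (∑-swap (bitVecs q) bools (λ a z → G (z ∷ a) b)) (sym (∑-tuples-suc bools q _))) ⟩
  ∑ (bitVecs L) (λ b → ∑ (bitVecs (suc q)) (λ a → G a b)) ∎
  where
  open ≡-Reasoning
  assoc : ∀ x y → 2 * x * y ≡ x * (2 * y)
  assoc = solve-∀
  G′ : Vec Bool q → Vec Bool L → ℕ
  G′ a b = ∑ bools (λ z → G (z ∷ a) b)
  inj′ : ∀ i j → proj₁ (lookup cs i) ≡ proj₁ (lookup cs j) → i ≡ j
  inj′ i j eq = Fin.suc-injective (inj (suc i) (suc j) eq)
  inv′ : ∀ i a b z → G′ a (b [ proj₁ (lookup cs i) ]≔ z) ≡ G′ a b
  inv′ i a b z = ∑-cong bools (λ y → inv (suc i) (y ∷ a) b z)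
  step : ∀ b z → G (readBits (b [ c ]≔ z) ((c , f) ∷ cs)) (b [ c ]≔ z) ≡ G ((f xor z) ∷ readBits b cs) b
  step b z = trans (inv zero _ b z) (cong (λ a → G a b) (cong₂ _∷_
    (cong (f xor_) (Vec.lookup∘updateAt c b))
    (readBits-≔ b c z cs (λ i eq → case inj (suc i) zero eq of λ ()))))

-- The Sauer–Shelah lemma

-- The sum of the binomial coefficients of `s` over 0, ..., d - 1, by Pascal's rule.
sauer : ℕ → ℕ → ℕ
sauer s       zero    = 0
sauer zero    (suc d) = 1
sauer (suc s) (suc d) = sauer s (suc d) + sauer s d

sauer≤ : ∀ s d → sauer s d ≤ suc s ^ d
sauer≤ s       zero    = z≤n
sauer≤ zero    (suc d) = ≤-reflexive (sym (^-zeroˡ (suc d)))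
sauer≤ (suc s) (suc d) = begin
  sauer s (suc d) + sauer s d     ≤⟨ +-mono-≤ (sauer≤ s (suc d)) (sauer≤ s d) ⟩
  suc s ^ suc d + suc s ^ d       ≡⟨ +-comm (suc s ^ suc d) _ ⟩
  suc (suc s) * suc s ^ d         ≤⟨ *-monoʳ-≤ (suc (suc s)) (^-monoˡ-≤ d (n≤1+n (suc s))) ⟩
  suc (suc s) ^ suc d             ∎
  where open ≤-Reasoning

Shattered : ∀ s d → (Vec Bool s → Bool) → Set
Shattered s d f = Σ (Vec (Fin s) d) λ P → ∀ a → ∃ λ c → f c ≡ true × Vec.map (lookup c) P ≡ a

-- The first coordinate splits a family into two families on the other coordinates, and its size is
-- that of their union plus that of their intersection. A large union shatters `suc d` of the other
-- coordinates. Otherwise the intersection is large and shatters `d` of them, and both values of the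
-- first coordinate can be prefixed.
sauer-shelah : ∀ s d (f : Vec Bool s → Bool) → sauer s d < ∑ (bitVecs s) (ind ∘ f) → Shattered s d f
sauer-shelah s zero f lt with ∑-positive (bitVecs s) lt
  where
  ∑-positive : ∀ (xs : List (Vec Bool s)) → 0 < ∑ xs (ind ∘ f) → ∃ λ c → f c ≡ true
  ∑-positive (x ∷ xs) lt with f x in eq
  ... | true  = x , eq
  ... | false = ∑-positive xs lt
... | c , fc = [] , λ { [] → c , fc , refl }
sauer-shelah zero (suc d) f lt =
  contradiction (≤-trans (≤-reflexive (+-identityʳ _)) (ind≤1 (f []))) (<⇒≱ lt)
sauer-shelah (suc s) (suc d) f lt with sauer s (suc d) <? ∑ (bitVecs s) (λ a → ind (f (true ∷ a) ∨ f (false ∷ a)))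
... | yes lt∨ with sauer-shelah s (suc d) _ lt∨
...   | P , sh = Vec.map suc P , λ a → extend a (sh a)
  where
  drop : ∀ {d} z (c : Vec Bool s) (P : Vec (Fin s) d) → Vec.map (lookup (z ∷ c)) (Vec.map suc P) ≡ Vec.map (lookup c) P
  drop z c P = sym (Vec.map-∘ (lookup (z ∷ c)) suc P)
  extend : ∀ a → (∃ λ c → (f (true ∷ c) ∨ f (false ∷ c)) ≡ true × Vec.map (lookup c) P ≡ a) →
           ∃ λ c → f c ≡ true × Vec.map (lookup c) (Vec.map suc P) ≡ a
  extend a (c , fc , eq) with f (true ∷ c) in fc₁
  ... | true  = true ∷ c , fc₁ , trans (drop true c P) eq
  ... | false = false ∷ c , fc , trans (drop false c P) eq
sauer-shelah (suc s) (suc d) f lt | no ¬lt∨ with sauer-shelah s d (λ a → f (true ∷ a) ∧ f (false ∷ a)) lt∧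
  where
  ∨∧ : ∀ x y → ind x + ind y ≡ ind (x ∨ y) + ind (x ∧ y)
  ∨∧ true  true  = refl
  ∨∧ true  false = refl
  ∨∧ false y     = sym (+-identityʳ (ind y))
  f₁ f₀ : Vec Bool s → ℕ
  f₁ a = ind (f (true ∷ a))
  f₀ a = ind (f (false ∷ a))
  S = bitVecs s
  split : ∑ (bitVecs (suc s)) (ind ∘ f) ≡
          ∑ S (λ a → ind (f (true ∷ a) ∨ f (false ∷ a))) + ∑ S (λ a → ind (f (true ∷ a) ∧ f (false ∷ a)))
  split = begin
    ∑ (bitVecs (suc s)) (ind ∘ f)      ≡⟨ ∑-tuples-suc bools s _ ⟩
    ∑ S f₁ + (∑ S f₀ + 0)              ≡⟨ cong (∑ S f₁ +_) (+-identityʳ _) ⟩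
    ∑ S f₁ + ∑ S f₀                    ≡⟨ ∑-+ S f₁ f₀ ⟨
    ∑ S (λ a → f₁ a + f₀ a)            ≡⟨ ∑-cong S (λ a → ∨∧ (f (true ∷ a)) (f (false ∷ a))) ⟩
    ∑ S _                              ≡⟨ ∑-+ S _ _ ⟩
    _                                  ∎
    where open ≡-Reasoning
  lt∧ : sauer s d < ∑ S (λ a → ind (f (true ∷ a) ∧ f (false ∷ a)))
  lt∧ = +-cancelˡ-< (sauer s (suc d)) _ _ (<-≤-trans lt (≤-trans (≤-reflexive split) (+-monoˡ-≤ _ (≮⇒≥ ¬lt∨))))
... | P , sh = zero ∷ Vec.map suc P , λ { (z ∷ a) → extend z a (sh a) }
  where
  drop : ∀ z (c : Vec Bool s) → Vec.map (lookup (z ∷ c)) (Vec.map suc P) ≡ Vec.map (lookup c) P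
  drop z c = sym (Vec.map-∘ (lookup (z ∷ c)) suc P)
  both : ∀ z c → (f (true ∷ c) ∧ f (false ∷ c)) ≡ true → f (z ∷ c) ≡ true
  both z c eq with f (true ∷ c) in fc₁ | f (false ∷ c) in fc₀
  both true  c eq | true | _    = fc₁
  both false c eq | true | true = fc₀
  extend : ∀ z a → (∃ λ c → (f (true ∷ c) ∧ f (false ∷ c)) ≡ true × Vec.map (lookup c) P ≡ a) →
           ∃ λ c → f c ≡ true × Vec.map (lookup c) (zero ∷ Vec.map suc P) ≡ z ∷ a
  extend z a (c , fc , eq) = z ∷ c , both z c fc , cong (z ∷_) (trans (drop z c) eq)

-- Chebyshev's inequality for uniform bit vectors

ones zeros : ∀ {q} → Vec Bool q → ℕ
ones  []      = 0
ones  (z ∷ a) = ind z + ones a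
zeros []      = 0
zeros (z ∷ a) = ind (not z) + zeros a

bias : ∀ {q} → Vec Bool q → ℕ
bias a = ∣ ones a - zeros a ∣

-- The variance of a sum of `q` independent signs is `q`: one more sign replaces x² by (x + 1)² + (x
-- - 1)² = 2x² + 2. The absolute differences keep this within the naturals.
∑-bias² : ∀ q → ∑ (bitVecs q) (λ a → bias a * bias a) ≡ q * 2 ^ q
∑-bias² zero    = refl
∑-bias² (suc q) = begin
  ∑ (bitVecs (suc q)) (λ a → bias a * bias a)            ≡⟨ ∑-tuples-suc bools q _ ⟩
  ∑ S (up true) + (∑ S (up false) + 0)                   ≡⟨ cong (∑ S (up true) +_) (+-identityʳ _) ⟩
  ∑ S (up true) + ∑ S (up false)                         ≡⟨ ∑-+ S _ _ ⟨
  ∑ S (λ a → up true a + up false a)                     ≡⟨ ∑-cong S (λ a → parallelogram (ones a) (zeros a)) ⟩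
  ∑ S (λ a → 2 * (bias a * bias a) + 2)                  ≡⟨ ∑-+ S _ _ ⟩
  ∑ S (λ a → 2 * (bias a * bias a)) + ∑ S (λ _ → 2)      ≡⟨ cong₂ _+_ (trans (∑-*ˡ S 2 _) (cong (2 *_) (∑-bias² q))) (trans (∑-const S 2) (cong (_* 2) (length-tuples bools q))) ⟩
  2 * (q * 2 ^ q) + 2 ^ q * 2                            ≡⟨ collect q (2 ^ q) ⟩
  suc q * 2 ^ suc q                                      ∎
  where
  open ≡-Reasoning
  S = bitVecs q
  up : Bool → Vec Bool q → ℕ
  up z a = bias (z ∷ a) * bias (z ∷ a)
  collect : ∀ q x → 2 * (q * x) + x * 2 ≡ suc q * (2 * x)
  collect = solve-∀
  square : ∀ x → suc x * suc x + suc x * suc x ≡ 2 * (x * x) + 2 + 4 * x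
  square = solve-∀
  parallelogram : ∀ o z → ∣ suc o - z ∣ * ∣ suc o - z ∣ + ∣ o - suc z ∣ * ∣ o - suc z ∣ ≡ 2 * (∣ o - z ∣ * ∣ o - z ∣) + 2
  parallelogram zero    zero    = refl
  parallelogram zero    (suc z) = eq z
    where
    eq : ∀ z → z * z + suc (suc z) * suc (suc z) ≡ 2 * (suc z * suc z) + 2
    eq = solve-∀
  parallelogram (suc o) zero    rewrite ∣-∣-identityʳ o = eq o
    where
    eq : ∀ z → suc (suc z) * suc (suc z) + z * z ≡ 2 * (suc z * suc z) + 2
    eq = solve-∀
  parallelogram (suc o) (suc z) = parallelogram o z

*-ind-≤ : ∀ {P : Set} (P? : Dec P) {x y} → (P → x ≤ y) → x * ind (does P?) ≤ y
*-ind-≤ (yes p) {x} h = ≤-trans (≤-reflexive (*-identityʳ x)) (h p)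
*-ind-≤ (no _)  {x} h = ≤-trans (≤-reflexive (*-zeroʳ x)) z≤n

ind-≤ : ∀ {P : Set} (P? : Dec P) {y} → (P → 1 ≤ y) → ind (does P?) ≤ y
ind-≤ (yes p) h = h p
ind-≤ (no _)  h = z≤n

unbalanced : ∀ {q} → ℕ → Vec Bool q → Bool
unbalanced {q} E a = does (q <? E * bias a)

-- Squaring the condition bounds the indicator by (E · bias / q)², whose mean is E² / q by
-- `∑-bias²`. Empty vectors are split off because a factor `q` is cancelled.
chebyshev : ∀ E q → q * ∑ (bitVecs q) (ind ∘ unbalanced E) ≤ E * E * 2 ^ q
chebyshev E zero        = z≤n
chebyshev E q@(suc q-1) = *-cancelˡ-≤ q (begin
  q * (q * ∑ S (ind ∘ unbalanced E))        ≡⟨ *-assoc q q _ ⟨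
  q * q * ∑ S (ind ∘ unbalanced E)          ≡⟨ ∑-*ˡ S (q * q) _ ⟨
  ∑ S (λ a → q * q * ind (unbalanced E a))  ≤⟨ ∑-mono S pointwise ⟩
  ∑ S (λ a → E * E * (bias a * bias a))     ≡⟨ ∑-*ˡ S (E * E) _ ⟩
  E * E * ∑ S (λ a → bias a * bias a)       ≡⟨ cong (E * E *_) (∑-bias² q) ⟩
  E * E * (q * 2 ^ q)                       ≡⟨ rearrange (E * E) q (2 ^ q) ⟩
  q * (E * E * 2 ^ q)                       ∎)
  where
  open ≤-Reasoning
  S = bitVecs q
  rearrange : ∀ x y z → x * (y * z) ≡ y * (x * z)
  rearrange = solve-∀
  square : ∀ x y → x * y * (x * y) ≡ x * x * (y * y)
  square = solve-∀
  pointwise : ∀ a → q * q * ind (unbalanced E a) ≤ E * E * (bias a * bias a)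
  pointwise a = *-ind-≤ (q <? E * bias a) (λ p → ≤-trans (*-mono-≤ (<⇒≤ p) (<⇒≤ p)) (≤-reflexive (square E (bias a))))

-- Matrices with few distinct columns

_≟ᵛ_ : ∀ {s} (a c : Vec Bool s) → Dec (a ≡ c)
_≟ᵛ_ = Vec.≡-dec Bool._≟_

_∈ᵛ?_ : ∀ {s t} (a : Vec Bool s) (M : Vec (Vec Bool s) t) → Dec (a VMem.∈ M)
a ∈ᵛ? M = VAny.any? (a ≟ᵛ_) M

columns : ∀ {s t} → Vec (Vec Bool s) t → ℕ
columns {s} M = ∑ (bitVecs s) (λ a → ind (does (a ∈ᵛ? M)))

ind-∧ : ∀ x y → ind (x ∧ y) ≤ ind x * ind y
ind-∧ true  y = ≤-reflexive (sym (+-identityʳ (ind y)))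
ind-∧ false y = z≤n

δ-bitVecs : ∀ {s} (c : Vec Bool s) → ∑ (bitVecs s) (λ a → ind (does (a ≟ᵛ c))) ≤ 1
δ-bitVecs []      = ≤-refl
δ-bitVecs {suc s} (z ∷ c) = begin
  ∑ (bitVecs (suc s)) (λ a → ind (does (a ≟ᵛ (z ∷ c))))                             ≡⟨ ∑-tuples-suc bools s _ ⟩
  ∑ bools (λ y → ∑ (bitVecs s) (λ a → ind (does ((y ∷ a) ≟ᵛ (z ∷ c)))))             ≤⟨ ∑-mono bools (λ y → ∑-mono (bitVecs s) (split y)) ⟩
  ∑ bools (λ y → ∑ (bitVecs s) (λ a → ind (does (y Bool.≟ z)) * ind (does (a ≟ᵛ c)))) ≡⟨ ∑-cong bools (λ y → ∑-*ˡ (bitVecs s) (ind (does (y Bool.≟ z))) (λ a → ind (does (a ≟ᵛ c)))) ⟩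
  ∑ bools (λ y → ind (does (y Bool.≟ z)) * ∑ (bitVecs s) (λ a → ind (does (a ≟ᵛ c)))) ≤⟨ ∑-mono bools (λ y → *-monoʳ-≤ (ind (does (y Bool.≟ z))) (δ-bitVecs c)) ⟩
  ∑ bools (λ y → ind (does (y Bool.≟ z)) * 1)                                       ≤⟨ one z ⟩
  1 ∎
  where
  open ≤-Reasoning
  one : ∀ z → ∑ bools (λ y → ind (does (y Bool.≟ z)) * 1) ≤ 1
  one true  = ≤-refl
  one false = ≤-refl
  split : ∀ y a → ind (does ((y ∷ a) ≟ᵛ (z ∷ c))) ≤ ind (does (y Bool.≟ z)) * ind (does (a ≟ᵛ c))
  split y a = ind-∧ (does (y Bool.≟ z)) (does (a ≟ᵛ c))

padTo : ∀ {g} (xs : List A) → A → length xs ≤ g → Σ (Vec A g) λ v → ∀ {x} → x ∈ xs → x VMem.∈ v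
padTo []       x₀ _        = Vec.replicate _ x₀ , λ ()
padTo (x ∷ xs) x₀ (s≤s le) with padTo xs x₀ le
... | v , sub = x ∷ v , λ { (here eq) → VAny.here eq ; (there p) → VAny.there (sub p) }

1≤∏ : ∀ {s} (v : Vec A s) (f : A → ℕ) → (∀ {x} → x VMem.∈ v → 1 ≤ f x) → 1 ≤ ∏ v f
1≤∏ []      f pos = ≤-refl
1≤∏ (x ∷ v) f pos = *-mono-≤ (pos (VAny.here refl)) (1≤∏ v f (pos ∘ VAny.there))

multiplicity : ∀ {s g} → Vec Bool s → Vec (Vec Bool s) g → ℕ
multiplicity a c = ∑ (Vec.toList c) (λ x → ind (does (a ≟ᵛ x)))

1≤multiplicity : ∀ {s g} {a : Vec Bool s} {c : Vec (Vec Bool s) g} → a VMem.∈ c → 1 ≤ multiplicity a c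
1≤multiplicity {a = a} (VAny.here refl) with a ≟ᵛ a
... | yes _ = s≤s z≤n
... | no ¬p = contradiction refl ¬p
1≤multiplicity (VAny.there p) = ≤-trans (1≤multiplicity p) (m≤n+m _ _)

∑-ind-filter : ∀ {P : A → Set} (P? : ∀ x → Dec (P x)) xs → length (filter P? xs) ≡ ∑ xs (λ x → ind (does (P? x)))
∑-ind-filter P? []       = refl
∑-ind-filter P? (x ∷ xs) with does (P? x)
... | true  = cong suc (∑-ind-filter P? xs)
... | false = ∑-ind-filter P? xs

few : ∀ {s t} → ℕ → Vec (Vec Bool s) t → Bool
few g M = does (columns M ≤? g)

-- A matrix with at most g distinct columns takes all its columns from some g-tuple.
few-bound : ∀ s t g → ∑ (tuples (bitVecs s) t) (ind ∘ few g) ≤ (2 ^ s) ^ g * g ^ t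
few-bound s t g = begin
  -- A union bound over `c`: the product is positive as soon as every column of `M` occurs in `c`,
  -- and its sum over all `M` is the `t`-th power of a sum that is at most `g`.
  ∑ 𝑀 (ind ∘ few g)                                                     ≤⟨ ∑-mono 𝑀 covered ⟩
  ∑ 𝑀 (λ M → ∑ 𝐶 (λ c → ∏ M (λ a → multiplicity a c)))                  ≡⟨ ∑-swap 𝑀 𝐶 _ ⟩
  ∑ 𝐶 (λ c → ∑ 𝑀 (λ M → ∏ M (λ a → multiplicity a c)))                  ≡⟨ ∑-cong 𝐶 (λ c → ∑-tuples-∏ (bitVecs s) t _) ⟩
  ∑ 𝐶 (λ c → ∑ (bitVecs s) (λ a → multiplicity a c) ^ t)                ≤⟨ ∑-mono 𝐶 (λ c → ^-monoˡ-≤ t (total c)) ⟩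
  ∑ 𝐶 (λ _ → g ^ t)                                                     ≡⟨ ∑-const 𝐶 (g ^ t) ⟩
  length 𝐶 * g ^ t                                                      ≡⟨ cong (_* g ^ t) (trans (length-tuples (bitVecs s) g) (cong (_^ g) (length-tuples bools s))) ⟩
  (2 ^ s) ^ g * g ^ t ∎
  where
  open ≤-Reasoning
  𝑀 = tuples (bitVecs s) t
  𝐶 = tuples (bitVecs s) g
  total : ∀ {h} (c : Vec (Vec Bool s) h) → ∑ (bitVecs s) (λ a → multiplicity a c) ≤ h
  total {h} c = begin
    ∑ (bitVecs s) (λ a → multiplicity a c)                                       ≡⟨ ∑-swap (bitVecs s) (Vec.toList c) _ ⟩
    ∑ (Vec.toList c) (λ x → ∑ (bitVecs s) (λ a → ind (does (a ≟ᵛ x))))           ≤⟨ ∑-mono (Vec.toList c) δ-bitVecs ⟩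
    ∑ (Vec.toList c) (λ _ → 1)                                                   ≡⟨ length≡∑1 (Vec.toList c) ⟨
    length (Vec.toList c)                                                        ≡⟨ Vec.length-toList c ⟩
    h                                                                            ∎
  covered : ∀ M → ind (few g M) ≤ ∑ 𝐶 (λ c → ∏ M (λ a → multiplicity a c))
  covered M = ind-≤ (columns M ≤? g) λ le →
    let c , sub = padTo (filter (_∈ᵛ? M) (bitVecs s)) (Vec.replicate s false)
                    (≤-trans (≤-reflexive (∑-ind-filter (_∈ᵛ? M) (bitVecs s))) le)
    in ≤-trans
      (1≤∏ M _ (λ a∈M → 1≤multiplicity (sub (∈-filter⁺ (_∈ᵛ? M) (∈-tuples ∈-bools _) a∈M))))
      (∑-member _ (∈-tuples (∈-tuples ∈-bools) c))

-- Lists without repetition and unordered pairs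

Unique-resp-↭ : {xs ys : List A} → xs ↭ ys → Unique xs → Unique ys
Unique-resp-↭ {A} p = SetoidPerm.Unique-resp-↭ (setoid A) (↭⇒↭ₛ p)

-- The complement `zs` is kept as a list, since lengths and weighted sums over `ys` are both split
-- along it later.
unique-⊆ : {xs ys : List A} → Unique xs → (∀ {x} → x ∈ xs → x ∈ ys) → ∃ λ zs → ys ↭ xs ++ zs
unique-⊆ {xs = []}     {ys} _        _   = ys , ↭-refl
unique-⊆ {xs = x ∷ xs} {ys} (x∉ ∷ u) sub with ∈-∃++ (sub (here refl))
... | ps , qs , refl with unique-⊆ {ys = ps ++ qs} u inRest
  where
  inRest : ∀ {y} → y ∈ xs → y ∈ ps ++ qs
  inRest {y} y∈ with Perm.∈-resp-↭ (Perm.shift x ps qs) (sub (there y∈))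
  ... | here refl = contradiction refl (All.lookup x∉ y∈)
  ... | there p   = p
...   | zs , p = zs , ↭-trans (Perm.shift x ps qs) (prep x p)

unique-⊆-length : {xs ys : List A} → Unique xs → (∀ {x} → x ∈ xs → x ∈ ys) → length xs ≤ length ys
unique-⊆-length {xs = xs} u sub with unique-⊆ u sub
... | zs , p = ≤-trans (m≤m+n (length xs) (length zs))
                 (≤-reflexive (sym (trans (Perm.↭-length p) (length-++ xs))))

unique-map-injective : {f : A → B} {xs : List A} → Unique (map f xs) →
                       ∀ {x y} → x ∈ xs → y ∈ xs → f x ≡ f y → x ≡ y
unique-map-injective (x∉ ∷ u) (here refl) (here refl) eq = refl
unique-map-injective {f = f} (x∉ ∷ u) (here refl) (there y∈) eq = contradiction eq (All.lookup x∉ (∈-map⁺ f y∈))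
unique-map-injective {f = f} (x∉ ∷ u) (there x∈) (here refl) eq = contradiction (sym eq) (All.lookup x∉ (∈-map⁺ f x∈))
unique-map-injective (x∉ ∷ u) (there x∈) (there y∈) eq = unique-map-injective u x∈ y∈ eq

pairs : List A → List (A × A)
pairs []       = []
pairs (x ∷ xs) = map (x ,_) xs ++ pairs xs

length-pairs : (xs : List A) → 2 * length (pairs xs) ≡ length xs * (length xs ∸ 1)
length-pairs []       = refl
length-pairs (x ∷ xs) = begin
  2 * length (map (x ,_) xs ++ pairs xs)         ≡⟨ cong (2 *_) (trans (length-++ (map (x ,_) xs)) (cong (_+ _) (length-map (x ,_) xs))) ⟩
  2 * (l + length (pairs xs))                    ≡⟨ *-distribˡ-+ 2 l _ ⟩
  2 * l + 2 * length (pairs xs)                  ≡⟨ cong (2 * l +_) (length-pairs xs) ⟩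
  2 * l + l * (l ∸ 1)                            ≡⟨ triangle l ⟩
  suc l * l                                      ∎
  where
  open ≡-Reasoning
  l = length xs
  eq : ∀ l → 2 * suc l + suc l * l ≡ suc (suc l) * suc l
  eq = solve-∀
  triangle : ∀ l → 2 * l + l * (l ∸ 1) ≡ suc l * l
  triangle zero    = refl
  triangle (suc l) = eq l

∈-pairs : {xs : List A} {x y : A} → x ∈ xs → y ∈ xs → x ≢ y → (x , y) ∈ pairs xs ⊎ (y , x) ∈ pairs xs
∈-pairs (here refl) (here refl) x≢y = contradiction refl x≢y
∈-pairs (here refl) (there y∈)  x≢y = inj₁ (∈-++⁺ˡ (∈-map⁺ _ y∈))
∈-pairs (there x∈)  (here refl) x≢y = inj₂ (∈-++⁺ˡ (∈-map⁺ _ x∈))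
∈-pairs {xs = z ∷ xs} (there x∈) (there y∈) x≢y with ∈-pairs x∈ y∈ x≢y
... | inj₁ p = inj₁ (∈-++⁺ʳ (map (z ,_) xs) p)
... | inj₂ p = inj₂ (∈-++⁺ʳ (map (z ,_) xs) p)

pairs-∈ : {xs : List A} {x y : A} → (x , y) ∈ pairs xs → x ∈ xs × y ∈ xs
pairs-∈ {xs = z ∷ xs} p with ∈-++⁻ (map (z ,_) xs) p
... | inj₂ q = Prod.map there there (pairs-∈ q)
... | inj₁ q with ∈-map⁻ (z ,_) q
...   | _ , y∈ , refl = here refl , there y∈

pairs-≢ : {xs : List A} → Unique xs → ∀ {x y} → (x , y) ∈ pairs xs → x ≢ y
pairs-≢ {xs = z ∷ xs} (z∉ ∷ u) p with ∈-++⁻ (map (z ,_) xs) p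
... | inj₂ q = pairs-≢ u q
... | inj₁ q with ∈-map⁻ (z ,_) q
...   | _ , y∈ , refl = All.lookup z∉ y∈

unique-pairs : {xs : List A} → Unique xs → Unique (pairs xs)
unique-pairs []                   = []
unique-pairs {xs = z ∷ xs} (z∉ ∷ u) =
  Unique.++⁺ (Unique.map⁺ Prod.,-injectiveʳ u) (unique-pairs u) disjoint
  where
  disjoint : Disjoint (map (z ,_) xs) (pairs xs)
  disjoint (p , q) with ∈-map⁻ (z ,_) p
  ... | _ , _ , refl = All.lookup z∉ (proj₁ (pairs-∈ q)) refl

-- Closed walks

walk : A → List A → A → List (A × A)
walk x []       y = (x , y) ∷ []
walk x (z ∷ zs) y = (x , z) ∷ walk z zs y

closedWalk : List A → List (A × A)
closedWalk []       = []
closedWalk (x ∷ xs) = walk x xs x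

cycleArcs≡closedWalk : ∀ {n} (c : List (Fin n)) → cycleArcs c ≡ closedWalk c
cycleArcs≡closedWalk []       = refl
cycleArcs≡closedWalk (x ∷ xs) = zip-walk x xs x
  where
  zip-walk : ∀ {n} (x : Fin n) xs y → zip (x ∷ xs) (xs ++ [ y ]) ≡ walk x xs y
  zip-walk x []       y = refl
  zip-walk x (z ∷ zs) y = cong ((x , z) ∷_) (zip-walk z zs y)

walk-++ : ∀ (x : A) xs z ys y → walk x (xs ++ z ∷ ys) y ≡ walk x xs z ++ walk z ys y
walk-++ x []       z ys y = refl
walk-++ x (w ∷ ws) z ys y = cong ((x , w) ∷_) (walk-++ w ws z ys y)

walk-map : ∀ (f : A → B) x xs y → walk (f x) (map f xs) (f y) ≡ map (Prod.map f f) (walk x xs y)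
walk-map f x []       y = refl
walk-map f x (z ∷ zs) y = cong ((f x , f z) ∷_) (walk-map f z zs y)

closedWalk-map : ∀ (f : A → B) c → closedWalk (map f c) ≡ map (Prod.map f f) (closedWalk c)
closedWalk-map f []       = refl
closedWalk-map f (x ∷ xs) = walk-map f x xs x

walk-sources : ∀ (x : A) xs y → map proj₁ (walk x xs y) ≡ x ∷ xs
walk-sources x []       y = refl
walk-sources x (z ∷ zs) y = cong (x ∷_) (walk-sources z zs y)

walk-targets : ∀ (x : A) xs y → map proj₂ (walk x xs y) ≡ xs ++ [ y ]
walk-targets x []       y = refl
walk-targets x (z ∷ zs) y = cong (z ∷_) (walk-targets z zs y)

closedWalk-sources : (c : List A) → map proj₁ (closedWalk c) ≡ c
closedWalk-sources []       = refl
closedWalk-sources (x ∷ xs) = walk-sources x xs x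

closedWalk-targets : (c : List A) → map proj₂ (closedWalk c) ↭ c
closedWalk-targets []       = ↭-refl
closedWalk-targets (x ∷ xs) = ↭-trans (↭-reflexive (walk-targets x xs x)) (Perm.++-comm xs [ x ])

length-closedWalk : (c : List A) → length (closedWalk c) ≡ length c
length-closedWalk c = trans (sym (length-map proj₁ (closedWalk c))) (cong length (closedWalk-sources c))

unique-closedWalk : {c : List A} → Unique c → Unique (closedWalk c)
unique-closedWalk {c = c} u = Unique.map⁻ (subst Unique (sym (closedWalk-sources c)) u)

walk-reverse : ∀ (x : A) xs y → walk y (reverse xs) x ↭ map swap (walk x xs y)
walk-reverse x []       y = ↭-refl
walk-reverse x (z ∷ zs) y = ↭-trans (↭-reflexive eq)
  (↭-trans (Perm.++-comm (walk y (reverse zs) z) _) (prep (z , x) (walk-reverse z zs y)))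
  where
  eq : walk y (reverse (z ∷ zs)) x ≡ walk y (reverse zs) z ++ walk z [] x
  eq = trans (cong (λ ws → walk y ws x) (unfold-reverse z zs)) (walk-++ y (reverse zs) z [] x)

reverseCycle : List A → List A
reverseCycle []       = []
reverseCycle (x ∷ xs) = x ∷ reverse xs

closedWalk-reverse : (c : List A) → closedWalk (reverseCycle c) ↭ map swap (closedWalk c)
closedWalk-reverse []       = ↭-refl
closedWalk-reverse (x ∷ xs) = walk-reverse x xs x

reverseCycle-↭ : (c : List A) → reverseCycle c ↭ c
reverseCycle-↭ []       = ↭-refl
reverseCycle-↭ (x ∷ xs) = prep x (Perm.↭-reverse xs)

closedWalk-rotate : ∀ (xs : List A) z ys → closedWalk (z ∷ ys ++ xs) ↭ closedWalk (xs ++ z ∷ ys)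
closedWalk-rotate []       z ys = ↭-reflexive (cong (λ ws → closedWalk (z ∷ ws)) (++-identityʳ ys))
closedWalk-rotate (x ∷ xs) z ys = ↭-trans (↭-reflexive (walk-++ z ys x xs z))
  (↭-trans (Perm.++-comm (walk z ys x) (walk x xs z)) (↭-reflexive (sym (walk-++ x xs z ys x))))

walk-applyUpTo : ∀ (f : ℕ → A) l y {i} → i < l → (f i , f (suc i)) ∈ walk (f 0) (applyUpTo (f ∘ suc) l) y
walk-applyUpTo f (suc l) y {zero}  _         = here refl
walk-applyUpTo f (suc l) y {suc i} (s≤s i<l) = there (walk-applyUpTo (f ∘ suc) l y i<l)

walk-applyUpTo-last : ∀ (f : ℕ → A) l y → (f l , y) ∈ walk (f 0) (applyUpTo (f ∘ suc) l) y
walk-applyUpTo-last f zero    y = here refl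
walk-applyUpTo-last f (suc l) y = there (walk-applyUpTo-last (f ∘ suc) l y)

-- Copies of the directed cycle

AllArcs : ∀ {n} → Digraph n → List (Arc n) → Set
AllArcs D = All (λ a → D (proj₁ a) (proj₂ a) ≡ true)

does-true : ∀ {P : Set} (P? : Dec P) → does P? ≡ true → P
does-true (yes p) _ = p

∧-true : ∀ {x y} → (x ∧ y) ≡ true → x ≡ true × y ≡ true
∧-true {true} {true} _ = refl , refl

allB⁻ : ∀ (p : A → Bool) xs → allB p xs ≡ true → All (λ x → p x ≡ true) xs
allB⁻ p []       _  = []
allB⁻ p (x ∷ xs) eq with ∧-true eq
... | px , pxs = px ∷ allB⁻ p xs pxs

allB⁺ : ∀ (p : A → Bool) {xs} → All (λ x → p x ≡ true) xs → allB p xs ≡ true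
allB⁺ p []         = refl
allB⁺ p (px ∷ pxs) = cong₂ _∧_ px (allB⁺ p pxs)

record Copy {n} (D : Digraph n) (k : ℕ) (x : Fin n) (xs : List (Fin n)) : Set where
  field
    size   : length (x ∷ xs) ≡ k
    unique : Unique (x ∷ xs)
    least  : All (λ v → toℕ x ≤ toℕ v) xs
    arcs   : AllArcs D (cycleArcs (x ∷ xs))

isCopy⁻ : ∀ {n} (D : Digraph n) k x xs → IsCopy D k (x ∷ xs) → Copy D k x xs
isCopy⁻ {n} D k x xs eq with ∧-true {does (length (x ∷ xs) ≟ k)} eq
... | eq₁ , rest with ∧-true {does (UDec.unique? (Fin._≟_ {n}) (x ∷ xs))} rest
...   | eq₂ , rest′ with ∧-true {allB (λ v → toℕ x ≤ᵇ toℕ v) xs} rest′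
...     | eq₃ , eq₄ = record
  { size   = does-true (length (x ∷ xs) ≟ k) eq₁
  ; unique = does-true (UDec.unique? Fin._≟_ (x ∷ xs)) eq₂
  ; least  = All.map (λ {v} e → does-true (toℕ x ≤? toℕ v) e) (allB⁻ _ xs eq₃)
  ; arcs   = allB⁻ _ (cycleArcs (x ∷ xs)) eq₄
  }

isCopy⁺ : ∀ {n} (D : Digraph n) k x xs → Copy D k x xs → IsCopy D k (x ∷ xs)
isCopy⁺ {n} D k x xs c = cong₂ _∧_ (dec-true (length (x ∷ xs) ≟ k) size)
  (cong₂ _∧_ (dec-true (UDec.unique? (Fin._≟_ {n}) (x ∷ xs)) unique)
  (cong₂ _∧_ (allB⁺ _ (All.map (λ {v} le → dec-true (toℕ x ≤? toℕ v) le) least)) (allB⁺ _ arcs)))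
  where open Copy c

least-split : ∀ {n} (x : Fin n) xs → ∃ λ ys → ∃ λ m → ∃ λ zs → x ∷ xs ≡ ys ++ m ∷ zs × All (λ v → toℕ m ≤ toℕ v) (x ∷ xs)
least-split x []       = [] , x , [] , refl , ≤-refl ∷ []
least-split x (y ∷ xs) with least-split y xs
... | ys , m , zs , eq , m≤ with ≤-total (toℕ x) (toℕ m)
...   | inj₁ x≤m = [] , x , y ∷ xs , refl , ≤-refl ∷ All.map (≤-trans x≤m) m≤
...   | inj₂ m≤x = x ∷ ys , m , zs , cong (x ∷_) eq , m≤x ∷ m≤

-- A copy must begin at its least vertex. Rotating a cycle to start there only permutes its arcs, so
-- whatever is known of its arc set carries over.
canonicalCopy : ∀ {n} (D : Digraph n) c → 1 ≤ length c → Unique c → AllArcs D (closedWalk c) →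
                ∃ λ c′ → IsCopy D (length c) c′ × cycleArcs c′ ↭ closedWalk c
canonicalCopy D (x ∷ xs) _ u arcs with least-split x xs
... | ys , m , zs , eq , m≤ = m ∷ zs ++ ys , isCopy⁺ D _ m (zs ++ ys) copy , same
  where
  rotate : x ∷ xs ↭ m ∷ zs ++ ys
  rotate = ↭-trans (↭-reflexive eq) (Perm.++-comm ys (m ∷ zs))
  same : cycleArcs (m ∷ zs ++ ys) ↭ closedWalk (x ∷ xs)
  same = ↭-trans (↭-reflexive (cycleArcs≡closedWalk (m ∷ zs ++ ys)))
    (↭-trans (closedWalk-rotate ys m zs) (↭-reflexive (cong closedWalk (sym eq))))
  copy : Copy D (length (x ∷ xs)) m (zs ++ ys)
  copy = record
    { size   = sym (Perm.↭-length rotate)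
    ; unique = Unique-resp-↭ rotate u
    ; least  = All.tail (Perm.All-resp-↭ rotate m≤)
    ; arcs   = Perm.All-resp-↭ (↭-sym same) arcs
    }

-- The list of vertices and counting by indicators

vertices≡allFin : ∀ n → vertices n ≡ allFin n
vertices≡allFin n = toList-tabulate id
  where
  toList-tabulate : ∀ {n} (f : Fin n → A) → Vec.toList (Vec.tabulate f) ≡ Data.List.tabulate f
  toList-tabulate {n = zero}  f = refl
  toList-tabulate {n = suc n} f = cong (f zero ∷_) (toList-tabulate (f ∘ suc))

∈-vertices : ∀ {n} (v : Fin n) → v ∈ vertices n
∈-vertices {n} v = subst (v ∈_) (sym (vertices≡allFin n)) (∈-allFin v)

unique-vertices : ∀ n → Unique (vertices n)
unique-vertices n = subst Unique (sym (vertices≡allFin n)) (Unique.allFin⁺ n)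

length-vertices : ∀ n → length (vertices n) ≡ n
length-vertices n = Vec.length-toList (Vec.allFin n)

∑-↭ : ∀ {xs ys : List A} (f : A → ℕ) → xs ↭ ys → ∑ xs f ≡ ∑ ys f
∑-↭ f _↭_.refl         = refl
∑-↭ f (_↭_.prep x p)   = cong (f x +_) (∑-↭ f p)
∑-↭ f (_↭_.swap x y p) = trans (cong (λ s → f x + (f y + s)) (∑-↭ f p)) (exchange (f x) (f y) _)
  where
  exchange : ∀ a b c → a + (b + c) ≡ b + (a + c)
  exchange = solve-∀
∑-↭ f (_↭_.trans p q)  = trans (∑-↭ f p) (∑-↭ f q)

module _ (_≟_ : (x y : A) → Dec (x ≡ y)) where

  count-∉ : ∀ {x xs} → x ∉ xs → ∑ xs (λ y → ind (does (y ≟ x))) ≡ 0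
  count-∉ {xs = []}     x∉ = refl
  count-∉ {x} {y ∷ xs}  x∉ = cong₂ _+_ (cong ind (dec-false (y ≟ x) (λ { refl → x∉ (here refl) }))) (count-∉ (x∉ ∘ there))

  count-∈ : ∀ {x xs} → Unique xs → x ∈ xs → ∑ xs (λ y → ind (does (y ≟ x))) ≡ 1
  count-∈ {x} (y∉ ∷ u) (here refl) =
    cong₂ _+_ (cong ind (dec-true (x ≟ x) refl)) (count-∉ (λ x∈ → All.lookup y∉ x∈ refl))
  count-∈ {x} {y ∷ _} (y∉ ∷ u) (there x∈) =
    cong₂ _+_ (cong ind (dec-false (y ≟ x) (All.lookup y∉ x∈))) (count-∈ u x∈)

δ : ∀ {n} → Fin n → Fin n → ℕ
δ u v = ind (does (u Fin.≟ v))

δ-sym : ∀ {n} (x y : Fin n) → δ x y ≡ δ y x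
δ-sym x y with x Fin.≟ y
... | yes refl = sym (cong ind (dec-true (x Fin.≟ x) refl))
... | no x≢y   = sym (cong ind (dec-false (y Fin.≟ x) (x≢y ∘ sym)))

∑-vertices-δ : ∀ {n} (v : Fin n) → ∑ (vertices n) (λ u → δ u v) ≡ 1
∑-vertices-δ v = count-∈ Fin._≟_ (unique-vertices _) (∈-vertices v)

-- Digraphs decomposed into copies of the directed k-cycle

record Decomposition {n} (T : Digraph n) (k : ℕ) : Set where
  field
    parts    : List (List (Fin n))
    packing  : IsPacking T k parts
    complete : ∀ u v → T u v ≡ true → (u , v) ∈ concatMap cycleArcs parts

length-copyArcs : ∀ {n} (D : Digraph n) k c → IsCopy D k c → length (cycleArcs c) ≡ k
length-copyArcs D k (x ∷ xs) ic = trans (cong length (cycleArcs≡closedWalk (x ∷ xs)))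
  (trans (length-closedWalk (x ∷ xs)) (Copy.size (isCopy⁻ D k x xs ic)))

copyArcs : ∀ {n} (D : Digraph n) k c → IsCopy D k c → AllArcs D (cycleArcs c)
copyArcs D k (x ∷ xs) ic = Copy.arcs (isCopy⁻ D k x xs ic)

copyUnique : ∀ {n} (D : Digraph n) k c → IsCopy D k c → Unique c
copyUnique D k (x ∷ xs) ic = Copy.unique (isCopy⁻ D k x xs ic)

unique-copyArcs : ∀ {n} (D : Digraph n) k c → IsCopy D k c → Unique (cycleArcs c)
unique-copyArcs D k c ic = subst Unique (sym (cycleArcs≡closedWalk c)) (unique-closedWalk (copyUnique D k c ic))

length-packingArcs : ∀ {n} (D : Digraph n) k P → All (IsCopy D k) P → length (concatMap cycleArcs P) ≡ length P * k
length-packingArcs D k []      []         = refl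
length-packingArcs D k (c ∷ P) (ic ∷ ics) = trans (length-++ (cycleArcs c))
  (cong₂ _+_ (length-copyArcs D k c ic) (length-packingArcs D k P ics))

packingArcs : ∀ {n} (D : Digraph n) k P → All (IsCopy D k) P → AllArcs D (concatMap cycleArcs P)
packingArcs D k []      []         = []
packingArcs D k (c ∷ P) (ic ∷ ics) = All.++⁺ (copyArcs D k c ic) (packingArcs D k P ics)

module _ {n} {T : Digraph n} {k} .{{_ : NonZero k}} (dec : Decomposition T k) where
  open Decomposition dec

  private
    arcsT : List (Arc n)
    arcsT = concatMap cycleArcs parts

  -- Every copy takes `k` arcs, and the parts already use up the arcs of `T`.
  decomposition-ν : IsNu T k (length parts)
  decomposition-ν = (parts , packing , refl) , λ P P-packing → *-cancelʳ-≤ (length P) (length parts) k (begin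
    length P * k                      ≡⟨ length-packingArcs T k P (proj₁ P-packing) ⟨
    length (concatMap cycleArcs P)    ≤⟨ unique-⊆-length (proj₂ P-packing) (λ a∈ → complete _ _ (All.lookup (packingArcs T k P (proj₁ P-packing)) a∈)) ⟩
    length arcsT                      ≡⟨ length-packingArcs T k parts (proj₁ packing) ⟩
    length parts * k                  ∎)
    where open ≤-Reasoning

  private
    ind-T : ∀ u v → ind (T u v) ≡ ∑ arcsT (λ a → ind (does (a ≟ᵃ (u , v))))
    ind-T u v with T u v in eq
    ... | true  = sym (count-∈ _≟ᵃ_ (proj₂ packing) (complete u v eq))
    ... | false = sym (count-∉ _≟ᵃ_ (λ a∈ → case trans (sym eq) (All.lookup (packingArcs T k parts (proj₁ packing)) a∈) of λ ()))

    δ-pair : ∀ (a : Arc n) u v → ind (does (a ≟ᵃ (u , v))) ≡ δ (proj₁ a) u * δ (proj₂ a) v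
    δ-pair (x , y) u v with x Fin.≟ u
    ... | no _     = refl
    ... | yes refl with y Fin.≟ v
    ...   | yes refl = refl
    ...   | no _     = refl

    degree-via : (side : Arc n → Fin n) → ℕ → Fin n → Set
    degree-via side d v = d ≡ ∑ parts (λ c → ∑ (map side (cycleArcs c)) (λ x → δ x v))

    through-parts : ∀ (side : Arc n → Fin n) v →
      ∑ arcsT (λ a → δ (side a) v) ≡ ∑ parts (λ c → ∑ (map side (cycleArcs c)) (λ x → δ x v))
    through-parts side v = trans (∑-concatMap cycleArcs parts _)
      (∑-cong parts (λ c → sym (∑-map side (cycleArcs c) _)))

    out-degree : ∀ v → degree-via proj₁ (∑ (vertices n) (λ j → ind (T v j))) v
    out-degree v = begin
      ∑ (vertices n) (λ j → ind (T v j))                                             ≡⟨ ∑-cong (vertices n) (ind-T v) ⟩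
      ∑ (vertices n) (λ j → ∑ arcsT (λ a → ind (does (a ≟ᵃ (v , j)))))               ≡⟨ ∑-swap (vertices n) arcsT _ ⟩
      ∑ arcsT (λ a → ∑ (vertices n) (λ j → ind (does (a ≟ᵃ (v , j)))))               ≡⟨ ∑-cong arcsT once ⟩
      ∑ arcsT (λ a → δ (proj₁ a) v)                                                  ≡⟨ through-parts proj₁ v ⟩
      _                                                                              ∎
      where
      open ≡-Reasoning
      once : ∀ a → ∑ (vertices n) (λ j → ind (does (a ≟ᵃ (v , j)))) ≡ δ (proj₁ a) v
      once a = trans (∑-cong (vertices n) (λ j → trans (δ-pair a v j) (cong (δ (proj₁ a) v *_) (δ-sym (proj₂ a) j))))
        (trans (∑-*ˡ (vertices n) (δ (proj₁ a) v) _) (trans (cong (δ (proj₁ a) v *_) (∑-vertices-δ (proj₂ a))) (*-identityʳ _)))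

    in-degree : ∀ v → degree-via proj₂ (∑ (vertices n) (λ j → ind (T j v))) v
    in-degree v = begin
      ∑ (vertices n) (λ j → ind (T j v))                                             ≡⟨ ∑-cong (vertices n) (λ j → ind-T j v) ⟩
      ∑ (vertices n) (λ j → ∑ arcsT (λ a → ind (does (a ≟ᵃ (j , v)))))               ≡⟨ ∑-swap (vertices n) arcsT _ ⟩
      ∑ arcsT (λ a → ∑ (vertices n) (λ j → ind (does (a ≟ᵃ (j , v)))))               ≡⟨ ∑-cong arcsT once ⟩
      ∑ arcsT (λ a → δ (proj₂ a) v)                                                  ≡⟨ through-parts proj₂ v ⟩
      _                                                                              ∎
      where
      open ≡-Reasoning
      once : ∀ a → ∑ (vertices n) (λ j → ind (does (a ≟ᵃ (j , v)))) ≡ δ (proj₂ a) v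
      once a = trans (∑-cong (vertices n) (λ j → trans (δ-pair a j v) (cong (_* δ (proj₂ a) v) (δ-sym (proj₁ a) j))))
        (trans (∑-*ʳ (vertices n) _ (δ (proj₂ a) v)) (trans (cong (_* δ (proj₂ a) v) (∑-vertices-δ (proj₁ a))) (*-identityˡ _)))

    -- A closed walk leaves each vertex as often as it enters it, because its sources and its
    -- targets are the same vertices with multiplicity.
    balanced-degrees : ∀ v → ∑ (vertices n) (λ j → ind (T v j)) ≡ ∑ (vertices n) (λ j → ind (T j v))
    balanced-degrees v = trans (out-degree v) (trans (∑-cong parts (λ c → ∑-↭ _ (ends c))) (sym (in-degree v)))
      where
      ends : ∀ c → map proj₁ (cycleArcs c) ↭ map proj₂ (cycleArcs c)
      ends c rewrite cycleArcs≡closedWalk c =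
        ↭-trans (↭-reflexive (closedWalk-sources c)) (↭-sym (closedWalk-targets c))

  -- The two degrees of a vertex of a tournament add up to n - 1, so equal degrees are both half of
  -- it. The term `δ j v` fills in for the absent loop, which makes each summand exactly 1.
  decomposition-regular : IsTournament T → IsRegular T
  decomposition-regular (loopless , semicomplete) = ⌊ n ∸ 1 /2⌋ , λ v → trans (outdeg≡ v) (half _ (double v))
    where
    open ≡-Reasoning
    out : Fin n → ℕ
    out v = ∑ (vertices n) (λ j → ind (T v j))
    sum-map : ∀ (f : Fin n → ℕ) xs → Data.Nat.ListAction.sum (map f xs) ≡ ∑ xs f
    sum-map f []       = refl
    sum-map f (x ∷ xs) = cong (f x +_) (sum-map f xs)
    outdeg≡ : ∀ v → outdeg T v ≡ out v
    outdeg≡ v = sum-map _ (vertices n)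
    half : ∀ x → x + x ≡ n ∸ 1 → x ≡ ⌊ n ∸ 1 /2⌋
    half x eq = trans (n≡⌊n+n/2⌋ x) (cong ⌊_/2⌋ eq)
    one : ∀ v j → ind (T v j) + ind (T j v) + δ j v ≡ 1
    one v j with j Fin.≟ v
    ... | yes refl rewrite loopless j = refl
    ... | no j≢v rewrite semicomplete v j (j≢v ∘ sym) with T j v
    ...   | true  = refl
    ...   | false = refl
    double : ∀ v → out v + out v ≡ n ∸ 1
    double v = begin
      out v + out v                                                      ≡⟨ cong (out v +_) (balanced-degrees v) ⟩
      out v + ∑ (vertices n) (λ j → ind (T j v))                         ≡⟨ ∑-+ (vertices n) _ _ ⟨
      s                                                                  ≡⟨ m+n∸n≡m s 1 ⟨
      s + 1 ∸ 1                                                          ≡⟨ cong (λ x → s + x ∸ 1) (∑-vertices-δ v) ⟨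
      s + ∑ (vertices n) (λ j → δ j v) ∸ 1                               ≡⟨ cong (_∸ 1) (∑-+ (vertices n) _ _) ⟨
      ∑ (vertices n) (λ j → ind (T v j) + ind (T j v) + δ j v) ∸ 1       ≡⟨ cong (_∸ 1) (∑-cong (vertices n) (one v)) ⟩
      ∑ (vertices n) (λ _ → 1) ∸ 1                                       ≡⟨ cong (_∸ 1) (trans (sym (length≡∑1 (vertices n))) (length-vertices n)) ⟩
      n ∸ 1                                                              ∎
      where s = ∑ (vertices n) (λ j → ind (T v j) + ind (T j v))

-- Orientations of an undirected cycle system

-- Edge-disjointness is encoded by `cover` together with `count`, so that an explicit construction
-- has to verify only a covering and a number.
record CycleSystem (k n : ℕ) : Set where
  field
    cycles   : List (List (Fin n))
    size     : All (λ c → length c ≡ k) cycles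
    distinct : All Unique cycles
    cover    : ∀ u v → u ≢ v → ∃ λ c → c ∈ cycles × ((u , v) ∈ closedWalk c ⊎ (v , u) ∈ closedWalk c)
    count    : 2 * (k * length cycles) ≡ n * (n ∸ 1)

⊆-length-↭ : {xs ys : List A} → Unique xs → (∀ {x} → x ∈ xs → x ∈ ys) → length ys ≤ length xs → ys ↭ xs
⊆-length-↭ {xs = xs} {ys} u sub le with unique-⊆ u sub
... | []     , p = ↭-trans p (↭-reflexive (++-identityʳ xs))
... | z ∷ zs , p = contradiction le (<⇒≱ (begin-strict
  length xs                     <⟨ m<m+n (length xs) z<s ⟩
  length xs + length (z ∷ zs)   ≡⟨ length-++ xs ⟨
  length (xs ++ z ∷ zs)         ≡⟨ Perm.↭-length p ⟨
  length ys                     ∎))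
  where open ≤-Reasoning

pairs-asym : {xs : List A} → Unique xs → ∀ {x y} → (x , y) ∈ pairs xs → (y , x) ∉ pairs xs
pairs-asym {xs = z ∷ xs} (z∉ ∷ u) p q with ∈-++⁻ (map (z ,_) xs) p | ∈-++⁻ (map (z ,_) xs) q
... | inj₂ p′ | inj₂ q′ = pairs-asym u p′ q′
... | inj₁ p′ | inj₁ q′ with ∈-map⁻ (z ,_) p′ | ∈-map⁻ (z ,_) q′
...   | _ , y∈ , refl | _ , _ , refl = All.lookup z∉ y∈ refl
pairs-asym {xs = z ∷ xs} (z∉ ∷ u) p q | inj₁ p′ | inj₂ q′ with ∈-map⁻ (z ,_) p′
... | _ , _ , refl = All.lookup z∉ (proj₂ (pairs-∈ q′)) refl
pairs-asym {xs = z ∷ xs} (z∉ ∷ u) p q | inj₂ p′ | inj₁ q′ with ∈-map⁻ (z ,_) q′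
... | _ , _ , refl = All.lookup z∉ (proj₂ (pairs-∈ p′)) refl

∈-concatMap⁻ : ∀ (h : A → List B) xs {y} → y ∈ concatMap h xs → ∃ λ x → x ∈ xs × y ∈ h x
∈-concatMap⁻ h (x ∷ xs) y∈ with ∈-++⁻ (h x) y∈
... | inj₁ p = x , here refl , p
... | inj₂ p = Prod.map₂ (Prod.map₁ there) (∈-concatMap⁻ h xs p)

unique-concatMap : ∀ (h : A → List B) {xs} → Unique xs → (∀ x → Unique (h x)) →
                   (∀ {x x′ y} → y ∈ h x → y ∈ h x′ → x ≡ x′) → Unique (concatMap h xs)
unique-concatMap h []       uh inj = []
unique-concatMap h {x ∷ xs} (x∉ ∷ u) uh inj = Unique.++⁺ (uh x) (unique-concatMap h u uh inj) disjoint
  where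
  disjoint : Disjoint (h x) (concatMap h xs)
  disjoint (p , q) with ∈-concatMap⁻ h xs q
  ... | x′ , x′∈ , q′ = All.lookup x∉ x′∈ (inj p q′)

arc-ends : ∀ {c : List A} {x y} → (x , y) ∈ closedWalk c → x ∈ c × y ∈ c
arc-ends {c = c} a∈ = subst (_ ∈_) (closedWalk-sources c) (∈-map⁺ proj₁ a∈) ,
                      Perm.∈-resp-↭ (closedWalk-targets c) (∈-map⁺ proj₂ a∈)

module Orientation {k n : ℕ} (CS : CycleSystem k n) (i₀ : Fin (length (CycleSystem.cycles CS))) (3≤k : 3 ≤ k) where
  open CycleSystem CS

  L : ℕ
  L = length cycles

  cyc : Fin L → List (Fin n)
  cyc = Data.List.lookup cycles

  cyc-size : ∀ i → length (cyc i) ≡ k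
  cyc-size i = All.lookup size (∈-lookup i)

  cyc-unique : ∀ i → Unique (cyc i)
  cyc-unique i = All.lookup distinct (∈-lookup i)

  private
    V = vertices n

    slots : List (Fin L × Arc n)
    slots = concatMap (λ i → map (i ,_) (closedWalk (cyc i))) (allFin L)

    edges : List (Arc n)
    edges = pairs V

    _∈edges? : ∀ a → Dec (a ∈ edges)
    a ∈edges? = Any.any? (a ≟ᵃ_) edges

    norm : Arc n → Arc n
    norm a = if does (a ∈edges?) then a else swap a

    norm-id : ∀ {a} → a ∈ edges → norm a ≡ a
    norm-id {a} a∈ rewrite dec-true (a ∈edges?) a∈ = refl

    norm-swap : ∀ {a} → a ∈ edges → norm (swap a) ≡ a
    norm-swap {a} a∈ rewrite dec-false (swap a ∈edges?) (pairs-asym (unique-vertices n) a∈) = refl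

    ∈-slots : ∀ {i a} → a ∈ closedWalk (cyc i) → (i , a) ∈ slots
    ∈-slots {i} a∈ = ∈-concatMap (∈-allFin i) (∈-map⁺ (i ,_) a∈)

    length-slots : length slots ≡ k * L
    length-slots = begin
      length slots                                                      ≡⟨ length≡∑1 slots ⟩
      ∑ slots (λ _ → 1)                                                 ≡⟨ ∑-concatMap _ (allFin L) _ ⟩
      ∑ (allFin L) (λ i → ∑ (map (i ,_) (closedWalk (cyc i))) (λ _ → 1)) ≡⟨ ∑-cong (allFin L) each ⟩
      ∑ (allFin L) (λ _ → k)                                            ≡⟨ ∑-const (allFin L) k ⟩
      length (allFin L) * k                                             ≡⟨ cong (_* k) (length-tabulate {n = L} id) ⟩
      L * k                                                             ≡⟨ *-comm L k ⟩
      k * L                                                             ∎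
      where
      open ≡-Reasoning
      each : ∀ i → ∑ (map (i ,_) (closedWalk (cyc i))) (λ _ → 1) ≡ k
      each i = trans (sym (length≡∑1 (map (i ,_) (closedWalk (cyc i)))))
        (trans (length-map (i ,_) (closedWalk (cyc i))) (trans (length-closedWalk (cyc i)) (cyc-size i)))

    locate : ∀ u v → u ≢ v → ∃ λ i → (u , v) ∈ closedWalk (cyc i) ⊎ (v , u) ∈ closedWalk (cyc i)
    locate u v u≢v with cover u v u≢v
    ... | c , c∈ , p = Any.index c∈ , subst (λ c → (u , v) ∈ closedWalk c ⊎ (v , u) ∈ closedWalk c) (index-∈ c∈) p
      where
      index-∈ : ∀ {xs : List A} {x} (x∈ : x ∈ xs) → x ≡ Data.List.lookup xs (Any.index x∈)
      index-∈ (here eq)  = eq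
      index-∈ (there x∈) = index-∈ x∈

    edges-covered : ∀ {a} → a ∈ edges → a ∈ map (norm ∘ proj₂) slots
    edges-covered {u , v} a∈ with locate u v (pairs-≢ (unique-vertices n) a∈)
    ... | i , inj₁ p = subst (_∈ map (norm ∘ proj₂) slots) (norm-id a∈) (∈-map⁺ (norm ∘ proj₂) (∈-slots p))
    ... | i , inj₂ p = subst (_∈ map (norm ∘ proj₂) slots) (norm-swap a∈) (∈-map⁺ (norm ∘ proj₂) (∈-slots p))

    -- Since every edge is covered and the number of slots is the number of edges, no edge is covered twice.
    slots-↭ : map (norm ∘ proj₂) slots ↭ edges
    slots-↭ = ⊆-length-↭ (unique-pairs (unique-vertices n)) edges-covered
      (≤-reflexive (trans (length-map (norm ∘ proj₂) slots) (*-cancelˡ-≡ _ _ 2 (begin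
        2 * length slots              ≡⟨ cong (2 *_) length-slots ⟩
        2 * (k * L)                   ≡⟨ count ⟩
        n * (n ∸ 1)                   ≡⟨ cong (λ m → m * (m ∸ 1)) (length-vertices n) ⟨
        length V * (length V ∸ 1)     ≡⟨ length-pairs V ⟨
        2 * length edges              ∎))))
      where open ≡-Reasoning

    slot-unique : ∀ {i j a b} → a ∈ closedWalk (cyc i) → b ∈ closedWalk (cyc j) → norm a ≡ norm b → i ≡ j × a ≡ b
    slot-unique a∈ b∈ eq with unique-map-injective (Unique-resp-↭ (↭-sym slots-↭) (unique-pairs (unique-vertices n)))
                                (∈-slots a∈) (∈-slots b∈) eq
    ... | refl = refl , refl

    slot-edge : ∀ {i a} → a ∈ closedWalk (cyc i) → a ∈ edges ⊎ swap a ∈ edges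
    slot-edge {i} {a} a∈ with a ∈edges? | Perm.∈-resp-↭ slots-↭ (∈-map⁺ (norm ∘ proj₂) (∈-slots {i} a∈))
    ... | yes p | _ = inj₁ p
    ... | no _  | q = inj₂ q

  arc-≢ : ∀ {i u v} → (u , v) ∈ closedWalk (cyc i) → u ≢ v
  arc-≢ a∈ with slot-edge a∈
  ... | inj₁ p = pairs-≢ (unique-vertices n) p
  ... | inj₂ p = pairs-≢ (unique-vertices n) p ∘ sym

  private
    norm-comm : ∀ {i a} → a ∈ closedWalk (cyc i) → norm a ≡ norm (swap a)
    norm-comm a∈ with slot-edge a∈
    ... | inj₁ p = trans (norm-id p) (sym (norm-swap p))
    ... | inj₂ p = trans (norm-swap p) (sym (norm-id p))

  arc-owner : ∀ {i j a} → a ∈ closedWalk (cyc i) → a ∈ closedWalk (cyc j) → i ≡ j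
  arc-owner p q = proj₁ (slot-unique p q refl)

  -- Opposite arcs have the same underlying edge and hence occupy the same slot, which would make
  -- the arc a loop.
  arc-asym : ∀ {i j u v} → (u , v) ∈ closedWalk (cyc i) → (v , u) ∉ closedWalk (cyc j)
  arc-asym p q = arc-≢ p (cong proj₁ (proj₂ (slot-unique p q (norm-comm p))))

  private
    Place : Fin n → Fin n → Set
    Place u v = ∃ λ i → (u , v) ∈ closedWalk (cyc i) ⊎ (v , u) ∈ closedWalk (cyc i)

    isForward : ∀ {u v} → Place u v → Bool
    isForward (_ , inj₁ _) = true
    isForward (_ , inj₂ _) = false

    place-forward : ∀ {i u v} → (u , v) ∈ closedWalk (cyc i) → (p : Place u v) → proj₁ p ≡ i × isForward p ≡ true
    place-forward p (j , inj₁ q) = arc-owner q p , refl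
    place-forward p (j , inj₂ q) = contradiction q (arc-asym p)

    place-backward : ∀ {i u v} → (v , u) ∈ closedWalk (cyc i) → (p : Place u v) → proj₁ p ≡ i × isForward p ≡ false
    place-backward p (j , inj₁ q) = contradiction p (arc-asym q)
    place-backward p (j , inj₂ q) = arc-owner q p , refl

  -- No cycle belongs to the diagonal, where `i₀` is a default; `tour` decides the diagonal
  -- separately.
  idx : Fin n → Fin n → Fin L
  idx u v with u Fin.≟ v
  ... | yes _  = i₀
  ... | no u≢v = proj₁ (locate u v u≢v)

  dir : Fin n → Fin n → Bool
  dir u v with u Fin.≟ v
  ... | yes _  = false
  ... | no u≢v = isForward (locate u v u≢v)

  forward : ∀ {i u v} → (u , v) ∈ closedWalk (cyc i) → idx u v ≡ i × dir u v ≡ true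
  forward {i} {u} {v} p with u Fin.≟ v
  ... | yes u≡v = contradiction u≡v (arc-≢ p)
  ... | no u≢v  = place-forward p (locate u v u≢v)

  backward : ∀ {i u v} → (v , u) ∈ closedWalk (cyc i) → idx u v ≡ i × dir u v ≡ false
  backward {i} {u} {v} p with u Fin.≟ v
  ... | yes u≡v = contradiction (sym u≡v) (arc-≢ p)
  ... | no u≢v  = place-backward p (locate u v u≢v)

  -- Bit `false` keeps a cycle as listed and `true` reverses it. As `dir` records the listed sense,
  -- an exclusive or yields the arc.
  tour : Vec Bool L → Digraph n
  tour b u v = if does (u Fin.≟ v) then false else dir u v xor lookup b (idx u v)

  tour-≢ : ∀ b {u v} → u ≢ v → tour b u v ≡ dir u v xor lookup b (idx u v)
  tour-≢ b {u} {v} u≢v rewrite dec-false (u Fin.≟ v) u≢v = refl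

  tour-forward : ∀ b {i u v} → (u , v) ∈ closedWalk (cyc i) → tour b u v ≡ not (lookup b i)
  tour-forward b {i} {u} {v} p with forward p
  ... | refl , eq = trans (tour-≢ b (arc-≢ p)) (cong (_xor lookup b (idx u v)) eq)

  tour-backward : ∀ b {i u v} → (v , u) ∈ closedWalk (cyc i) → tour b u v ≡ lookup b i
  tour-backward b {i} {u} {v} p with backward p
  ... | refl , eq = trans (tour-≢ b (arc-≢ p ∘ sym)) (cong (_xor lookup b (idx u v)) eq)

  tour-tournament : ∀ b → IsTournament (tour b)
  tour-tournament b = loopless , semicomplete
    where
    loopless : ∀ i → tour b i i ≡ false
    loopless i rewrite dec-true (i Fin.≟ i) refl = refl
    semicomplete : ∀ u v → u ≢ v → tour b u v ≡ not (tour b v u)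
    semicomplete u v u≢v with locate u v u≢v
    ... | i , inj₁ p = trans (tour-forward b p) (cong not (sym (tour-backward b p)))
    ... | i , inj₂ p = trans (tour-backward b p) (trans (sym (Bool.not-involutive (lookup b i))) (cong not (sym (tour-forward b p))))

  cycle-vertex : ∀ {u v} → u ≢ v → u ∈ cyc (idx u v) × v ∈ cyc (idx u v)
  cycle-vertex {u} {v} u≢v with locate u v u≢v
  ... | i , inj₁ p rewrite proj₁ (forward p)  = arc-ends p
  ... | i , inj₂ p rewrite proj₁ (backward p) = swap (arc-ends p)

  oriented : Vec Bool L → Fin L → List (Fin n)
  oriented b i = if lookup b i then reverseCycle (cyc i) else cyc i

  oriented-↭ : ∀ b i → oriented b i ↭ cyc i
  oriented-↭ b i with lookup b i
  ... | true  = reverseCycle-↭ (cyc i)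
  ... | false = ↭-refl

  Oriented : Vec Bool L → Fin L → Arc n → Set
  Oriented b i a = (lookup b i ≡ false × a ∈ closedWalk (cyc i)) ⊎ (lookup b i ≡ true × swap a ∈ closedWalk (cyc i))

  oriented⁻ : ∀ b i {a} → a ∈ closedWalk (oriented b i) → Oriented b i a
  oriented⁻ b i a∈ with lookup b i
  ... | false = inj₁ (refl , a∈)
  ... | true with ∈-map⁻ swap (Perm.∈-resp-↭ (closedWalk-reverse (cyc i)) a∈)
  ...   | _ , p , refl = inj₂ (refl , p)

  oriented⁺ : ∀ b i {a} → Oriented b i a → a ∈ closedWalk (oriented b i)
  oriented⁺ b i (inj₁ (eq , p)) rewrite eq = p
  oriented⁺ b i (inj₂ (eq , p)) rewrite eq = Perm.∈-resp-↭ (↭-sym (closedWalk-reverse (cyc i))) (∈-map⁺ swap p)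

  private
    copyOf : ∀ b i → ∃ λ c → IsCopy (tour b) k c × cycleArcs c ↭ closedWalk (oriented b i)
    copyOf b i = subst (λ l → ∃ λ c → IsCopy (tour b) l c × cycleArcs c ↭ closedWalk (oriented b i)) len
      (canonicalCopy (tour b) (oriented b i) (≤-trans (s≤s z≤n) (≤-trans 3≤k (≤-reflexive (sym len))))
        (Unique-resp-↭ (↭-sym (oriented-↭ b i)) (cyc-unique i)) (All.tabulate arcs))
      where
      len : length (oriented b i) ≡ k
      len = trans (Perm.↭-length (oriented-↭ b i)) (cyc-size i)
      arcs : ∀ {a} → a ∈ closedWalk (oriented b i) → tour b (proj₁ a) (proj₂ a) ≡ true
      arcs a∈ with oriented⁻ b i a∈
      ... | inj₁ (eq , p) = trans (tour-forward b p) (cong not eq)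
      ... | inj₂ (eq , p) = trans (tour-backward b p) eq

    same-owner : ∀ b {i j a} → Oriented b i a → Oriented b j a → i ≡ j
    same-owner b (inj₁ (_ , p)) (inj₁ (_ , q)) = arc-owner p q
    same-owner b (inj₂ (_ , p)) (inj₂ (_ , q)) = arc-owner p q
    same-owner b (inj₁ (_ , p)) (inj₂ (_ , q)) = contradiction q (arc-asym p)
    same-owner b (inj₂ (_ , p)) (inj₁ (_ , q)) = contradiction p (arc-asym q)

  tour-decomposition : ∀ b → Decomposition (tour b) k
  tour-decomposition b = record
    { parts    = map part (allFin L)
    ; packing  = All.map⁺ (All.tabulate (λ {i} _ → proj₁ (proj₂ (copyOf b i))))
               , subst Unique (sym flatten) (unique-concatMap (cycleArcs ∘ part) (Unique.allFin⁺ L)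
                   (λ i → unique-copyArcs (tour b) k (part i) (proj₁ (proj₂ (copyOf b i))))
                   (λ p q → same-owner b (owned p) (owned q)))
    ; complete = λ u v eq → subst ((u , v) ∈_) (sym flatten) (complete u v eq)
    }
    where
    part : Fin L → List (Fin n)
    part i = proj₁ (copyOf b i)
    flatten : concatMap cycleArcs (map part (allFin L)) ≡ concatMap (cycleArcs ∘ part) (allFin L)
    flatten = concatMap-map cycleArcs part (allFin L)
    owned : ∀ {i a} → a ∈ cycleArcs (part i) → Oriented b i a
    owned {i} a∈ = oriented⁻ b i (Perm.∈-resp-↭ (proj₂ (proj₂ (copyOf b i))) a∈)
    owner : ∀ {i a} → Oriented b i a → a ∈ concatMap (cycleArcs ∘ part) (allFin L)
    owner {i} o = ∈-concatMap (∈-allFin i) (Perm.∈-resp-↭ (↭-sym (proj₂ (proj₂ (copyOf b i)))) (oriented⁺ b i o))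
    complete : ∀ u v → tour b u v ≡ true → (u , v) ∈ concatMap (cycleArcs ∘ part) (allFin L)
    complete u v eq = byPlace (locate u v λ { refl → case trans (sym eq) (proj₁ (tour-tournament b) u) of λ () })
      where
      byPlace : Place u v → (u , v) ∈ concatMap (cycleArcs ∘ part) (allFin L)
      byPlace (i , inj₁ p) = owner (inj₁ (Bool.not-injective (trans (sym (tour-forward b p)) eq) , p))
      byPlace (i , inj₂ p) = owner (inj₂ (trans (sym (tour-backward b p)) eq , p))

  tour-parts : ∀ b → length (Decomposition.parts (tour-decomposition b)) ≡ L
  tour-parts b = trans (length-map _ (allFin L)) (length-tabulate {n = L} id)

-- Fractional packings

Σℚ : List A → (A → ℚ) → ℚ
Σℚ xs f = sumℚ (map f xs)

Σℚ-mono : ∀ (xs : List A) {f g : A → ℚ} → (∀ x → x ∈ xs → f x ℚ.≤ g x) → Σℚ xs f ℚ.≤ Σℚ xs g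
Σℚ-mono []       f≤g = ℚ.≤-refl
Σℚ-mono (x ∷ xs) f≤g = ℚ.+-mono-≤ (f≤g x (here refl)) (Σℚ-mono xs (λ y y∈ → f≤g y (there y∈)))

Σℚ-cong : ∀ (xs : List A) {f g : A → ℚ} → (∀ x → f x ≡ g x) → Σℚ xs f ≡ Σℚ xs g
Σℚ-cong xs f≗g = cong sumℚ (map-cong f≗g xs)

Σℚ-0 : ∀ (xs : List A) → Σℚ xs (λ _ → 0ℚ) ≡ 0ℚ
Σℚ-0 []       = refl
Σℚ-0 (x ∷ xs) = trans (ℚ.+-identityˡ _) (Σℚ-0 xs)

Σℚ-+ : ∀ (xs : List A) (f g : A → ℚ) → Σℚ xs (λ x → f x ℚ.+ g x) ≡ Σℚ xs f ℚ.+ Σℚ xs g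
Σℚ-+ []       f g = refl
Σℚ-+ (x ∷ xs) f g = trans (cong (f x ℚ.+ g x ℚ.+_) (Σℚ-+ xs f g)) (medial (f x) (g x) _ _)
  where
  medial : ∀ a b c d → (a ℚ.+ b) ℚ.+ (c ℚ.+ d) ≡ (a ℚ.+ c) ℚ.+ (b ℚ.+ d)
  medial = Algebra.Properties.CommutativeSemigroup.interchange
    (record { isCommutativeSemigroup = Algebra.Structures.IsCommutativeMonoid.isCommutativeSemigroup ℚ.+-0-isCommutativeMonoid })

Σℚ-swap : ∀ (xs : List A) (ys : List B) (f : A → B → ℚ) →
          Σℚ xs (λ x → Σℚ ys (f x)) ≡ Σℚ ys (λ y → Σℚ xs (λ x → f x y))
Σℚ-swap []       ys f = sym (Σℚ-0 ys)
Σℚ-swap (x ∷ xs) ys f = trans (cong (Σℚ ys (f x) ℚ.+_) (Σℚ-swap xs ys f)) (sym (Σℚ-+ ys (f x) _))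

Σℚ-++ : ∀ (xs ys : List A) (f : A → ℚ) → Σℚ (xs ++ ys) f ≡ Σℚ xs f ℚ.+ Σℚ ys f
Σℚ-++ []       ys f = sym (ℚ.+-identityˡ _)
Σℚ-++ (x ∷ xs) ys f = trans (cong (f x ℚ.+_) (Σℚ-++ xs ys f)) (sym (ℚ.+-assoc (f x) _ _))

Σℚ-↭ : ∀ {xs ys : List A} (f : A → ℚ) → xs ↭ ys → Σℚ xs f ≡ Σℚ ys f
Σℚ-↭ f _↭_.refl         = refl
Σℚ-↭ f (_↭_.prep x p)   = cong (f x ℚ.+_) (Σℚ-↭ f p)
Σℚ-↭ f (_↭_.swap x y p) = trans (cong (λ s → f x ℚ.+ (f y ℚ.+ s)) (Σℚ-↭ f p))
  (trans (sym (ℚ.+-assoc (f x) (f y) _)) (trans (cong (ℚ._+ _) (ℚ.+-comm (f x) (f y))) (ℚ.+-assoc (f y) (f x) _)))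
Σℚ-↭ f (_↭_.trans p q)  = trans (Σℚ-↭ f p) (Σℚ-↭ f q)

Σℚ-filter : ∀ {P : A → Set} (P? : ∀ x → Dec (P x)) xs (f : A → ℚ) →
            Σℚ (filter P? xs) f ≡ Σℚ xs (λ x → if does (P? x) then f x else 0ℚ)
Σℚ-filter P? []       f = refl
Σℚ-filter P? (x ∷ xs) f with does (P? x)
... | true  = cong (f x ℚ.+_) (Σℚ-filter P? xs f)
... | false = trans (Σℚ-filter P? xs f) (sym (ℚ.+-identityˡ _))

infixl 7 _·_
-- Iterated addition instead of a product of rationals: the double counting only adds equal weights,
-- and `·1` translates the outcome into a quotient.
_·_ : ℕ → ℚ → ℚ
zero  · x = 0ℚ
suc k · x = x ℚ.+ k · x

Σℚ-const : ∀ (xs : List A) x → Σℚ xs (λ _ → x) ≡ length xs · x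
Σℚ-const []       x = refl
Σℚ-const (_ ∷ xs) x = cong (x ℚ.+_) (Σℚ-const xs x)

Σℚ-· : ∀ k (xs : List A) (f : A → ℚ) → Σℚ xs (λ x → k · f x) ≡ k · Σℚ xs f
Σℚ-· zero    xs f = Σℚ-0 xs
Σℚ-· (suc k) xs f = trans (Σℚ-+ xs f _) (cong (Σℚ xs f ℚ.+_) (Σℚ-· k xs f))

·-+ : ∀ j k x → (j + k) · x ≡ j · x ℚ.+ k · x
·-+ zero    k x = sym (ℚ.+-identityˡ _)
·-+ (suc j) k x = trans (cong (x ℚ.+_) (·-+ j k x)) (sym (ℚ.+-assoc x _ _))

·-* : ∀ j k x → (j * k) · x ≡ j · (k · x)
·-* zero    k x = refl
·-* (suc j) k x = trans (·-+ k (j * k) x) (cong (k · x ℚ.+_) (·-* j k x))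

·-mono-< : ∀ k .{{_ : NonZero k}} {x y} → x ℚ.< y → k · x ℚ.< k · y
·-mono-< (suc zero)    lt = ℚ.+-monoˡ-< 0ℚ lt
·-mono-< (suc (suc k)) lt = ℚ.+-mono-< lt (·-mono-< (suc k) lt)

·-cancel-≤ : ∀ k .{{_ : NonZero k}} {x y} → k · x ℚ.≤ k · y → x ℚ.≤ y
·-cancel-≤ k {x} {y} le with x ℚ.≤? y
... | yes p = p
... | no ¬p = ⊥-elim (ℚ.<-irrefl refl (ℚ.≤-<-trans le (·-mono-< k (ℚ.≰⇒> ¬p))))

·1 : ∀ k → k · 1ℚ ≡ (ℤ.+ k) ℚ./ 1
·1 zero    = refl
·1 (suc k) = trans (cong (1ℚ ℚ.+_) (·1 k)) (ℚ.toℚᵘ-injective (begin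
  ℚ.toℚᵘ (1ℚ ℚ.+ ((ℤ.+ k) ℚ./ 1))                ≈⟨ ℚ.toℚᵘ-homo-+ 1ℚ ((ℤ.+ k) ℚ./ 1) ⟩
  ℚ.toℚᵘ 1ℚ ℚᵘ.+ ℚ.toℚᵘ ((ℤ.+ k) ℚ./ 1)          ≈⟨ ℚᵘ.+-congʳ (ℚ.toℚᵘ 1ℚ) (ℚ.toℚᵘ-fromℚᵘ (ℚᵘ.mkℚᵘ (ℤ.+ k) 0)) ⟩
  ℚ.toℚᵘ 1ℚ ℚᵘ.+ ℚᵘ.mkℚᵘ (ℤ.+ k) 0               ≈⟨ ℚᵘ.*≡* (one k) ⟩
  ℚᵘ.mkℚᵘ (ℤ.+ suc k) 0                          ≈⟨ ℚ.toℚᵘ-fromℚᵘ (ℚᵘ.mkℚᵘ (ℤ.+ suc k) 0) ⟨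
  ℚ.toℚᵘ ((ℤ.+ suc k) ℚ./ 1)                     ∎))
  where
  open ℚᵘ.≃-Reasoning
  one : ∀ k → (ℤ.+ 1 ℤ.* ℤ.+ 1 ℤ.+ ℤ.+ k ℤ.* ℤ.+ 1) ℤ.* ℤ.+ 1 ≡ ℤ.+ suc k ℤ.* ℤ.+ 1
  one k = cong (λ z → (ℤ.+ 1 ℤ.+ z) ℤ.* ℤ.+ 1) (ℤ.*-identityʳ (ℤ.+ k))

unique-++-disjoint : {xs ys : List A} → Unique (xs ++ ys) → Disjoint xs ys
unique-++-disjoint {xs = x ∷ xs} (x∉ ∷ u) (here refl , q) = All.lookup x∉ (∈-++⁺ʳ xs q) refl
unique-++-disjoint {xs = x ∷ xs} (x∉ ∷ u) (there p   , q) = unique-++-disjoint u (p , q)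

unique-++ʳ : (xs : List A) {ys : List A} → Unique (xs ++ ys) → Unique ys
unique-++ʳ []       u       = u
unique-++ʳ (x ∷ xs) (_ ∷ u) = unique-++ʳ xs u

concatMap-owner : ∀ (h : A → List B) {xs} → Unique (concatMap h xs) →
                  ∀ {x x′ y} → x ∈ xs → x′ ∈ xs → y ∈ h x → y ∈ h x′ → x ≡ x′
concatMap-owner h u (here refl) (here refl) p q = refl
concatMap-owner h {z ∷ zs} u (here refl) (there x′∈) p q = contradiction (p , ∈-concatMap x′∈ q) (unique-++-disjoint u)
concatMap-owner h {z ∷ zs} u (there x∈) (here refl) p q = contradiction (q , ∈-concatMap x∈ p) (unique-++-disjoint u)
concatMap-owner h {z ∷ zs} u (there x∈) (there x′∈) p q = concatMap-owner h (unique-++ʳ (h z) u) x∈ x′∈ p q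

unique-concatMap⁻ : ∀ (h : A → List B) {xs} → (∀ {x} → x ∈ xs → ∃ λ y → y ∈ h x) → Unique (concatMap h xs) → Unique xs
unique-concatMap⁻ h {[]}     inhabited u = []
unique-concatMap⁻ h {z ∷ zs} inhabited u =
  All.tabulate (λ { x∈ refl → let y , y∈ = inhabited (here refl) in unique-++-disjoint u (y∈ , ∈-concatMap x∈ y∈) })
  ∷ unique-concatMap⁻ h (inhabited ∘ there) (unique-++ʳ (h z) u)

unique-singleton : {xs : List A} → Unique xs → (∀ {x y} → x ∈ xs → y ∈ xs → x ≡ y) → length xs ≤ 1
unique-singleton {xs = []}         u       eq = z≤n
unique-singleton {xs = x ∷ []}     u       eq = ≤-refl
unique-singleton {xs = x ∷ y ∷ xs} ((x≢y ∷ _) ∷ _) eq = contradiction (eq (here refl) (there (here refl))) x≢y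

∈-allLists : ∀ {n} (c : List (Fin n)) → c ∈ allLists n (length c)
∈-allLists []      = here refl
∈-allLists (x ∷ c) = ∈-concatMap (∈-vertices x) (∈-map⁺ (x ∷_) (∈-allLists c))

unique-allLists : ∀ n k → Unique (allLists n k)
unique-allLists n zero    = [] ∷ []
unique-allLists n (suc k) = unique-concatMap (λ v → map (v ∷_) (allLists n k)) (unique-vertices n)
  (λ v → Unique.map⁺ ∷-injectiveʳ (unique-allLists n k)) same
  where
  same : ∀ {v v′ c} → c ∈ map (v ∷_) (allLists n k) → c ∈ map (v′ ∷_) (allLists n k) → v ≡ v′
  same p q with ∈-map⁻ (_ ∷_) p | ∈-map⁻ (_ ∷_) q
  ... | _ , _ , refl | _ , _ , refl = refl

module _ {n} (D : Digraph n) (k : ℕ) where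

  ∈-copies : ∀ {c} → IsCopy D k c → c ∈ copies D k
  ∈-copies {x ∷ xs} ic = ∈-filter⁺ (λ c → isCopy D k c Bool.≟ true)
    (subst (λ l → x ∷ xs ∈ allLists n l) (Copy.size (isCopy⁻ D k x xs ic)) (∈-allLists (x ∷ xs))) ic

  copies-∈ : ∀ {c} → c ∈ copies D k → IsCopy D k c
  copies-∈ c∈ = proj₂ (∈-filter⁻ (λ c → isCopy D k c Bool.≟ true) {xs = allLists n k} c∈)

  unique-copies : Unique (copies D k)
  unique-copies = Unique.filter⁺ (λ c → isCopy D k c Bool.≟ true) (unique-allLists n k)

module _ {n} {T : Digraph n} {k} .{{_ : NonZero k}} (dec : Decomposition T k) where
  open Decomposition dec

  private
    arcsT : List (Arc n)
    arcsT = concatMap cycleArcs parts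

    through? : (a : Arc n) (c : List (Fin n)) → Dec (Any (_≡ a) (cycleArcs c))
    through? a c = Any.any? (λ b → b ≟ᵃ a) (cycleArcs c)

    part? : (c : List (Fin n)) → Dec (c ∈ parts)
    part? c = Any.any? (≡-dec Fin._≟_ c) parts

    weight : List (Fin n) → ℚ
    weight c = if does (part? c) then 1ℚ else 0ℚ

    unique-parts : Unique parts
    unique-parts = unique-concatMap⁻ cycleArcs inhabited (proj₂ packing)
      where
      nonempty : ∀ (xs : List A) → NonZero (length xs) → ∃ λ y → y ∈ xs
      nonempty (x ∷ xs) _ = x , here refl
      inhabited : ∀ {c} → c ∈ parts → ∃ λ a → a ∈ cycleArcs c
      inhabited {c} c∈ = nonempty (cycleArcs c)
        (subst NonZero (sym (length-copyArcs T k c (All.lookup (proj₁ packing) c∈))) (recompute-nonZero k))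
        where
        recompute-nonZero : ∀ k → .{{NonZero k}} → NonZero k
        recompute-nonZero (suc k) = _

    Σℚ-weight : ∀ cs → Σℚ cs weight ≡ length (filter part? cs) · 1ℚ
    Σℚ-weight cs = trans (sym (Σℚ-filter part? cs (λ _ → 1ℚ))) (Σℚ-const (filter part? cs) 1ℚ)

    weight-value : fracValue T k weight ≡ (ℤ.+ length parts) ℚ./ 1
    weight-value = trans (Σℚ-weight (copies T k)) (trans (cong (_· 1ℚ) (≤-antisym
      (unique-⊆-length (Unique.filter⁺ part? (unique-copies T k)) (λ c∈ → proj₂ (∈-filter⁻ part? {xs = copies T k} c∈)))
      (unique-⊆-length unique-parts (λ c∈ → ∈-filter⁺ part? (∈-copies T k (All.lookup (proj₁ packing) c∈)) c∈))))
      (·1 (length parts)))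

    0≤1 : 0ℚ ℚ.≤ 1ℚ
    0≤1 = does-true (0ℚ ℚ.≤? 1ℚ) refl

    weight-packing : IsFracPacking T k weight
    weight-packing = nonneg , λ u v _ → subst (ℚ._≤ 1ℚ) (sym (Σℚ-weight (copiesThrough T k (u , v)))) (at-most-one _ (once u v))
      where
      nonneg : ∀ c → IsCopy T k c → 0ℚ ℚ.≤ weight c
      nonneg c _ with does (part? c)
      ... | true  = 0≤1
      ... | false = ℚ.≤-refl
      at-most-one : ∀ l → l ≤ 1 → l · 1ℚ ℚ.≤ 1ℚ
      at-most-one zero    _         = 0≤1
      at-most-one (suc l) (s≤s z≤n) = ℚ.≤-refl
      once : ∀ u v → length (filter part? (copiesThrough T k (u , v))) ≤ 1
      once u v = unique-singleton (Unique.filter⁺ part? (Unique.filter⁺ (through? (u , v)) (unique-copies T k))) same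
        where
        member : ∀ {c} → c ∈ filter part? (copiesThrough T k (u , v)) → c ∈ parts × (u , v) ∈ cycleArcs c
        member c∈ with ∈-filter⁻ part? {xs = copiesThrough T k (u , v)} c∈
        ... | c∈t , c∈p = c∈p , Any.map sym (proj₂ (∈-filter⁻ (through? (u , v)) {xs = copies T k} c∈t))
        same : ∀ {c c′} → c ∈ filter part? (copiesThrough T k (u , v)) → c′ ∈ filter part? (copiesThrough T k (u , v)) → c ≡ c′
        same p q = concatMap-owner cycleArcs (proj₂ packing) (proj₁ (member p)) (proj₁ (member q)) (proj₂ (member p)) (proj₂ (member q))

    -- Every copy spreads `k` times its weight over its arcs, and the capacities of all arcs add up
    -- to `k` times the number of parts.
    upper : ∀ m → IsFracPacking T k m → fracValue T k m ℚ.≤ (ℤ.+ length parts) ℚ./ 1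
    upper m (nonneg , capacity) = ·-cancel-≤ k (begin
      k · Σℚ (copies T k) m                                            ≡⟨ Σℚ-· k (copies T k) m ⟨
      Σℚ (copies T k) (λ c → k · m c)                                  ≤⟨ Σℚ-mono (copies T k) spread ⟩
      Σℚ (copies T k) (λ c → Σℚ arcsT (λ a → share a c))               ≡⟨ Σℚ-swap (copies T k) arcsT (λ c a → share a c) ⟩
      Σℚ arcsT (λ a → Σℚ (copies T k) (share a))                       ≡⟨ Σℚ-cong arcsT (λ a → Σℚ-filter (through? a) (copies T k) m) ⟨
      Σℚ arcsT (λ a → Σℚ (copiesThrough T k a) m)                      ≤⟨ Σℚ-mono arcsT (λ a a∈ → capacity _ _ (All.lookup (packingArcs T k parts (proj₁ packing)) a∈)) ⟩
      Σℚ arcsT (λ _ → 1ℚ)                                              ≡⟨ Σℚ-const arcsT 1ℚ ⟩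
      length arcsT · 1ℚ                                                ≡⟨ cong (_· 1ℚ) (trans (length-packingArcs T k parts (proj₁ packing)) (*-comm (length parts) k)) ⟩
      (k * length parts) · 1ℚ                                          ≡⟨ ·-* k (length parts) 1ℚ ⟩
      k · (length parts · 1ℚ)                                          ≡⟨ cong (k ·_) (·1 (length parts)) ⟩
      k · ((ℤ.+ length parts) ℚ./ 1)                                     ∎)
      where
      open ℚ.≤-Reasoning
      share : Arc n → List (Fin n) → ℚ
      share a c = if does (through? a c) then m c else 0ℚ
      spread : ∀ c → c ∈ copies T k → k · m c ℚ.≤ Σℚ arcsT (λ a → share a c)
      spread c c∈ with unique-⊆ {ys = arcsT} (unique-copyArcs T k c (copies-∈ T k c∈))
                         (λ a∈ → complete _ _ (All.lookup (copyArcs T k c (copies-∈ T k c∈)) a∈))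
      ... | rest , p = begin
        k · m c                                                        ≡⟨ cong (_· m c) (length-copyArcs T k c (copies-∈ T k c∈)) ⟨
        length (cycleArcs c) · m c                                     ≡⟨ Σℚ-const (cycleArcs c) (m c) ⟨
        Σℚ (cycleArcs c) (λ _ → m c)                                   ≤⟨ Σℚ-mono (cycleArcs c) (λ a a∈ → ℚ.≤-reflexive (sym (cong (λ t → if t then m c else 0ℚ) (dec-true (through? a c) (Any.map sym a∈))))) ⟩
        Σℚ (cycleArcs c) (λ a → share a c)                             ≡⟨ ℚ.+-identityʳ _ ⟨
        Σℚ (cycleArcs c) (λ a → share a c) ℚ.+ 0ℚ                      ≡⟨ cong (Σℚ (cycleArcs c) (λ a → share a c) ℚ.+_) (Σℚ-0 rest) ⟨
        Σℚ (cycleArcs c) (λ a → share a c) ℚ.+ Σℚ rest (λ _ → 0ℚ)      ≤⟨ ℚ.+-monoʳ-≤ (Σℚ (cycleArcs c) (λ a → share a c)) (Σℚ-mono rest (λ a _ → share-nonneg a)) ⟩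
        Σℚ (cycleArcs c) (λ a → share a c) ℚ.+ Σℚ rest (λ a → share a c) ≡⟨ Σℚ-++ (cycleArcs c) rest _ ⟨
        Σℚ (cycleArcs c ++ rest) (λ a → share a c)                     ≡⟨ Σℚ-↭ _ p ⟨
        Σℚ arcsT (λ a → share a c)                                     ∎
        where
        share-nonneg : ∀ a → 0ℚ ℚ.≤ share a c
        share-nonneg a with does (through? a c)
        ... | true  = nonneg c (copies-∈ T k c∈)
        ... | false = ℚ.≤-refl

  decomposition-ν* : IsNuStar T k ((ℤ.+ length parts) ℚ./ 1)
  decomposition-ν* = (weight , weight-packing , weight-value) , upper

-- Transversals

least-witness : ∀ {P : ℕ → Set} → (∀ t → Dec (P t)) → ∀ t₀ → P t₀ → ∃ λ t → P t × (∀ t′ → P t′ → t ≤ t′)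
least-witness {P} P? t₀ p₀ = search t₀ 0 (λ _ ()) (subst P (sym (+-identityʳ t₀)) p₀)
  where
  search : ∀ fuel t → (∀ t′ → t′ < t → ¬ P t′) → P (fuel + t) → ∃ λ t → P t × (∀ t′ → P t′ → t ≤ t′)
  search zero       t below p = t , p , λ t′ p′ → ≮⇒≥ (λ lt → below t′ lt p′)
  search (suc fuel) t below p with P? t
  ... | yes pt = t , pt , λ t′ p′ → ≮⇒≥ (λ lt → below t′ lt p′)
  ... | no ¬pt = search fuel (suc t) below′ (subst P (sym (+-suc fuel t)) p)
    where
    below′ : ∀ t′ → t′ < suc t → ¬ P t′
    below′ t′ (s≤s t′≤t) with m≤n⇒m<n∨m≡n t′≤t
    ... | inj₁ t′<t = below t′ t′<t
    ... | inj₂ refl = ¬pt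

module _ {n} (T : Digraph n) (k : ℕ) where

  allArcs : List (Arc n)
  allArcs = cartesianProduct (vertices n) (vertices n)

  ∈-allArcs : ∀ a → a ∈ allArcs
  ∈-allArcs (u , v) = ∈-cartesianProduct⁺ (∈-vertices u) (∈-vertices v)

  private
    arc? : (a : Arc n) → Dec (T (proj₁ a) (proj₂ a) ≡ true)
    arc? a = T (proj₁ a) (proj₂ a) Bool.≟ true

    transversal? : ∀ S → Dec (IsTransversal T k S)
    transversal? S = All.all? arc? S ×-dec (UDec.unique? _≟ᵃ_ S ×-dec
      map′ (λ hit c ic → All.lookup hit (∈-copies T k {c} ic)) (λ hit → All.tabulate (λ {c} c∈ → hit c (copies-∈ T k c∈)))
        (All.all? (λ c → Any.any? (λ a → Any.any? (a ≟ᵃ_) S) (cycleArcs c)) (copies T k)))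

    OfSize : ℕ → Set
    OfSize t = ∃ λ S → IsTransversal T k S × length S ≡ t

    ofSize? : ∀ t → Dec (OfSize t)
    ofSize? t = map′ found exhaustive (Any.any? (transversal? ∘ Vec.toList) (tuples allArcs t))
      where
      found : Any (IsTransversal T k ∘ Vec.toList) (tuples allArcs t) → OfSize t
      found p = let v , tr = Any.satisfied p in Vec.toList v , tr , Vec.length-toList v
      exhaustive : OfSize t → Any (IsTransversal T k ∘ Vec.toList) (tuples allArcs t)
      exhaustive (S , tr , refl) = Any.map (λ { refl → subst (IsTransversal T k) (sym (Vec.toList∘fromList S)) tr })
        (∈-tuples ∈-allArcs (Vec.fromList S))

    module Monotone (R : Fin n → Fin n → Set) (R? : ∀ u v → Dec (R u v)) where

      sel? : (a : Arc n) → Dec (T (proj₁ a) (proj₂ a) ≡ true × R (proj₁ a) (proj₂ a))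
      sel? a = arc? a ×-dec R? (proj₁ a) (proj₂ a)

      selected : List (Arc n)
      selected = filter sel? allArcs

      transversal : (∀ c → IsCopy T k c → ∃ λ a → a ∈ cycleArcs c × R (proj₁ a) (proj₂ a)) → IsTransversal T k selected
      transversal hit = All.map proj₁ (All.all-filter sel? allArcs)
        , Unique.filter⁺ sel? (Unique.cartesianProduct⁺ (unique-vertices n) (unique-vertices n))
        , λ c ic → let a , a∈ , r = hit c ic in
            Any.map (λ { refl → ∈-filter⁺ sel? (∈-allArcs a) (All.lookup (copyArcs T k c ic) a∈ , r) }) a∈

    module Asc  = Monotone Fin._<_ Fin._<?_
    module Desc = Monotone Fin._>_ (λ u v → v Fin.<? u)

    -- A copy begins at its least vertex, so its first arc ascends. For the same reason its last
    -- arc, which returns there, descends.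
    ascent : 2 ≤ k → ∀ c → IsCopy T k c → ∃ λ a → a ∈ cycleArcs c × proj₁ a Fin.< proj₂ a
    ascent 2≤k (x ∷ [])     ic = contradiction (Copy.size (isCopy⁻ T k x [] ic)) (<⇒≢ 2≤k)
    ascent 2≤k (x ∷ y ∷ ys) ic = (x , y) , here refl ,
      ≤∧≢⇒< (All.head least) (λ eq → All.head (AllPairs.head unique) (Fin.toℕ-injective eq))
      where open Copy (isCopy⁻ T k x (y ∷ ys) ic)

    descent : 2 ≤ k → ∀ c → IsCopy T k c → ∃ λ a → a ∈ cycleArcs c × proj₂ a Fin.< proj₁ a
    descent 2≤k (x ∷ [])     ic = contradiction (Copy.size (isCopy⁻ T k x [] ic)) (<⇒≢ 2≤k)
    descent 2≤k (x ∷ y ∷ ys) ic with last-arc y ys x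
      where
      last-arc : ∀ (y : A) ys x → ∃ λ z → z ∈ y ∷ ys × (z , x) ∈ walk y ys x
      last-arc y []        x = y , here refl , here refl
      last-arc y (y′ ∷ ys) x = Prod.map₂ (Prod.map there there) (last-arc y′ ys x)
    ... | z , z∈ , a∈ = (z , x) , subst ((z , x) ∈_) (sym (cycleArcs≡closedWalk (x ∷ y ∷ ys))) (there a∈) ,
      ≤∧≢⇒< (All.lookup least z∈) (λ eq → All.lookup (AllPairs.head unique) z∈ (Fin.toℕ-injective eq))
      where open Copy (isCopy⁻ T k x (y ∷ ys) ic)

  -- The minimum is found by search: `ofSize?` tries all tuples of arcs of a given length, and the
  -- ascending arcs supply a transversal that bounds the search.
  τ-exists : 2 ≤ k → ∃ (IsTau T k)
  τ-exists 2≤k with least-witness ofSize? _ (Asc.selected , Asc.transversal (ascent 2≤k) , refl)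
  ... | t , p , minimal = t , p , λ S tr → minimal (length S) (S , tr , refl)

  τ-upper : 2 ≤ k → IsTournament T → ∀ {t} → IsTau T k t → 4 * t ≤ n * n
  τ-upper 2≤k (loopless , semicomplete) {t} (_ , minimal) = begin
    4 * t                                                  ≡⟨ four t ⟩
    2 * (t + t)                                            ≤⟨ *-monoʳ-≤ 2 (+-mono-≤ (minimal _ (Asc.transversal (ascent 2≤k))) (minimal _ (Desc.transversal (descent 2≤k)))) ⟩
    2 * (length Asc.selected + length Desc.selected)       ≡⟨ cong (2 *_) (cong₂ _+_ (∑-ind-filter Asc.sel? allArcs) (∑-ind-filter Desc.sel? allArcs)) ⟩
    2 * (∑ allArcs asc + ∑ allArcs desc)                   ≡⟨ cong (2 *_) (∑-+ allArcs asc desc) ⟨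
    2 * ∑ allArcs (λ a → asc a + desc a)                   ≤⟨ *-monoʳ-≤ 2 (∑-mono allArcs (uncurry one-way)) ⟩
    2 * ∑ allArcs (λ a → ind (T (proj₁ a) (proj₂ a)))      ≡⟨ cong (2 *_) (∑-product _) ⟩
    2 * X                                                  ≡⟨ cong (X +_) (+-identityʳ X) ⟩
    X + X                                                  ≡⟨ cong (X +_) (∑-swap V V (λ u v → ind (T u v))) ⟩
    X + ∑ V (λ u → ∑ V (λ v → ind (T v u)))                ≡⟨ ∑-+ V _ _ ⟨
    ∑ V (λ u → ∑ V (λ v → ind (T u v)) + ∑ V (λ v → ind (T v u)))  ≡⟨ ∑-cong V (λ u → ∑-+ V _ _) ⟨
    ∑ V (λ u → ∑ V (λ v → ind (T u v) + ind (T v u)))      ≤⟨ ∑-mono V (λ u → ∑-mono V (at-most-one u)) ⟩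
    ∑ V (λ u → ∑ V (λ v → 1))                              ≡⟨ ∑-cong V (λ _ → trans (sym (length≡∑1 V)) (length-vertices n)) ⟩
    ∑ V (λ _ → n)                                          ≡⟨ trans (∑-const V n) (cong (_* n) (length-vertices n)) ⟩
    n * n                                                  ∎
    where
    open ≤-Reasoning
    V = vertices n
    X = ∑ V (λ u → ∑ V (λ v → ind (T u v)))
    asc desc : Arc n → ℕ
    asc a = ind (does (Asc.sel? a))
    desc a = ind (does (Desc.sel? a))
    four : ∀ t → 4 * t ≡ 2 * (t + t)
    four = solve-∀
    ∑-product : ∀ (f : Arc n → ℕ) → ∑ allArcs f ≡ ∑ V (λ u → ∑ V (λ v → f (u , v)))
    ∑-product f = go V
      where
      go : ∀ us → ∑ (cartesianProduct us V) f ≡ ∑ us (λ u → ∑ V (λ v → f (u , v)))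
      go []       = refl
      go (u ∷ us) = trans (∑-++ (map (u ,_) V) (cartesianProduct us V) f) (cong₂ _+_ (∑-map (u ,_) V f) (go us))
    one-way : ∀ u v → asc (u , v) + desc (u , v) ≤ ind (T u v)
    one-way u v = exclusive (T u v) (u Fin.<? v) (v Fin.<? u) <-asym
      where
      exclusive : ∀ x {P Q : Set} (P? : Dec P) (Q? : Dec Q) → (P → Q → ⊥) →
        ind (does ((x Bool.≟ true) ×-dec P?)) + ind (does ((x Bool.≟ true) ×-dec Q?)) ≤ ind x
      exclusive false P?      Q?      _  = z≤n
      exclusive true  (yes p) (yes q) ¬b = ⊥-elim (¬b p q)
      exclusive true  (yes _) (no _)  _  = ≤-refl
      exclusive true  (no _)  (yes _) _  = ≤-refl
      exclusive true  (no _)  (no _)  _  = z≤n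
    at-most-one : ∀ u v → ind (T u v) + ind (T v u) ≤ 1
    at-most-one u v with u Fin.≟ v
    ... | yes refl rewrite loopless u = z≤n
    ... | no u≢v rewrite semicomplete u v u≢v with T v u
    ...   | true  = ≤-refl
    ...   | false = ≤-refl

-- Patterns of vertex tuples and shattered sets

row : ∀ {n p} → Digraph n → Vec (Fin n) p → Fin n → Vec Bool p
row T X y = Vec.map (λ x → T x y) X

mat : ∀ {n p t} → Digraph n → Vec (Fin n) p → Vec (Fin n) t → Vec (Vec Bool p) t
mat T X = Vec.map (row T X)

-- The columns of `M` are read as a family of vectors indexed by the rows: the rows `P` are
-- shattered, and the column `Q a` has the trace `a` on them.
record Shatter {s t} (d : ℕ) (M : Vec (Vec Bool s) t) : Set where
  field
    P       : Vec (Fin s) d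
    Q       : Vec Bool d → Fin t
    realise : ∀ a → Vec.map (lookup (lookup M (Q a))) P ≡ a

  realise-lookup : ∀ a i → lookup (lookup M (Q a)) (lookup P i) ≡ lookup a i
  realise-lookup a i = trans (sym (Vec.lookup-map i _ P)) (cong (λ c → lookup c i) (realise a))

  Q-injective : ∀ {a a′} → Q a ≡ Q a′ → a ≡ a′
  Q-injective {a} {a′} eq = trans (sym (realise a)) (trans (cong (λ q → Vec.map (lookup (lookup M q)) P) eq) (realise a′))

  -- Realising the pattern that is true only at `i` separates the row at `i` from the row at any
  -- other index.
  P-injective : ∀ {i j} → lookup P i ≡ lookup P j → i ≡ j
  P-injective {i} {j} eq with i Fin.≟ j
  ... | yes p = p
  ... | no ¬p = case trans (sym (Vec.lookup∘updateAt i z)) (trans (sym (realise-lookup a i))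
                  (trans (cong (lookup (lookup M (Q a))) eq) (trans (realise-lookup a j)
                  (trans (Vec.lookup∘updateAt′ j i (¬p ∘ sym) z) (Vec.lookup-replicate j false))))) of λ ()
    where
    z = Vec.replicate d false
    a = z [ i ]≔ true

shatter : ∀ {s t} d (M : Vec (Vec Bool s) t) → sauer s d < columns M → Shatter d M
shatter {s} {t} d M lt with sauer-shelah s d (λ a → does (a ∈ᵛ? M)) lt
... | P , sh = record
  { P = P
  ; Q = λ a → proj₁ (position a)
  ; realise = λ a → trans (cong (λ c → Vec.map (lookup c) P) (proj₂ (position a))) (proj₂ (proj₂ (sh a)))
  }
  where
  position : ∀ a → ∃ λ j → lookup M j ≡ proj₁ (sh a)
  position a = VAny.index c∈ , sym (VAny.lookup-index c∈)
    where
    c∈ : proj₁ (sh a) VMem.∈ M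
    c∈ = does-true (proj₁ (sh a) ∈ᵛ? M) (proj₁ (proj₂ (sh a)))

module _ {s t d} {M : Vec (Vec Bool s) t} (sh : Shatter d M) where
  open Shatter sh

  rows : Vec (Fin (s + t)) d
  rows = Vec.map (_↑ˡ t) P

  cols : Vec (Fin (s + t)) (length (bitVecs d))
  cols = Vec.map (λ a → s ↑ʳ Q a) (Vec.fromList (bitVecs d))

  -- `r` lists the directions between a further vertex and all vertices of the two tuples. Only its
  -- entries at the shattered rows and at the realising columns are tested, each group for its own
  -- balance.
  skewed : ℕ → Vec Bool (s + t) → Bool
  skewed E r = unbalanced E (Vec.map (lookup r) rows) ∨ unbalanced E (Vec.map (lookup r) cols)

map-lookup-uniform : ∀ {p q} (ι : Vec (Fin p) q) → (∀ i j → lookup ι i ≡ lookup ι j → i ≡ j) → (F : Vec Bool q → ℕ) →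
  2 ^ q * ∑ (bitVecs p) (λ r → F (Vec.map (lookup r) ι)) ≡ 2 ^ p * ∑ (bitVecs q) F
map-lookup-uniform {p} {q} ι inj F = begin
  2 ^ q * ∑ (bitVecs p) (λ r → F (Vec.map (lookup r) ι))       ≡⟨ cong (2 ^ q *_) (∑-cong (bitVecs p) (λ r → cong F (Vec.map-∘ _ (_, false) ι))) ⟩
  2 ^ q * ∑ (bitVecs p) (λ r → F (readBits r cs))              ≡⟨ readBits-uniform cs (λ a _ → F a) inj′ (λ _ _ _ _ → refl) ⟩
  ∑ (bitVecs p) (λ _ → ∑ (bitVecs q) F)                        ≡⟨ ∑-const (bitVecs p) _ ⟩
  length (bitVecs p) * ∑ (bitVecs q) F                         ≡⟨ cong (_* ∑ (bitVecs q) F) (length-tuples bools p) ⟩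
  2 ^ p * ∑ (bitVecs q) F                                      ∎
  where
  open ≡-Reasoning
  cs : Vec (Fin p × Bool) q
  cs = Vec.map (_, false) ι
  first : ∀ i → proj₁ (lookup cs i) ≡ lookup ι i
  first i = cong proj₁ (Vec.lookup-map i (_, false) ι)
  inj′ : ∀ i j → proj₁ (lookup cs i) ≡ proj₁ (lookup cs j) → i ≡ j
  inj′ i j eq = inj i j (trans (sym (first i)) (trans eq (first j)))

unbalanced-count : ∀ E {p q} (ι : Vec (Fin p) q) → (∀ i j → lookup ι i ≡ lookup ι j → i ≡ j) →
  q * ∑ (bitVecs p) (λ r → ind (unbalanced E (Vec.map (lookup r) ι))) ≤ E * E * 2 ^ p
unbalanced-count E {p} {q} ι inj = *-cancelˡ-≤ (2 ^ q) {{m^n≢0 2 q}} (begin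
  2 ^ q * (q * ∑ (bitVecs p) (λ r → ind (unbalanced E (Vec.map (lookup r) ι))))   ≡⟨ exchange (2 ^ q) q _ ⟩
  q * (2 ^ q * ∑ (bitVecs p) (λ r → ind (unbalanced E (Vec.map (lookup r) ι))))   ≡⟨ cong (q *_) (map-lookup-uniform ι inj _) ⟩
  q * (2 ^ p * ∑ (bitVecs q) (ind ∘ unbalanced E))                                ≡⟨ exchange q (2 ^ p) _ ⟩
  2 ^ p * (q * ∑ (bitVecs q) (ind ∘ unbalanced E))                                ≤⟨ *-monoʳ-≤ (2 ^ p) (chebyshev E q) ⟩
  2 ^ p * (E * E * 2 ^ q)                                                         ≡⟨ rearrange (2 ^ p) (E * E) (2 ^ q) ⟩
  2 ^ q * (E * E * 2 ^ p)                                                         ∎)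
  where
  open ≤-Reasoning
  exchange : ∀ x y z → x * (y * z) ≡ y * (x * z)
  exchange = solve-∀
  rearrange : ∀ x y z → x * (y * z) ≡ z * (y * x)
  rearrange = solve-∀

↑ˡ≢↑ʳ : ∀ {m n} (i : Fin m) (j : Fin n) → i ↑ˡ n ≢ m ↑ʳ j
↑ˡ≢↑ʳ {m} {n} i j eq = <⇒≢ (≤-trans (Fin.toℕ<n i) (m≤m+n m (toℕ j)))
  (trans (sym (Fin.toℕ-↑ˡ i n)) (trans (cong toℕ eq) (Fin.toℕ-↑ʳ m j)))

n<2^n : ∀ n → n < 2 ^ n
n<2^n zero    = s≤s z≤n
n<2^n (suc n) = ≤-trans (+-mono-≤ (m^n>0 2 n) (n<2^n n)) (≤-reflexive (cong (2 ^ n +_) (sym (+-identityʳ (2 ^ n)))))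

lookup-fromList-injective : {xs : List A} → Unique xs → ∀ i j → lookup (Vec.fromList xs) i ≡ lookup (Vec.fromList xs) j → i ≡ j
lookup-fromList-injective (x∉ ∷ u) zero    zero    eq = refl
lookup-fromList-injective (x∉ ∷ u) zero    (suc j) eq = contradiction eq (All.lookup x∉ (VMem.∈-fromList⁻ (VMem.∈-lookup j _)))
lookup-fromList-injective (x∉ ∷ u) (suc i) zero    eq = contradiction (sym eq) (All.lookup x∉ (VMem.∈-fromList⁻ (VMem.∈-lookup i _)))
lookup-fromList-injective (x∉ ∷ u) (suc i) (suc j) eq = cong suc (lookup-fromList-injective u i j eq)

unique-tuples : {xs : List A} → Unique xs → ∀ s → Unique (tuples xs s)
unique-tuples u zero    = [] ∷ []
unique-tuples {xs = xs} u (suc s) = unique-concatMap (λ v → map (v ∷_) (tuples xs s)) u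
  (λ v → Unique.map⁺ Vec.∷-injectiveʳ (unique-tuples u s)) same
  where
  same : ∀ {v v′ c} → c ∈ map (v ∷_) (tuples xs s) → c ∈ map (v′ ∷_) (tuples xs s) → v ≡ v′
  same p q with ∈-map⁻ (_ ∷_) p | ∈-map⁻ (_ ∷_) q
  ... | _ , _ , refl | _ , _ , refl = refl

unique-bitVecs : ∀ q → Unique (bitVecs q)
unique-bitVecs = unique-tuples (((λ ()) ∷ []) ∷ [] ∷ [])

ind-∨ : ∀ x y → ind (x ∨ y) ≤ ind x + ind y
ind-∨ true  y = s≤s z≤n
ind-∨ false y = ≤-refl

skewed-count : ∀ {s t d} {M : Vec (Vec Bool s) t} (sh : Shatter d M) E →
  d * ∑ (bitVecs (s + t)) (ind ∘ skewed sh E) ≤ 2 * (E * E) * 2 ^ (s + t)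
skewed-count {s} {t} {d} sh E = begin
  d * ∑ R (ind ∘ skewed sh E)                ≤⟨ *-monoʳ-≤ d (∑-mono R (λ r → ind-∨ (unbalanced E (Vec.map (lookup r) (rows sh))) _)) ⟩
  d * ∑ R (λ r → pI r + qI r)                ≡⟨ cong (d *_) (∑-+ R pI qI) ⟩
  d * (∑ R pI + ∑ R qI)                      ≡⟨ *-distribˡ-+ d _ _ ⟩
  -- There are `2 ^ d ≥ d` realising columns, so both Chebyshev bounds can be put over the common
  -- denominator `d`.
  d * ∑ R pI + d * ∑ R qI                    ≤⟨ +-mono-≤ (unbalanced-count E (rows sh) rows-inj)
                                                  (≤-trans (*-monoˡ-≤ (∑ R qI) d≤) (unbalanced-count E (cols sh) cols-inj)) ⟩
  X + X                                      ≡⟨ double (E * E) (2 ^ (s + t)) ⟩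
  2 * (E * E) * 2 ^ (s + t)                  ∎
  where
  open ≤-Reasoning
  open Shatter sh
  R = bitVecs (s + t)
  X = E * E * 2 ^ (s + t)
  pI qI : Vec Bool (s + t) → ℕ
  pI r = ind (unbalanced E (Vec.map (lookup r) (rows sh)))
  qI r = ind (unbalanced E (Vec.map (lookup r) (cols sh)))
  double : ∀ x y → x * y + x * y ≡ 2 * x * y
  double = solve-∀
  d≤ : d ≤ length (bitVecs d)
  d≤ = ≤-trans (<⇒≤ (n<2^n d)) (≤-reflexive (sym (length-tuples bools d)))
  rows-inj : ∀ i j → lookup (rows sh) i ≡ lookup (rows sh) j → i ≡ j
  rows-inj i j eq = P-injective (Fin.↑ˡ-injective t _ _ (trans (sym (Vec.lookup-map i (_↑ˡ t) P)) (trans eq (Vec.lookup-map j (_↑ˡ t) P))))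
  cols-inj : ∀ i j → lookup (cols sh) i ≡ lookup (cols sh) j → i ≡ j
  cols-inj i j eq = lookup-fromList-injective (unique-bitVecs d) i j
    (Q-injective (Fin.↑ʳ-injective s _ _ (trans (sym (Vec.lookup-map i _ (Vec.fromList (bitVecs d)))) (trans eq (Vec.lookup-map j _ (Vec.fromList (bitVecs d)))))))

-- The shattered set is a function of the matrix alone. Whether a further vertex is skewed then
-- depends on fresh bits, so the bound holds for each matrix separately. A matrix with too few
-- columns gets the value 0.
skew : ∀ {s t} (d E : ℕ) (M : Vec (Vec Bool s) t) → Vec Bool (s + t) → ℕ
skew {s} d E M r with sauer s d <? columns M
... | yes lt = ind (skewed (shatter d M lt) E r)
... | no _   = 0

skew≤1 : ∀ {s t} d E (M : Vec (Vec Bool s) t) r → skew d E M r ≤ 1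
skew≤1 {s} d E M r with sauer s d <? columns M
... | yes lt = ind≤1 _
... | no _   = z≤n

skew-count : ∀ {s t} d E (M : Vec (Vec Bool s) t) → d * ∑ (bitVecs (s + t)) (skew d E M) ≤ 2 * (E * E) * 2 ^ (s + t)
skew-count {s} {t} d E M with sauer s d <? columns M
... | yes lt = skewed-count (shatter d M lt) E
... | no _   = ≤-trans (≤-reflexive (trans (cong (d *_) (∑-0 (bitVecs (s + t)))) (*-zeroʳ d))) z≤n

skew-shatter : ∀ {s t} d E (M : Vec (Vec Bool s) t) → few (sauer s d) M ≡ false →
               Σ (Shatter d M) λ sh → ∀ r → skew d E M r ≡ ind (skewed sh E r)
skew-shatter {s} d E M notFew with sauer s d <? columns M
... | yes lt = shatter d M lt , λ _ → refl
... | no ≮   = case trans (sym notFew) (dec-true (columns M ≤? sauer s d) (≮⇒≥ ≮)) of λ ()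

∏-≤1 : ∀ {s} (v : Vec A s) (f : A → ℕ) → (∀ x → f x ≤ 1) → ∏ v f ≤ 1
∏-≤1 []      f f≤1 = ≤-refl
∏-≤1 (x ∷ v) f f≤1 = *-mono-≤ (f≤1 x) (∏-≤1 v f f≤1)

∏-map : ∀ {s} (h : A → B) (v : Vec A s) (f : B → ℕ) → ∏ (Vec.map h v) f ≡ ∏ v (f ∘ h)
∏-map h []      f = refl
∏-map h (x ∷ v) f = cong (f (h x) *_) (∏-map h v f)

^-distribʳ-* : ∀ x y u → (x * y) ^ u ≡ x ^ u * y ^ u
^-distribʳ-* x y zero    = refl
^-distribʳ-* x y (suc u) = trans (cong (x * y *_) (^-distribʳ-* x y u)) (medial x y (x ^ u) (y ^ u))
  where
  medial : ∀ a b c d → a * b * (c * d) ≡ a * c * (b * d)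
  medial = solve-∀

-- Counts of bad tuples

module Bad {n} (T : Digraph n) where

  fewCount : ℕ → ℕ → ℕ → ℕ
  fewCount d s t = ∑ (tuples (vertices n) s) (λ x → ∑ (tuples (vertices n) t) (λ v → ind (few (sauer s d) (mat T x v))))

  skewCount : ∀ d E {s t} → Vec (Fin n) s → Vec (Fin n) t → ℕ
  skewCount d E x v = ∑ (vertices n) (λ w → skew d E (mat T x v) (row T (x Vec.++ v) w))

  -- Equivalently the number of tuples (x , v , w₁ , ... , w_u) in which every w is skewed, so that
  -- again only tuples of fixed length are averaged over the orientations.
  skewMoment : ℕ → ℕ → ℕ → ℕ → ℕ → ℕ
  skewMoment d E s t u = ∑ (tuples (vertices n) s) (λ x → ∑ (tuples (vertices n) t) (λ v → skewCount d E x v ^ u))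

open Bad public

-- Uniformity of patterns over random orientations

module Random {k n : ℕ} (CS : CycleSystem k n) (i₀ : Fin (length (CycleSystem.cycles CS))) (3≤k : 3 ≤ k) where
  open Orientation CS i₀ 3≤k

  private
    V = vertices n

  tour-≔ : ∀ b c z {u v} → idx u v ≢ c → tour (b [ c ]≔ z) u v ≡ tour b u v
  tour-≔ b c z {u} {v} ne = cong (λ x → if does (u Fin.≟ v) then false else dir u v xor x) (Vec.lookup∘updateAt′ (idx u v) c ne b)

  row-≔ : ∀ b c z {p} (X : Vec (Fin n) p) y → (∀ i → idx (lookup X i) y ≢ c) → row (tour (b [ c ]≔ z)) X y ≡ row (tour b) X y
  row-≔ b c z []      y ne = refl
  row-≔ b c z (x ∷ X) y ne = cong₂ _∷_ (tour-≔ b c z {x} {y} (ne zero)) (row-≔ b c z X y (ne ∘ suc))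

  mat-≔ : ∀ b c z {p t} (X : Vec (Fin n) p) (Y : Vec (Fin n) t) → (∀ i j → idx (lookup X i) (lookup Y j) ≢ c) →
          mat (tour (b [ c ]≔ z)) X Y ≡ mat (tour b) X Y
  mat-≔ b c z X []      ne = refl
  mat-≔ b c z X (y ∷ Y) ne = cong₂ _∷_ (row-≔ b c z X y (λ i → ne i zero)) (mat-≔ b c z X Y (λ i j → ne i (suc j)))

  row-readBits : ∀ b {p} (X : Vec (Fin n) p) y → (∀ i → lookup X i ≢ y) →
                 row (tour b) X y ≡ readBits b (Vec.map (λ x → idx x y , dir x y) X)
  row-readBits b []      y ne = refl
  row-readBits b (x ∷ X) y ne = cong₂ _∷_ (tour-≢ b (ne zero)) (row-readBits b X y (ne ∘ suc))

  -- Columns are peeled off one at a time by `readBits-uniform`, since all pairs between `X` and `Y`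
  -- lie on different cycles. `F` retains the argument `b` because the test applied to the matrix
  -- may itself depend on other bits, as `skew` does.
  mat-uniform : ∀ {p t} (X : Vec (Fin n) p) (Y : Vec (Fin n) t) (F : Vec (Vec Bool p) t → Vec Bool L → ℕ) →
    (∀ i j → lookup X i ≢ lookup Y j) →
    (∀ i j i′ j′ → idx (lookup X i) (lookup Y j) ≡ idx (lookup X i′) (lookup Y j′) → i ≡ i′ × j ≡ j′) →
    (∀ i j M b z → F M (b [ idx (lookup X i) (lookup Y j) ]≔ z) ≡ F M b) →
    (2 ^ p) ^ t * ∑ (bitVecs L) (λ b → F (mat (tour b) X Y) b) ≡ ∑ (bitVecs L) (λ b → ∑ (tuples (bitVecs p) t) (λ M → F M b))
  mat-uniform X [] F ne inj inv = trans (+-identityʳ _) (∑-cong (bitVecs L) (λ b → sym (+-identityʳ _)))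
  mat-uniform {p} {suc t} X (y ∷ Y) F ne inj inv = begin
    2 ^ p * N * ∑ 𝔹 (λ b → F (row (tour b) X y ∷ mat (tour b) X Y) b)
      ≡⟨ assoc (2 ^ p) N _ ⟩
    N * (2 ^ p * ∑ 𝔹 (λ b → F (row (tour b) X y ∷ mat (tour b) X Y) b))
      ≡⟨ cong (λ e → N * (2 ^ p * e)) (∑-cong 𝔹 (λ b → cong (λ r → F (r ∷ mat (tour b) X Y) b) (row-readBits b X y (λ i → ne i zero)))) ⟩
    N * (2 ^ p * ∑ 𝔹 (λ b → F (readBits b cs ∷ mat (tour b) X Y) b))
      ≡⟨ cong (N *_) (readBits-uniform cs (λ a b → F (a ∷ mat (tour b) X Y) b) inj′ inv′) ⟩
    N * ∑ 𝔹 (λ b → ∑ (bitVecs p) (λ a → F (a ∷ mat (tour b) X Y) b))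
      ≡⟨ cong (N *_) (∑-swap 𝔹 (bitVecs p) _) ⟩
    N * ∑ (bitVecs p) (λ a → ∑ 𝔹 (λ b → F (a ∷ mat (tour b) X Y) b))
      ≡⟨ ∑-*ˡ (bitVecs p) N _ ⟨
    ∑ (bitVecs p) (λ a → N * ∑ 𝔹 (λ b → F (a ∷ mat (tour b) X Y) b))
      ≡⟨ ∑-cong (bitVecs p) (λ a → mat-uniform X Y (λ M → F (a ∷ M)) (λ i j → ne i (suc j))
           (λ i j i′ j′ eq → Prod.map₂ Fin.suc-injective (inj i (suc j) i′ (suc j′) eq)) (λ i j M → inv i (suc j) (a ∷ M))) ⟩
    ∑ (bitVecs p) (λ a → ∑ 𝔹 (λ b → ∑ (tuples (bitVecs p) t) (λ M → F (a ∷ M) b)))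
      ≡⟨ ∑-swap (bitVecs p) 𝔹 _ ⟩
    ∑ 𝔹 (λ b → ∑ (bitVecs p) (λ a → ∑ (tuples (bitVecs p) t) (λ M → F (a ∷ M) b)))
      ≡⟨ ∑-cong 𝔹 (λ b → ∑-tuples-suc (bitVecs p) t (λ M → F M b)) ⟨
    ∑ 𝔹 (λ b → ∑ (tuples (bitVecs p) (suc t)) (λ M → F M b)) ∎
    where
    open ≡-Reasoning
    𝔹 = bitVecs L
    N = (2 ^ p) ^ t
    assoc : ∀ a b c → a * b * c ≡ b * (a * c)
    assoc = solve-∀
    cs : Vec (Fin L × Bool) p
    cs = Vec.map (λ x → idx x y , dir x y) X
    first : ∀ i → proj₁ (lookup cs i) ≡ idx (lookup X i) y
    first i = cong proj₁ (Vec.lookup-map i _ X)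
    inj′ : ∀ i j → proj₁ (lookup cs i) ≡ proj₁ (lookup cs j) → i ≡ j
    inj′ i j eq = proj₁ (inj i zero j zero (trans (sym (first i)) (trans eq (first j))))
    inv′ : ∀ i a b z → F (a ∷ mat (tour (b [ proj₁ (lookup cs i) ]≔ z)) X Y) (b [ proj₁ (lookup cs i) ]≔ z) ≡ F (a ∷ mat (tour b) X Y) b
    inv′ i a b z rewrite first i = trans (inv i zero _ b z)
      (cong (λ M → F (a ∷ M) b) (mat-≔ b _ z X Y (λ i′ j eq → case proj₂ (inj i′ (suc j) i zero eq) of λ ())))

  -- Tuples none of whose vertices lies on the cycle through two others

  -- For distinct vertices the cycle through them contains `u` anyway. On the diagonal the head `u`
  -- is what makes genericity imply that the entries of a tuple are distinct.
  block : Fin n → Fin n → List (Fin n)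
  block u v = u ∷ cyc (idx u v)

  private
    hit : Fin n → List (Fin n) → ℕ
    hit z c = ∑ c (λ x → δ x z)

    hit-0 : ∀ {z c} → hit z c ≡ 0 → z ∉ c
    hit-0 {z} eq z∈ = case trans (sym (cong ind (dec-true (z Fin.≟ z) refl))) (∑-≡0 (λ x → δ x z) eq z∈) of λ ()

    ∑-hit : ∀ c → ∑ V (λ z → hit z c) ≡ length c
    ∑-hit c = trans (∑-swap V c _) (trans (∑-cong c (λ x → trans (∑-cong V (λ z → δ-sym x z)) (∑-vertices-δ x))) (sym (length≡∑1 c)))

    term : ∀ {h} (i j l : Fin h) → Vec (Fin n) h → ℕ
    term i j l φ with l Fin.≟ i | l Fin.≟ j
    ... | no _ | no _ = hit (lookup φ l) (block (lookup φ i) (lookup φ j))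
    ... | _    | _    = 0

  clash : ∀ {h} → Vec (Fin n) h → ℕ
  clash {h} φ = ∑ (allFin h) (λ i → ∑ (allFin h) (λ j → ∑ (allFin h) (λ l → term i j l φ)))

  private
    -- The block of the entries at `i` and `j` does not change when the entry at `l` is redrawn, and
    -- it has `suc k` members for the new entry to hit.
    term-bound : ∀ {h} (i j l : Fin h) → n * ∑ (tuples V h) (term i j l) ≤ suc k * n ^ h
    term-bound {h} i j l = begin
      n * ∑ (tuples V h) (term i j l)                                ≡⟨ cong (_* ∑ (tuples V h) (term i j l)) (length-vertices n) ⟨
      length V * ∑ (tuples V h) (term i j l)                         ≡⟨ ∑-resample V l (term i j l) ⟩
      ∑ (tuples V h) (λ φ → ∑ V (λ z → term i j l (φ [ l ]≔ z)))     ≤⟨ ∑-mono (tuples V h) resampled ⟩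
      ∑ (tuples V h) (λ _ → suc k)                                   ≡⟨ ∑-const (tuples V h) (suc k) ⟩
      length (tuples V h) * suc k                                    ≡⟨ cong (_* suc k) (trans (length-tuples V h) (cong (_^ h) (length-vertices n))) ⟩
      n ^ h * suc k                                                  ≡⟨ *-comm (n ^ h) (suc k) ⟩
      suc k * n ^ h                                                  ∎
      where
      open ≤-Reasoning
      resampled : ∀ φ → ∑ V (λ z → term i j l (φ [ l ]≔ z)) ≤ suc k
      resampled φ with l Fin.≟ i | l Fin.≟ j
      ... | yes _  | _      = ≤-trans (≤-reflexive (∑-0 V)) z≤n
      ... | no _   | yes _  = ≤-trans (≤-reflexive (∑-0 V)) z≤n
      ... | no l≢i | no l≢j = ≤-reflexive (trans (∑-cong V fresh) (trans (∑-hit (block (lookup φ i) (lookup φ j))) (cong suc (cyc-size _))))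
        where
        fresh : ∀ z → hit (lookup (φ [ l ]≔ z) l) (block (lookup (φ [ l ]≔ z) i) (lookup (φ [ l ]≔ z) j)) ≡ hit z (block (lookup φ i) (lookup φ j))
        fresh z = cong₂ hit (Vec.lookup∘updateAt l φ)
          (cong₂ block (Vec.lookup∘updateAt′ i l (l≢i ∘ sym) φ) (Vec.lookup∘updateAt′ j l (l≢j ∘ sym) φ))

  -- One term for each of the `h * h * h` index triples. Non-generic tuples thus form a fraction of
  -- order 1/n, which is the whole cost of the dependence inside a cycle.
  clash-bound : ∀ h → n * ∑ (tuples V h) clash ≤ h * h * h * suc k * n ^ h
  clash-bound h = begin
    n * ∑ Φ clash
      ≡⟨ cong (n *_) (∑-swap Φ I _) ⟩
    n * ∑ I (λ i → ∑ Φ (λ φ → ∑ I (λ j → ∑ I (λ l → term i j l φ))))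
      ≡⟨ cong (n *_) (∑-cong I (λ i → ∑-swap Φ I _)) ⟩
    n * ∑ I (λ i → ∑ I (λ j → ∑ Φ (λ φ → ∑ I (λ l → term i j l φ))))
      ≡⟨ cong (n *_) (∑-cong I (λ i → ∑-cong I (λ j → ∑-swap Φ I _))) ⟩
    n * ∑ I (λ i → ∑ I (λ j → ∑ I (λ l → ∑ Φ (term i j l))))
      ≡⟨ ∑-*ˡ I n _ ⟨
    ∑ I (λ i → n * ∑ I (λ j → ∑ I (λ l → ∑ Φ (term i j l))))
      ≡⟨ ∑-cong I (λ i → ∑-*ˡ I n _) ⟨
    ∑ I (λ i → ∑ I (λ j → n * ∑ I (λ l → ∑ Φ (term i j l))))
      ≡⟨ ∑-cong I (λ i → ∑-cong I (λ j → ∑-*ˡ I n _)) ⟨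
    ∑ I (λ i → ∑ I (λ j → ∑ I (λ l → n * ∑ Φ (term i j l))))
      ≤⟨ ∑-mono I (λ i → ∑-mono I (λ j → ∑-mono I (λ l → term-bound i j l))) ⟩
    ∑ I (λ i → ∑ I (λ j → ∑ I (λ l → suc k * n ^ h)))
      ≡⟨ trans (∑-const I _) (cong₂ _*_ len (trans (∑-const I _) (cong₂ _*_ len (trans (∑-const I _) (cong (_* (suc k * n ^ h)) len))))) ⟩
    h * (h * (h * (suc k * n ^ h)))
      ≡⟨ assoc h (suc k) (n ^ h) ⟩
    h * h * h * suc k * n ^ h ∎
    where
    open ≤-Reasoning
    Φ = tuples V h
    I = allFin h
    len : length I ≡ h
    len = length-tabulate {n = h} id
    assoc : ∀ a b c → a * (a * (a * (b * c))) ≡ a * a * a * b * c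
    assoc = solve-∀

  module _ {h} (φ : Vec (Fin n) h) (generic : clash φ ≡ 0) where

    generic-∉ : ∀ i j l → l ≢ i → l ≢ j → lookup φ l ∉ block (lookup φ i) (lookup φ j)
    generic-∉ i j l l≢i l≢j = hit-0 (zero-term (∑-≡0 _ (∑-≡0 _ (∑-≡0 _ generic (∈-allFin i)) (∈-allFin j)) (∈-allFin l)))
      where
      zero-term : term i j l φ ≡ 0 → hit (lookup φ l) (block (lookup φ i) (lookup φ j)) ≡ 0
      zero-term eq with l Fin.≟ i | l Fin.≟ j
      ... | yes p | _     = contradiction p l≢i
      ... | no _  | yes p = contradiction p l≢j
      ... | no _  | no _  = eq

    generic-≢ : ∀ i l → l ≢ i → lookup φ l ≢ lookup φ i
    generic-≢ i l l≢i eq = generic-∉ i i l l≢i l≢i (here eq)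

    -- If two pairs of entries share a cycle, the second pair lies on the cycle through the first,
    -- and genericity allows no third entry there.
    generic-idx : ∀ i j i′ j′ → i′ ≢ j′ → idx (lookup φ i) (lookup φ j) ≡ idx (lookup φ i′) (lookup φ j′) →
                  (i′ ≡ i ⊎ i′ ≡ j) × (j′ ≡ i ⊎ j′ ≡ j)
    generic-idx i j i′ j′ i′≢j′ eq = among i′ (proj₁ ends) , among j′ (proj₂ ends)
      where
      ends : lookup φ i′ ∈ cyc (idx (lookup φ i) (lookup φ j)) × lookup φ j′ ∈ cyc (idx (lookup φ i) (lookup φ j))
      ends rewrite eq = cycle-vertex (generic-≢ j′ i′ i′≢j′)
      among : ∀ l → lookup φ l ∈ cyc (idx (lookup φ i) (lookup φ j)) → l ≡ i ⊎ l ≡ j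
      among l l∈ with l Fin.≟ i | l Fin.≟ j
      ... | yes p  | _      = inj₁ p
      ... | no _   | yes p  = inj₂ p
      ... | no l≢i | no l≢j = contradiction (there l∈) (generic-∉ i j l l≢i l≢j)

  module _ {p t} (X : Vec (Fin n) p) (Y : Vec (Fin n) t) (generic : clash (X Vec.++ Y) ≡ 0) where

    private
      φ = X Vec.++ Y
      atX : ∀ i → lookup φ (i ↑ˡ t) ≡ lookup X i
      atX = Vec.lookup-++ˡ X Y
      atY : ∀ j → lookup φ (p ↑ʳ j) ≡ lookup Y j
      atY = Vec.lookup-++ʳ X Y

    generic-++-≢ : ∀ i j → lookup X i ≢ lookup Y j
    generic-++-≢ i j eq = generic-≢ φ generic (p ↑ʳ j) (i ↑ˡ t) (↑ˡ≢↑ʳ i j) (trans (atX i) (trans eq (sym (atY j))))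

    generic-++-idx : ∀ i j i′ j′ → idx (lookup X i) (lookup Y j) ≡ idx (lookup X i′) (lookup Y j′) → i ≡ i′ × j ≡ j′
    generic-++-idx i j i′ j′ eq with generic-idx φ generic (i ↑ˡ t) (p ↑ʳ j) (i′ ↑ˡ t) (p ↑ʳ j′) (↑ˡ≢↑ʳ i′ j′)
                                       (trans (cong₂ idx (atX i) (atY j)) (trans eq (sym (cong₂ idx (atX i′) (atY j′)))))
    ... | inj₁ e , inj₂ e′ = sym (Fin.↑ˡ-injective t _ _ e) , sym (Fin.↑ʳ-injective p _ _ e′)
    ... | inj₂ e , _       = contradiction e (↑ˡ≢↑ʳ i′ j)
    ... | _      , inj₁ e′ = contradiction (sym e′) (↑ˡ≢↑ʳ i j′)

    -- Keeps the bits that determine the shattered set, which are read inside `X`, apart from the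
    -- bits towards the further vertices in `Y`.
    generic-inner-idx : ∀ i i₂ i′ j′ → i ≢ i₂ → idx (lookup X i) (lookup X i₂) ≢ idx (lookup X i′) (lookup Y j′)
    generic-inner-idx i i₂ i′ j′ i≢i₂ eq with generic-idx φ generic (i ↑ˡ t) (i₂ ↑ˡ t) (i′ ↑ˡ t) (p ↑ʳ j′) (↑ˡ≢↑ʳ i′ j′)
                                       (trans (cong₂ idx (atX i) (atX i₂)) (trans eq (sym (cong₂ idx (atX i′) (atY j′)))))
    ... | _ , inj₁ e = ↑ˡ≢↑ʳ i j′ (sym e)
    ... | _ , inj₂ e = ↑ˡ≢↑ʳ i₂ j′ (sym e)

-- First moments over all orientations

take-++ˡ : ∀ {m n} (xs : Vec A m) (ys : Vec A n) → Vec.take m (xs Vec.++ ys) ≡ xs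
take-++ˡ []       ys = refl
take-++ˡ (x ∷ xs) ys = cong (x ∷_) (take-++ˡ xs ys)

drop-++ˡ : ∀ {m n} (xs : Vec A m) (ys : Vec A n) → Vec.drop m (xs Vec.++ ys) ≡ ys
drop-++ˡ []       ys = refl
drop-++ˡ (x ∷ xs) ys = drop-++ˡ xs ys

module FirstMoment {k n : ℕ} (CS : CycleSystem k n) (i₀ : Fin (length (CycleSystem.cycles CS))) (3≤k : 3 ≤ k) where
  open Orientation CS i₀ 3≤k
  open Random CS i₀ 3≤k

  private
    V = vertices n
    𝔹 = bitVecs L

    length-𝔹 : length 𝔹 ≡ 2 ^ L
    length-𝔹 = length-tuples bools L

    -- A quantity in {0,1} contributes at most its generic average plus the number of clashes.
    dichotomy : ∀ c (N X : ℕ) (F : Vec Bool L → ℕ) → (∀ b → F b ≤ 1) → (c ≡ 0 → N * ∑ 𝔹 F ≤ 2 ^ L * X) →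
                N * ∑ 𝔹 F ≤ 2 ^ L * (X + N * c)
    dichotomy zero    N X F F≤1 gen = ≤-trans (gen refl) (*-monoʳ-≤ (2 ^ L) (m≤m+n X (N * 0)))
    dichotomy (suc c) N X F F≤1 gen = begin
      N * ∑ 𝔹 F                   ≤⟨ *-monoʳ-≤ N (∑-mono 𝔹 F≤1) ⟩
      N * ∑ 𝔹 (λ _ → 1)           ≡⟨ cong (N *_) (trans (sym (length≡∑1 𝔹)) length-𝔹) ⟩
      N * 2 ^ L                   ≡⟨ *-comm N (2 ^ L) ⟩
      2 ^ L * N                   ≡⟨ cong (2 ^ L *_) (*-identityʳ N) ⟨
      2 ^ L * (N * 1)             ≤⟨ *-monoʳ-≤ (2 ^ L) (*-monoʳ-≤ N (s≤s z≤n)) ⟩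
      2 ^ L * (N * suc c)         ≤⟨ *-monoʳ-≤ (2 ^ L) (m≤n+m (N * suc c) X) ⟩
      2 ^ L * (X + N * suc c)     ∎
      where open ≤-Reasoning

    total : ∀ h N X (F : Vec (Fin n) h → Vec Bool L → ℕ) →
            (∀ φ → N * ∑ 𝔹 (F φ) ≤ 2 ^ L * (X + N * clash φ)) →
            n * (N * ∑ 𝔹 (λ b → ∑ (tuples V h) (λ φ → F φ b))) ≤ 2 ^ L * (n ^ h * (n * X + N * (h * h * h * suc k)))
    total h N X F each = begin
      n * (N * ∑ 𝔹 (λ b → ∑ Φ (λ φ → F φ b)))                   ≡⟨ cong (λ e → n * (N * e)) (∑-swap 𝔹 Φ _) ⟩
      n * (N * ∑ Φ (λ φ → ∑ 𝔹 (F φ)))                           ≡⟨ cong (n *_) (∑-*ˡ Φ N _) ⟨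
      n * ∑ Φ (λ φ → N * ∑ 𝔹 (F φ))                             ≤⟨ *-monoʳ-≤ n (∑-mono Φ each) ⟩
      n * ∑ Φ (λ φ → 2 ^ L * (X + N * clash φ))                 ≡⟨ cong (n *_) (trans (∑-*ˡ Φ (2 ^ L) _) (cong (2 ^ L *_) (∑-+ Φ _ _))) ⟩
      n * (2 ^ L * (∑ Φ (λ _ → X) + ∑ Φ (λ φ → N * clash φ)))   ≡⟨ cong (λ e → n * (2 ^ L * e)) (cong₂ _+_ (trans (∑-const Φ X) (cong (_* X) lenΦ)) (∑-*ˡ Φ N clash)) ⟩
      n * (2 ^ L * (n ^ h * X + N * ∑ Φ clash))                 ≡⟨ regroup n (2 ^ L) (n ^ h) X N (∑ Φ clash) ⟩
      2 ^ L * (n ^ h * (n * X) + N * (n * ∑ Φ clash))           ≤⟨ *-monoʳ-≤ (2 ^ L) (+-monoʳ-≤ (n ^ h * (n * X)) (*-monoʳ-≤ N (clash-bound h))) ⟩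
      2 ^ L * (n ^ h * (n * X) + N * (h * h * h * suc k * n ^ h)) ≡⟨ regroup′ (2 ^ L) (n ^ h) (n * X) N (h * h * h * suc k) ⟩
      2 ^ L * (n ^ h * (n * X + N * (h * h * h * suc k)))       ∎
      where
      open ≤-Reasoning
      Φ = tuples V h
      lenΦ : length Φ ≡ n ^ h
      lenΦ = trans (length-tuples V h) (cong (_^ h) (length-vertices n))
      regroup : ∀ n l m x N c → n * (l * (m * x + N * c)) ≡ l * (m * (n * x) + N * (n * c))
      regroup = solve-∀
      regroup′ : ∀ l m x N c → l * (m * x + N * (c * m)) ≡ l * (m * (x + N * c))
      regroup′ = solve-∀

  -- On a generic tuple the pattern matrix is uniform and `few-bound` applies; the summand with
  -- `suc k` pays for the clashes.
  few-moment : ∀ d s t → n * ((2 ^ s) ^ t * ∑ 𝔹 (λ b → fewCount (tour b) d s t)) ≤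
    2 ^ L * (n ^ (s + t) * (n * ((2 ^ s) ^ sauer s d * sauer s d ^ t) + (2 ^ s) ^ t * ((s + t) * (s + t) * (s + t) * suc k)))
  few-moment d s t = subst (λ e → n * ((2 ^ s) ^ t * e) ≤ _) (∑-cong 𝔹 regroup)
    (total (s + t) ((2 ^ s) ^ t) ((2 ^ s) ^ g * g ^ t) F each)
    where
    g = sauer s d
    f : Vec (Fin n) s → Vec (Fin n) t → Vec Bool L → ℕ
    f x v b = ind (few g (mat (tour b) x v))
    F : Vec (Fin n) (s + t) → Vec Bool L → ℕ
    F φ = f (Vec.take s φ) (Vec.drop s φ)
    regroup : ∀ b → ∑ (tuples V (s + t)) (λ φ → F φ b) ≡ fewCount (tour b) d s t
    regroup b = trans (∑-tuples-+ V s t _) (∑-cong (tuples V s) (λ x → ∑-cong (tuples V t) (λ v →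
      cong₂ (λ x v → f x v b) (take-++ˡ x v) (drop-++ˡ x v))))
    generic : ∀ x v → clash (x Vec.++ v) ≡ 0 → (2 ^ s) ^ t * ∑ 𝔹 (f x v) ≤ 2 ^ L * ((2 ^ s) ^ g * g ^ t)
    generic x v gen = begin
      (2 ^ s) ^ t * ∑ 𝔹 (f x v)                              ≡⟨ mat-uniform x v (λ M _ → ind (few g M)) (generic-++-≢ x v gen) (generic-++-idx x v gen) (λ _ _ _ _ _ → refl) ⟩
      ∑ 𝔹 (λ _ → ∑ (tuples (bitVecs s) t) (ind ∘ few g))     ≡⟨ trans (∑-const 𝔹 _) (cong (_* ∑ (tuples (bitVecs s) t) (ind ∘ few g)) length-𝔹) ⟩
      2 ^ L * ∑ (tuples (bitVecs s) t) (ind ∘ few g)         ≤⟨ *-monoʳ-≤ (2 ^ L) (few-bound s t g) ⟩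
      2 ^ L * ((2 ^ s) ^ g * g ^ t)                          ∎
      where open ≤-Reasoning
    each : ∀ φ → (2 ^ s) ^ t * ∑ 𝔹 (F φ) ≤ 2 ^ L * ((2 ^ s) ^ g * g ^ t + (2 ^ s) ^ t * clash φ)
    each φ = dichotomy (clash φ) ((2 ^ s) ^ t) _ (F φ) (λ b → ind≤1 _)
      (λ gen → generic (Vec.take s φ) (Vec.drop s φ) (trans (cong clash (Vec.take++drop≡id s φ)) gen))

  -- Given the bits between `x` and `v`, the rows of the `u` further vertices are independent and
  -- uniform on a generic tuple. So all of them are skewed with at most the `u`-th power of the
  -- Chebyshev bound for one.
  skew-moment : ∀ d E s t u → n * (d ^ u * ∑ 𝔹 (λ b → skewMoment (tour b) d E s t u)) ≤
    2 ^ L * (n ^ (s + t + u) * (n * (2 * (E * E)) ^ u + d ^ u * ((s + t + u) * (s + t + u) * (s + t + u) * suc k)))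
  skew-moment d E s t u = subst (λ e → n * (d ^ u * e) ≤ _) (∑-cong 𝔹 regroup)
    (total (s + t + u) (d ^ u) ((2 * (E * E)) ^ u) F each)
    where
    p = s + t
    f : Vec (Fin n) s → Vec (Fin n) t → Vec (Fin n) u → Vec Bool L → ℕ
    f x v w b = ∏ w (λ y → skew d E (mat (tour b) x v) (row (tour b) (x Vec.++ v) y))
    F : Vec (Fin n) (p + u) → Vec Bool L → ℕ
    F φ = f (Vec.take s (Vec.take p φ)) (Vec.drop s (Vec.take p φ)) (Vec.drop p φ)
    cong₃ : ∀ {x x′ v v′ w w′} b → x ≡ x′ → v ≡ v′ → w ≡ w′ → f x v w b ≡ f x′ v′ w′ b
    cong₃ b refl refl refl = refl
    regroup : ∀ b → ∑ (tuples V (p + u)) (λ φ → F φ b) ≡ skewMoment (tour b) d E s t u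
    regroup b = begin
      ∑ (tuples V (p + u)) (λ φ → F φ b)
        ≡⟨ ∑-tuples-+ V p u _ ⟩
      ∑ (tuples V p) (λ z → ∑ (tuples V u) (λ w → F (z Vec.++ w) b))
        ≡⟨ ∑-tuples-+ V s t _ ⟩
      ∑ (tuples V s) (λ x → ∑ (tuples V t) (λ v → ∑ (tuples V u) (λ w → F ((x Vec.++ v) Vec.++ w) b)))
        ≡⟨ ∑-cong (tuples V s) (λ x → ∑-cong (tuples V t) (λ v → trans (∑-cong (tuples V u) (λ w → cong₃ b
             (trans (cong (Vec.take s) (take-++ˡ (x Vec.++ v) w)) (take-++ˡ x v))
             (trans (cong (Vec.drop s) (take-++ˡ (x Vec.++ v) w)) (drop-++ˡ x v))
             (drop-++ˡ (x Vec.++ v) w))) (∑-tuples-∏ V u _))) ⟩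
      skewMoment (tour b) d E s t u ∎
      where open ≡-Reasoning
    generic : ∀ x v w → clash ((x Vec.++ v) Vec.++ w) ≡ 0 → d ^ u * ∑ 𝔹 (f x v w) ≤ 2 ^ L * (2 * (E * E)) ^ u
    generic x v w gen = *-cancelˡ-≤ ((2 ^ p) ^ u) {{m^n≢0 (2 ^ p) u {{m^n≢0 2 p}}}} (begin
      (2 ^ p) ^ u * (d ^ u * ∑ 𝔹 (f x v w))
        ≡⟨ exchange ((2 ^ p) ^ u) (d ^ u) _ ⟩
      d ^ u * ((2 ^ p) ^ u * ∑ 𝔹 (f x v w))
        ≡⟨ cong (λ e → d ^ u * ((2 ^ p) ^ u * e)) (∑-cong 𝔹 (λ b → sym (∏-map (row (tour b) (x Vec.++ v)) w (skew d E (mat (tour b) x v))))) ⟩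
      d ^ u * ((2 ^ p) ^ u * ∑ 𝔹 (λ b → G (mat (tour b) (x Vec.++ v) w) b))
        ≡⟨ cong (d ^ u *_) (mat-uniform (x Vec.++ v) w G (generic-++-≢ (x Vec.++ v) w gen) (generic-++-idx (x Vec.++ v) w gen) invariant) ⟩
      d ^ u * ∑ 𝔹 (λ b → ∑ (tuples (bitVecs p) u) (λ R → G R b))
        ≡⟨ cong (d ^ u *_) (∑-cong 𝔹 (λ b → ∑-tuples-∏ (bitVecs p) u (skew d E (mat (tour b) x v)))) ⟩
      d ^ u * ∑ 𝔹 (λ b → ∑ (bitVecs p) (skew d E (mat (tour b) x v)) ^ u)
        ≡⟨ ∑-*ˡ 𝔹 (d ^ u) _ ⟨
      ∑ 𝔹 (λ b → d ^ u * ∑ (bitVecs p) (skew d E (mat (tour b) x v)) ^ u)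
        ≡⟨ ∑-cong 𝔹 (λ b → ^-distribʳ-* d _ u) ⟨
      ∑ 𝔹 (λ b → (d * ∑ (bitVecs p) (skew d E (mat (tour b) x v))) ^ u)
        ≤⟨ ∑-mono 𝔹 (λ b → ^-monoˡ-≤ u (skew-count d E (mat (tour b) x v))) ⟩
      ∑ 𝔹 (λ b → (2 * (E * E) * 2 ^ p) ^ u)
        ≡⟨ trans (∑-const 𝔹 _) (cong₂ _*_ length-𝔹 (^-distribʳ-* (2 * (E * E)) (2 ^ p) u)) ⟩
      2 ^ L * ((2 * (E * E)) ^ u * (2 ^ p) ^ u)
        ≡⟨ rotate (2 ^ L) ((2 * (E * E)) ^ u) ((2 ^ p) ^ u) ⟩
      (2 ^ p) ^ u * (2 ^ L * (2 * (E * E)) ^ u) ∎)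
      where
      open ≤-Reasoning
      exchange : ∀ x y z → x * (y * z) ≡ y * (x * z)
      exchange = solve-∀
      rotate : ∀ x y z → x * (y * z) ≡ z * (x * y)
      rotate = solve-∀
      G : Vec (Vec Bool p) u → Vec Bool L → ℕ
      G R b = ∏ R (skew d E (mat (tour b) x v))
      invariant : ∀ i j R b z → G R (b [ idx (lookup (x Vec.++ v) i) (lookup w j) ]≔ z) ≡ G R b
      invariant i j R b z = cong (λ M → ∏ R (skew d E M)) (mat-≔ b _ z x v (λ i′ j′ eq →
        generic-inner-idx (x Vec.++ v) w gen (i′ ↑ˡ t) (s ↑ʳ j′) i j (↑ˡ≢↑ʳ i′ j′)
          (trans (cong₂ idx (Vec.lookup-++ˡ x v i′) (Vec.lookup-++ʳ x v j′)) eq)))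
    each : ∀ φ → d ^ u * ∑ 𝔹 (F φ) ≤ 2 ^ L * ((2 * (E * E)) ^ u + d ^ u * clash φ)
    each φ = dichotomy (clash φ) (d ^ u) _ (F φ)
      (λ b → ∏-≤1 (Vec.drop p φ) _ (λ y → skew≤1 d E (mat (tour b) (Vec.take s (Vec.take p φ)) (Vec.drop s (Vec.take p φ))) _))
      (λ gen → generic (Vec.take s (Vec.take p φ)) (Vec.drop s (Vec.take p φ)) (Vec.drop p φ)
        (trans (cong clash (trans (cong (Vec._++ Vec.drop p φ) (Vec.take++drop≡id s (Vec.take p φ))) (Vec.take++drop≡id p φ))) gen))

  -- The weights `c` and `a` measure both averages in units of `a * c`, each using half of it. An
  -- orientation whose combined value is below `a * c` then meets both bounds.
  markov : ∀ (f g : Vec Bool L → ℕ) a c → 1 ≤ a → 1 ≤ c → 2 * ∑ 𝔹 f ≤ 2 ^ L * a → 2 * ∑ 𝔹 g < 2 ^ L * c →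
           ∃ λ b → f b ≤ a × g b < c
  markov f g a c 1≤a 1≤c f≤ g< with ∑-average 𝔹 (λ b → c * f b + a * g b) (a * c) (*-cancelˡ-< 2 _ _ (begin-strict
      2 * ∑ 𝔹 (λ b → c * f b + a * g b)             ≡⟨ cong (2 *_) (trans (∑-+ 𝔹 _ _) (cong₂ _+_ (∑-*ˡ 𝔹 c f) (∑-*ˡ 𝔹 a g))) ⟩
      2 * (c * ∑ 𝔹 f + a * ∑ 𝔹 g)                   ≡⟨ distribute c a (∑ 𝔹 f) (∑ 𝔹 g) ⟩
      c * (2 * ∑ 𝔹 f) + a * (2 * ∑ 𝔹 g)             <⟨ +-mono-≤-< (*-monoʳ-≤ c f≤) (*-monoʳ-< a {{>-nonZero 1≤a}} g<) ⟩
      c * (2 ^ L * a) + a * (2 ^ L * c)             ≡⟨ collect c a (2 ^ L) ⟩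
      2 * (2 ^ L * (a * c))                         ≡⟨ cong (λ l → 2 * (l * (a * c))) length-𝔹 ⟨
      2 * (length 𝔹 * (a * c))                      ∎))
    where
    open ≤-Reasoning
    distribute : ∀ c a x y → 2 * (c * x + a * y) ≡ c * (2 * x) + a * (2 * y)
    distribute = solve-∀
    collect : ∀ c a l → c * (l * a) + a * (l * c) ≡ 2 * (l * (a * c))
    collect = solve-∀
  ... | b , _ , lt = b
    , <⇒≤ (*-cancelˡ-< c _ _ (≤-<-trans (m≤m+n (c * f b) (a * g b)) (<-≤-trans lt (≤-reflexive (*-comm a c)))))
    , *-cancelˡ-< a _ _ (≤-<-trans (m≤n+m (a * g b) (c * f b)) lt)

-- Directed cycles through a shattered set

HasCycle : ∀ {n} → Digraph n → ℕ → Set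
HasCycle D k = ∃ λ c → length c ≡ k × Unique c × AllArcs D (closedWalk c)

converse : ∀ {n} → Digraph n → Digraph n
converse D u v = D v u

hasCycle-converse : ∀ {n} {D : Digraph n} {k} → HasCycle (converse D) k → HasCycle D k
hasCycle-converse (c , len , u , arcs) = reverseCycle c
  , trans (Perm.↭-length (reverseCycle-↭ c)) len
  , Unique-resp-↭ (↭-sym (reverseCycle-↭ c)) u
  , Perm.All-resp-↭ (↭-sym (closedWalk-reverse c)) (All.map⁺ arcs)

∑-allFin-suc : ∀ {d} (f : Fin (suc d) → ℕ) → ∑ (allFin (suc d)) f ≡ f zero + ∑ (allFin d) (f ∘ suc)
∑-allFin-suc {d} f = cong (f zero +_) (trans (cong (λ xs → ∑ xs f) (sym (map-tabulate id suc))) (∑-map suc (allFin d) f))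

-- If no marked vector is true at a marked coordinate, the marked vectors lie in a subcube.
cube-meet : ∀ d (f : Vec Bool d → Bool) (g : Fin d → Bool) →
  (∃ λ l → ∃ λ a → g l ≡ true × f a ≡ true × lookup a l ≡ true) ⊎
  ∑ (bitVecs d) (ind ∘ f) * 2 ^ ∑ (allFin d) (ind ∘ g) ≤ 2 ^ d
cube-meet zero f g = inj₂ (≤-trans (≤-reflexive (trans (*-identityʳ _) (+-identityʳ _))) (ind≤1 (f [])))
cube-meet (suc d) f g = step (g zero) refl (cube-meet d (λ a → f (true ∷ a)) (g ∘ suc)) (cube-meet d (λ a → f (false ∷ a)) (g ∘ suc))
  where
  open ≤-Reasoning
  F₁ = ∑ (bitVecs d) (λ a → ind (f (true ∷ a)))
  F₀ = ∑ (bitVecs d) (λ a → ind (f (false ∷ a)))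
  G = ∑ (allFin d) (ind ∘ g ∘ suc)
  Meets : (Vec Bool d → Bool) → Set
  Meets f = ∃ λ l → ∃ λ a → g (suc l) ≡ true × f a ≡ true × lookup a l ≡ true
  Goal : Set
  Goal = (∃ λ l → ∃ λ a → g l ≡ true × f a ≡ true × lookup a l ≡ true) ⊎
         ∑ (bitVecs (suc d)) (ind ∘ f) * 2 ^ ∑ (allFin (suc d)) (ind ∘ g) ≤ 2 ^ suc d
  unfold : ∑ (bitVecs (suc d)) (ind ∘ f) * 2 ^ ∑ (allFin (suc d)) (ind ∘ g) ≡ (F₁ + (F₀ + 0)) * 2 ^ (ind (g zero) + G)
  unfold = cong₂ (λ x y → x * 2 ^ y) (∑-tuples-suc bools d _) (∑-allFin-suc (ind ∘ g))
  distribute : ∀ x y z → (x + (y + 0)) * z ≡ x * z + (y * z + 0)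
  distribute = solve-∀
  double : ∀ y z → (y + 0) * (2 * z) ≡ 2 * (y * z)
  double = solve-∀
  some : ∀ (xs : List (Vec Bool d)) → 0 < ∑ xs (λ a → ind (f (true ∷ a))) → ∃ λ a → f (true ∷ a) ≡ true
  some (x ∷ xs) lt with f (true ∷ x) in e
  ... | true  = x , e
  ... | false = some xs lt
  marked : g zero ≡ true → ∀ m → F₁ ≡ m → F₀ * 2 ^ G ≤ 2 ^ d → Goal
  marked g₀ (suc m) eq le₀ = let a , fa = some (bitVecs d) (≤-trans (s≤s z≤n) (≤-reflexive (sym eq))) in inj₁ (zero , true ∷ a , g₀ , fa , refl)
  marked g₀ zero    eq le₀ = inj₂ (begin
    ∑ (bitVecs (suc d)) (ind ∘ f) * 2 ^ ∑ (allFin (suc d)) (ind ∘ g)   ≡⟨ unfold ⟩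
    (F₁ + (F₀ + 0)) * 2 ^ (ind (g zero) + G)                          ≡⟨ cong₂ (λ x z → (x + (F₀ + 0)) * 2 ^ (ind z + G)) eq g₀ ⟩
    (F₀ + 0) * (2 * 2 ^ G)                                            ≡⟨ double F₀ (2 ^ G) ⟩
    2 * (F₀ * 2 ^ G)                                                  ≤⟨ *-monoʳ-≤ 2 le₀ ⟩
    2 ^ suc d                                                         ∎)
  step : ∀ z → g zero ≡ z → Meets (λ a → f (true ∷ a)) ⊎ F₁ * 2 ^ G ≤ 2 ^ d → Meets (λ a → f (false ∷ a)) ⊎ F₀ * 2 ^ G ≤ 2 ^ d → Goal
  step z g₀ (inj₁ (l , a , gl , fa , al)) _ = inj₁ (suc l , true ∷ a , gl , fa , al)
  step z g₀ (inj₂ _) (inj₁ (l , a , gl , fa , al)) = inj₁ (suc l , false ∷ a , gl , fa , al)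
  step true  g₀ (inj₂ _) (inj₂ le₀) = marked g₀ F₁ refl le₀
  step false g₀ (inj₂ le₁) (inj₂ le₀) = inj₂ (begin
    ∑ (bitVecs (suc d)) (ind ∘ f) * 2 ^ ∑ (allFin (suc d)) (ind ∘ g)   ≡⟨ unfold ⟩
    (F₁ + (F₀ + 0)) * 2 ^ (ind (g zero) + G)                          ≡⟨ cong (λ z → (F₁ + (F₀ + 0)) * 2 ^ (ind z + G)) g₀ ⟩
    (F₁ + (F₀ + 0)) * 2 ^ G                                           ≡⟨ distribute F₁ F₀ (2 ^ G) ⟩
    F₁ * 2 ^ G + (F₀ * 2 ^ G + 0)                                     ≤⟨ +-mono-≤ le₁ (+-monoˡ-≤ 0 le₀) ⟩
    2 ^ suc d                                                         ∎)

Asymmetric : ∀ {n} → Digraph n → Set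
Asymmetric D = ∀ {u v} → D u v ≡ true → D v u ≢ true

-- What the cycle constructions retain of a shattered set: every pattern of directions towards `P`
-- is realised by some `Q a`, with all these arcs present in `D`.
record Hub {n} (D : Digraph n) (d : ℕ) : Set where
  field
    asym : Asymmetric D
    P    : Fin d → Fin n
    Q    : Vec Bool d → Fin n
    PQ   : ∀ a i → lookup a i ≡ true → D (P i) (Q a) ≡ true
    QP   : ∀ a i → lookup a i ≡ false → D (Q a) (P i) ≡ true

  single : Fin d → Vec Bool d
  single i = Vec.replicate d false [ i ]≔ true

  single-≡ : ∀ i → lookup (single i) i ≡ true
  single-≡ i = Vec.lookup∘updateAt i (Vec.replicate d false)

  single-≢ : ∀ {i j} → j ≢ i → lookup (single i) j ≡ false
  single-≢ {i} {j} j≢i = trans (Vec.lookup∘updateAt′ j i j≢i (Vec.replicate d false)) (Vec.lookup-replicate j false)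

  Y : Fin d → Fin n
  Y i = Q (single i)

  arc-irrefl : ∀ {u v} → D u v ≡ true → u ≢ v
  arc-irrefl uv refl = asym uv uv

  P≢Q : ∀ i a → P i ≢ Q a
  P≢Q i a with lookup a i in eq
  ... | true  = arc-irrefl (PQ a i eq)
  ... | false = arc-irrefl (QP a i eq) ∘ sym

  Y→P : ∀ {i j} → j ≢ i → D (Y i) (P j) ≡ true
  Y→P {i} {j} j≢i = QP (single i) j (single-≢ j≢i)

  P→Y : ∀ i → D (P i) (Y i) ≡ true
  P→Y i = PQ (single i) i (single-≡ i)

  P-injective : ∀ {i j} → P i ≡ P j → i ≡ j
  P-injective {i} {j} eq with j Fin.≟ i
  ... | yes p = sym p
  ... | no ¬p = contradiction (subst (λ p → D (Y i) p ≡ true) (sym eq) (Y→P ¬p)) (asym (P→Y i))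

  Q-lookup : ∀ {a a′} → Q a ≡ Q a′ → ∀ i → lookup a i ≡ lookup a′ i
  Q-lookup {a} {a′} eq i with lookup a i in e | lookup a′ i in e′
  ... | true  | true  = refl
  ... | false | false = refl
  ... | true  | false = contradiction (QP a′ i e′) (asym (subst (λ q → D (P i) q ≡ true) eq (PQ a i e)))
  ... | false | true  = contradiction (PQ a′ i e′) (asym (subst (λ q → D q (P i) ≡ true) eq (QP a i e)))

  Y-injective : ∀ {i j} → Y i ≡ Y j → i ≡ j
  Y-injective {i} {j} eq with i Fin.≟ j
  ... | yes p = p
  ... | no ¬p = case trans (sym (single-≡ i)) (trans (Q-lookup eq i) (single-≢ ¬p)) of λ ()

  -- `P i` sends an arc to `Y i`, and `Y i` sends arcs to all other `P j`; so distinct indices in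
  -- any order give a directed path.
  zig : List (Fin d) → List (Fin n)
  zig []       = []
  zig (i ∷ is) = P i ∷ Y i ∷ zig is

  zig-∈ : ∀ {z} is → z ∈ zig is → ∃ λ i → i ∈ is × (z ≡ P i ⊎ z ≡ Y i)
  zig-∈ (i ∷ is) (here eq)         = i , here refl , inj₁ eq
  zig-∈ (i ∷ is) (there (here eq)) = i , here refl , inj₂ eq
  zig-∈ (i ∷ is) (there (there p)) = Prod.map₂ (Prod.map₁ there) (zig-∈ is p)

  unique-zig : ∀ {is} → Unique is → Unique (zig is)
  unique-zig []       = []
  unique-zig {i ∷ is} (i∉ ∷ u) = (P≢Q i (single i) ∷ All.tabulate P∉) ∷ (All.tabulate Y∉ ∷ unique-zig u)
    where
    P∉ : ∀ {z} → z ∈ zig is → P i ≢ z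
    P∉ z∈ eq with zig-∈ is z∈
    ... | j , j∈ , inj₁ e = All.lookup i∉ j∈ (P-injective (trans eq e))
    ... | j , j∈ , inj₂ e = P≢Q i (single j) (trans eq e)
    Y∉ : ∀ {z} → z ∈ zig is → Y i ≢ z
    Y∉ z∈ eq with zig-∈ is z∈
    ... | j , j∈ , inj₁ e = P≢Q j (single i) (sym (trans eq e))
    ... | j , j∈ , inj₂ e = All.lookup i∉ j∈ (Y-injective (trans eq e))

  length-zig : ∀ is → length (zig is) ≡ 2 * length is
  length-zig []       = refl
  length-zig (i ∷ is) = trans (cong (2 +_) (length-zig is)) (double (length is))
    where
    double : ∀ l → 2 + 2 * l ≡ 2 * suc l
    double = solve-∀

  -- It is the last `Y` that has to reach `y`. The side condition exempts the first index when there
  -- are several, which allows `y` to be `P i` itself and so closes an even cycle.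
  zig-walk : ∀ i is y → Unique (i ∷ is) → (∀ l → l ∈ i ∷ is → (l ≡ i → is ≡ []) → D (Y l) y ≡ true) →
             AllArcs D (walk (P i) (Y i ∷ zig is) y)
  zig-walk i []       y u final = P→Y i ∷ final i (here refl) (λ _ → refl) ∷ []
  zig-walk i (j ∷ is) y ((i≢j ∷ i∉) ∷ u) final = P→Y i ∷ Y→P (i≢j ∘ sym) ∷ zig-walk j is y u
    (λ { l (here refl) _ → final l (there (here refl)) (λ l≡i → contradiction (sym l≡i) i≢j)
       ; l (there l∈) _ → final l (there (there l∈)) (λ l≡i → contradiction (sym l≡i) (All.lookup i∉ l∈)) })

  evenCycle : ∀ j → suc (suc j) ≤ d → HasCycle D (2 * suc (suc j))
  evenCycle j j≤d = build (take (2 + j) (allFin d)) (Unique.take⁺ (2 + j) (Unique.allFin⁺ d))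
    (trans (length-take (2 + j) (allFin d)) (m≤n⇒m⊓n≡m (≤-trans j≤d (≤-reflexive (sym (length-tabulate {n = d} id))))))
    where
    build : ∀ is → Unique is → length is ≡ 2 + j → HasCycle D (2 * suc (suc j))
    build (i ∷ i′ ∷ is) u len = zig (i ∷ i′ ∷ is) , trans (length-zig (i ∷ i′ ∷ is)) (cong (2 *_) len) , unique-zig u
      , zig-walk i (i′ ∷ is) (P i) u (λ l _ l≢ → Y→P (λ i≡l → case l≢ (sym i≡l) of λ ()))

  -- The route is `w`, the zigzag, `P l`, `Q a` and back. `Q a` is none of the `Y j` on the zigzag,
  -- since `a` is true at `l` while the patterns of these `Y j` are false there.
  oddCycle : ∀ w l is a → Unique (l ∷ is) → (∀ {j} → j ∈ l ∷ is → D w (P j) ≡ true) → (∀ i → w ≢ Y i) →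
             lookup a l ≡ true → D (Q a) w ≡ true → HasCycle D (2 * length is + 3)
  oddCycle w l is a u@(l∉ ∷ uis) wP w≢Y al qw = w ∷ tl , len , All.tabulate w∉ ∷ unique-tl , arcs is uis wP l∉
    where
    tl : List (Fin n)
    tl = zig is ++ P l ∷ Q a ∷ []
    len : length (w ∷ tl) ≡ 2 * length is + 3
    len = trans (cong suc (trans (length-++ (zig is)) (cong (_+ 2) (length-zig is)))) (sym (+-suc (2 * length is) 2))
    w∉ : ∀ {z} → z ∈ tl → w ≢ z
    w∉ z∈ refl with ∈-++⁻ (zig is) z∈
    ... | inj₂ (here eq)         = arc-irrefl (wP (here refl)) eq
    ... | inj₂ (there (here eq)) = arc-irrefl qw (sym eq)
    ... | inj₁ p with zig-∈ is p
    ...   | j , j∈ , inj₁ e = arc-irrefl (wP (there j∈)) e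
    ...   | j , j∈ , inj₂ e = w≢Y j e
    unique-tl : Unique tl
    unique-tl = Unique.++⁺ (unique-zig uis) ((P≢Q l a ∷ []) ∷ [] ∷ []) disjoint
      where
      disjoint : Disjoint (zig is) (P l ∷ Q a ∷ [])
      disjoint (p , q) with zig-∈ is p | q
      ... | j , j∈ , inj₁ e | here e′         = All.lookup l∉ j∈ (P-injective (trans (sym e′) e))
      ... | j , j∈ , inj₁ e | there (here e′) = P≢Q j a (trans (sym e) e′)
      ... | j , j∈ , inj₂ e | here e′         = P≢Q l (single j) (trans (sym e′) e)
      ... | j , j∈ , inj₂ e | there (here e′) =
        case trans (sym al) (trans (Q-lookup (trans (sym e′) e) l) (single-≢ (All.lookup l∉ j∈))) of λ ()
    arcs : ∀ is → Unique is → (∀ {j} → j ∈ l ∷ is → D w (P j) ≡ true) → All (l ≢_) is →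
           AllArcs D (walk w (zig is ++ P l ∷ Q a ∷ []) w)
    arcs []       _ wP l∉ = wP (here refl) ∷ PQ a l al ∷ qw ∷ []
    arcs (i ∷ is) u wP l∉ = wP (there (here refl)) ∷ subst (AllArcs D) (sym (walk-++ (P i) (Y i ∷ zig is) (P l) (Q a ∷ []) w))
      (All.++⁺ (zig-walk i is (P l) u (λ j j∈ _ → Y→P (All.lookup l∉ j∈))) (PQ a l al ∷ qw ∷ []))

  outP : Fin n → ℕ
  outP w = ∑ (allFin d) (λ i → ind (D w (P i)))

  inQ : Fin n → ℕ
  inQ w = ∑ (bitVecs d) (λ a → ind (D (Q a) w))

  outP-large : ∀ e w → 16 * (e * e) ≤ d → d < 4 * e * outP w → 4 * e < outP w
  outP-large e w e²≤d bigP = *-cancelˡ-< (4 * e) _ _ (≤-<-trans (≤-trans (≤-reflexive (sixteen e)) e²≤d) bigP)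
    where
    sixteen : ∀ e → 4 * e * (4 * e) ≡ 16 * (e * e)
    sixteen = solve-∀

  -- As `w` has more than `4 * e` out-neighbours in `P`, the vectors that are false at all of them
  -- make up less than 1/(4e) of the cube. So some in-neighbour `Q a` of `w` has a vector that is
  -- true at some out-neighbour `P l`; the other indices are taken from the remaining
  -- out-neighbours.
  oddHub : ∀ e j w → 2 * j + 3 ≤ e → 16 * (e * e) ≤ d → 4 * e * outP w ≤ (2 * e + 1) * d →
           d < 4 * e * outP w → 2 ^ d < 4 * e * inQ w → HasCycle D (2 * j + 3)
  oddHub e j w j≤e e²≤d balanced bigP bigQ with cube-meet d (λ a → D (Q a) w) (λ i → D w (P i))
  ... | inj₂ le = contradiction (begin-strict
      2 ^ d                          <⟨ bigQ ⟩
      4 * e * inQ w                  ≡⟨ *-comm (4 * e) (inQ w) ⟩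
      inQ w * (4 * e)                ≤⟨ *-monoʳ-≤ (inQ w) (≤-trans (<⇒≤ (outP-large e w e²≤d bigP)) (<⇒≤ (n<2^n (outP w)))) ⟩
      inQ w * 2 ^ outP w             ≤⟨ le ⟩
      2 ^ d                          ∎) (<-irrefl refl)
    where
    open ≤-Reasoning
  ... | inj₁ (l , a , wl , qw , al) with ∈-∃++ (∈-filter⁺ (λ i → D w (P i) Bool.≟ true) (∈-allFin l) wl)
  ...   | ys , zs , eq = subst (λ x → HasCycle D (2 * x + 3)) len-is
          (oddCycle w l is a (l∉ ∷ uis) wP w≢Y al qw)
    where
    open ≤-Reasoning
    P₂ : List (Fin d)
    P₂ = filter (λ i → D w (P i) Bool.≟ true) (allFin d)
    shuffled : P₂ ↭ l ∷ ys ++ zs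
    shuffled = ↭-trans (↭-reflexive eq) (Perm.shift l ys zs)
    unique₂ : Unique (l ∷ ys ++ zs)
    unique₂ = Unique-resp-↭ shuffled (Unique.filter⁺ (λ i → D w (P i) Bool.≟ true) (Unique.allFin⁺ d))
    is : List (Fin d)
    is = take j (ys ++ zs)
    take-∈ : ∀ {A : Set} m {xs : List A} {x} → x ∈ take m xs → x ∈ xs
    take-∈ (suc m) {_ ∷ _} (here e)  = here e
    take-∈ (suc m) {_ ∷ _} (there p) = there (take-∈ m p)
    l∉ : All (l ≢_) is
    l∉ with unique₂
    ... | p ∷ _ = All.take⁺ j p
    uis : Unique is
    uis with unique₂
    ... | _ ∷ p = Unique.take⁺ j p
    wP : ∀ {i} → i ∈ l ∷ is → D w (P i) ≡ true
    wP {i} i∈ = proj₂ (∈-filter⁻ (λ i → D w (P i) Bool.≟ true) {xs = allFin d} (Perm.∈-resp-↭ (↭-sym shuffled) (sub i∈)))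
      where
      sub : i ∈ l ∷ is → i ∈ l ∷ ys ++ zs
      sub (here p)  = here p
      sub (there p) = there (take-∈ j p)
    length-P₂ : length P₂ ≡ outP w
    length-P₂ = trans (∑-ind-filter (λ i → D w (P i) Bool.≟ true) (allFin d)) (∑-cong (allFin d) (λ i → ind-≟ (D w (P i))))
      where
      ind-≟ : ∀ x → ind (does (x Bool.≟ true)) ≡ ind x
      ind-≟ true  = refl
      ind-≟ false = refl
    j≤ : j ≤ length (ys ++ zs)
    j≤ = s≤s⁻¹ (begin
      suc j                   ≤⟨ s≤s (≤-trans (m≤n*m j 2) (m≤m+n (2 * j) 2)) ⟩
      suc (2 * j + 2)         ≡⟨ +-suc (2 * j) 2 ⟨
      2 * j + 3               ≤⟨ j≤e ⟩
      e                       ≤⟨ m≤n*m e 4 ⟩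
      4 * e                   ≤⟨ <⇒≤ (outP-large e w e²≤d bigP) ⟩
      outP w                  ≡⟨ trans (sym length-P₂) (Perm.↭-length shuffled) ⟩
      suc (length (ys ++ zs)) ∎)
    len-is : length is ≡ j
    len-is = trans (length-take j (ys ++ zs)) (m≤n⇒m⊓n≡m j≤)
    w≢Y : ∀ i → w ≢ Y i
    -- `Y i` sends arcs to all of `P` except one vertex, which contradicts `balanced`.
    w≢Y i refl = <-irrefl refl (begin-strict
      4 * e * d + 4 * e                   ≡⟨ expand e d ⟩
      4 * e * suc d                       ≤⟨ *-monoʳ-≤ (4 * e) (s≤s d≤) ⟩
      4 * e * suc (outP w + 1)            ≡⟨ expand′ e (outP w) ⟩
      4 * e * outP w + 8 * e              ≤⟨ +-monoˡ-≤ (8 * e) balanced ⟩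
      (2 * e + 1) * d + 8 * e             ≡⟨ split e d ⟩
      2 * e * d + (d + 4 * e) + 4 * e     <⟨ +-monoˡ-< (4 * e) (+-monoʳ-< (2 * e * d) small) ⟩
      2 * e * d + 2 * e * d + 4 * e       ≡⟨ join e d ⟩
      4 * e * d + 4 * e                   ∎)
      where
      expand : ∀ e d → 4 * e * d + 4 * e ≡ 4 * e * suc d
      expand = solve-∀
      expand′ : ∀ e x → 4 * e * suc (x + 1) ≡ 4 * e * x + 8 * e
      expand′ = solve-∀
      split : ∀ e d → (2 * e + 1) * d + 8 * e ≡ 2 * e * d + (d + 4 * e) + 4 * e
      split = solve-∀
      join : ∀ e d → 2 * e * d + 2 * e * d + 4 * e ≡ 4 * e * d + 4 * e
      join = solve-∀
      3≤e : 3 ≤ e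
      3≤e = ≤-trans (m≤n+m 3 (2 * j)) j≤e
      small : d + 4 * e < 2 * e * d
      small = begin-strict
        d + 4 * e                        <⟨ +-monoʳ-< d (*-monoˡ-< e {{>-nonZero (≤-trans (s≤s z≤n) 3≤e)}} {4} {16} (s≤s (s≤s (s≤s (s≤s (s≤s z≤n)))))) ⟩
        d + 16 * e                       ≤⟨ +-monoʳ-≤ d (*-monoʳ-≤ 16 (m≤m*n e e {{>-nonZero (≤-trans (s≤s z≤n) 3≤e)}})) ⟩
        d + 16 * (e * e)                 ≤⟨ +-monoʳ-≤ d e²≤d ⟩
        d + d                            ≡⟨ cong (d +_) (+-identityʳ d) ⟨
        2 * d                            ≤⟨ *-monoˡ-≤ d (*-monoʳ-≤ 2 (≤-trans (s≤s z≤n) 3≤e)) ⟩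
        2 * e * d                        ∎
      d≤ : d ≤ outP w + 1
      d≤ = begin
        d                                                        ≡⟨ length-tabulate {n = d} id ⟨
        length (allFin d)                                        ≡⟨ length≡∑1 (allFin d) ⟩
        ∑ (allFin d) (λ _ → 1)                                   ≤⟨ ∑-mono (allFin d) each ⟩
        ∑ (allFin d) (λ i′ → ind (D w (P i′)) + δ i′ i)          ≡⟨ ∑-+ (allFin d) _ _ ⟩
        outP w + ∑ (allFin d) (λ i′ → δ i′ i)                    ≡⟨ cong (outP w +_) (count-∈ Fin._≟_ (Unique.allFin⁺ d) (∈-allFin i)) ⟩
        outP w + 1                                               ∎
        where
        each : ∀ i′ → 1 ≤ ind (D w (P i′)) + δ i′ i
        each i′ with i′ Fin.≟ i
        ... | yes _ = m≤n+m 1 _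
        ... | no ne rewrite Y→P ne = ≤-refl

-- Reversing all arcs complements every pattern, so `Q` is relabelled by complements.
converseHub : ∀ {n} {D : Digraph n} {d} → Hub D d → Hub (converse D) d
converseHub hub = record
  { asym = λ uv vu → asym vu uv
  ; P    = P
  ; Q    = λ a → Q (Vec.map not a)
  ; PQ   = λ a i eq → QP (Vec.map not a) i (trans (Vec.lookup-map i not a) (cong not eq))
  ; QP   = λ a i eq → PQ (Vec.map not a) i (trans (Vec.lookup-map i not a) (cong not eq))
  }
  where open Hub hub

∑-complement : ∀ d (F : Vec Bool d → ℕ) → ∑ (bitVecs d) (λ a → F (Vec.map not a)) ≡ ∑ (bitVecs d) F
∑-complement zero    F = refl
∑-complement (suc d) F = begin
  ∑ (bitVecs (suc d)) (λ a → F (Vec.map not a))      ≡⟨ ∑-tuples-suc bools d _ ⟩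
  ∑ bools (λ z → ∑ (bitVecs d) (λ a → F (not z ∷ Vec.map not a)))   ≡⟨ ∑-cong bools (λ z → ∑-complement d (λ a → F (not z ∷ a))) ⟩
  ∑ bools (λ z → ∑ (bitVecs d) (λ a → F (not z ∷ a)))   ≡⟨ ∑-bools-xor true (λ z → ∑ (bitVecs d) (λ a → F (z ∷ a))) ⟩
  ∑ bools (λ z → ∑ (bitVecs d) (λ a → F (z ∷ a)))       ≡⟨ ∑-tuples-suc bools d F ⟨
  ∑ (bitVecs (suc d)) F                              ∎
  where open ≡-Reasoning

even-or-odd : ∀ k → 3 ≤ k → (∃ λ j → k ≡ 2 * suc (suc j)) ⊎ (∃ λ j → k ≡ 2 * j + 3)
even-or-odd 1 (s≤s ())
even-or-odd 2 (s≤s (s≤s ()))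
even-or-odd (suc (suc (suc zero)))       _ = inj₂ (0 , refl)
even-or-odd (suc (suc (suc (suc zero)))) _ = inj₁ (0 , refl)
even-or-odd (suc (suc k@(suc (suc (suc _))))) _ with even-or-odd k (s≤s (s≤s (s≤s z≤n)))
... | inj₁ (j , eq) = inj₁ (suc j , trans (cong (2 +_) eq) (step j))
  where
  step : ∀ j → 2 + 2 * suc (suc j) ≡ 2 * suc (suc (suc j))
  step = solve-∀
... | inj₂ (j , eq) = inj₂ (suc j , trans (cong (2 +_) eq) (step j))
  where
  step : ∀ j → 2 + (2 * j + 3) ≡ 2 * suc j + 3
  step = solve-∀

-- Among the four degrees of w towards and from P and Q, either a complementary pair is large,
-- which closes a cycle, or two of them are negligible and the other two are at most about half.
hub-dichotomy : ∀ {n} {D : Digraph n} {d} (hub : Hub D d) e k w → 3 ≤ k → k ≤ e → 16 * (e * e) ≤ d →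
  let open Hub hub
      outP = ∑ (allFin d) (λ i → ind (D w (P i)))
      inP  = ∑ (allFin d) (λ i → ind (D (P i) w))
      outQ = ∑ (bitVecs d) (λ a → ind (D w (Q a)))
      inQ  = ∑ (bitVecs d) (λ a → ind (D (Q a) w))
  in 4 * e * outP ≤ (2 * e + 1) * d → 4 * e * inP ≤ (2 * e + 1) * d →
     4 * e * outQ ≤ (2 * e + 1) * 2 ^ d → 4 * e * inQ ≤ (2 * e + 1) * 2 ^ d →
     HasCycle D k ⊎ e * (2 ^ d * (outP + inP) + d * (outQ + inQ)) ≤ d * 2 ^ d * (e + 1)
hub-dichotomy {D = D} {d} hub e k w 3≤k k≤e e²≤d bOP bIP bOQ bIQ with even-or-odd k 3≤k
... | inj₁ (j , refl) = inj₁ (Hub.evenCycle hub j (≤-trans (m≤n*m (2 + j) 2) (≤-trans k≤e (≤-trans (m≤m*n e e {{>-nonZero (≤-trans (s≤s z≤n) (≤-trans 3≤k k≤e))}}) (≤-trans (m≤n*m (e * e) 16) e²≤d)))))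
... | inj₂ (j , refl) = decide (d <? 4 * e * op) (2 ^ d <? 4 * e * iq) (d <? 4 * e * ip) (2 ^ d <? 4 * e * oq)
  where
  open Hub hub
  q = 2 ^ d
  op = ∑ (allFin d) (λ i → ind (D w (P i)))
  ip = ∑ (allFin d) (λ i → ind (D (P i) w))
  oq = ∑ (bitVecs d) (λ a → ind (D w (Q a)))
  iq = ∑ (bitVecs d) (λ a → ind (D (Q a) w))
  Goal = HasCycle D (2 * j + 3) ⊎ e * (q * (op + ip) + d * (oq + iq)) ≤ d * q * (e + 1)
  -- `A` to `D′` are densities in units of 1/(4e). In each surviving case two of them are 1 and two
  -- are `2 * e + 1`, so that the sum amounts to a joint density of 1 + 1/e out of 2.
  combine : ∀ A B C D′ → 4 * e * op ≤ A * d → 4 * e * ip ≤ B * d → 4 * e * oq ≤ C * q → 4 * e * iq ≤ D′ * q →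
            A + B + C + D′ ≡ 4 * e + 4 → Goal
  combine A B C D′ a b c d′ sum = inj₂ (*-cancelˡ-≤ 4 (begin
    4 * (e * (q * (op + ip) + d * (oq + iq)))                                     ≡⟨ spread e q d op ip oq iq ⟩
    q * (4 * e * op) + q * (4 * e * ip) + d * (4 * e * oq) + d * (4 * e * iq)     ≤⟨ +-mono-≤ (+-mono-≤ (+-mono-≤ (*-monoʳ-≤ q a) (*-monoʳ-≤ q b)) (*-monoʳ-≤ d c)) (*-monoʳ-≤ d d′) ⟩
    q * (A * d) + q * (B * d) + d * (C * q) + d * (D′ * q)                        ≡⟨ collect q d A B C D′ ⟩
    d * q * (A + B + C + D′)                                                      ≡⟨ cong (d * q *_) sum ⟩
    d * q * (4 * e + 4)                                                           ≡⟨ factor (d * q) e ⟩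
    4 * (d * q * (e + 1))                                                         ∎))
    where
    open ≤-Reasoning
    spread : ∀ e q d a b c f → 4 * (e * (q * (a + b) + d * (c + f))) ≡ q * (4 * e * a) + q * (4 * e * b) + d * (4 * e * c) + d * (4 * e * f)
    spread = solve-∀
    collect : ∀ q d A B C F → q * (A * d) + q * (B * d) + d * (C * q) + d * (F * q) ≡ d * q * (A + B + C + F)
    collect = solve-∀
    factor : ∀ x e → x * (4 * e + 4) ≡ 4 * (x * (e + 1))
    factor = solve-∀
  small : ∀ {x y} → ¬ (x < y) → y ≤ 1 * x
  small {x} ¬p = ≤-trans (≮⇒≥ ¬p) (≤-reflexive (sym (*-identityˡ x)))
  s₁ : ∀ e → 1 + 1 + (2 * e + 1) + (2 * e + 1) ≡ 4 * e + 4
  s₁ = solve-∀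
  s₂ : ∀ e → 1 + (2 * e + 1) + 1 + (2 * e + 1) ≡ 4 * e + 4
  s₂ = solve-∀
  s₃ : ∀ e → (2 * e + 1) + 1 + (2 * e + 1) + 1 ≡ 4 * e + 4
  s₃ = solve-∀
  s₄ : ∀ e → (2 * e + 1) + (2 * e + 1) + 1 + 1 ≡ 4 * e + 4
  s₄ = solve-∀
  decide : Dec (d < 4 * e * op) → Dec (q < 4 * e * iq) → Dec (d < 4 * e * ip) → Dec (q < 4 * e * oq) → Goal
  decide (yes p) (yes r) _ _ = inj₁ (Hub.oddHub hub e j w k≤e e²≤d bOP p r)
  decide _ _ (yes p) (yes r) = inj₁ (hasCycle-converse (Hub.oddHub (converseHub hub) e j w k≤e e²≤d bIP p
    (subst (λ x → q < 4 * e * x) (sym (∑-complement d (λ a → ind (D w (Q a))))) r)))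
  decide (no ¬p) _ (no ¬r) _ = combine 1 1 (2 * e + 1) (2 * e + 1) (small ¬p) (small ¬r) bOQ bIQ (s₁ e)
  decide (no ¬p) _ _ (no ¬r) = combine 1 (2 * e + 1) 1 (2 * e + 1) (small ¬p) bIP (small ¬r) bIQ (s₂ e)
  decide _ (no ¬p) (no ¬r) _ = combine (2 * e + 1) 1 (2 * e + 1) 1 bOP (small ¬r) bOQ (small ¬p) (s₃ e)
  decide _ (no ¬p) _ (no ¬r) = combine (2 * e + 1) (2 * e + 1) 1 1 bOP bIP (small ¬r) (small ¬p) (s₄ e)

-- Dense subdigraphs of a tournament with few bad tuples contain the directed k-cycle

ones≡∑ : ∀ {q} (a : Vec Bool q) → ones a ≡ ∑ (Vec.toList a) ind
ones≡∑ []      = refl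
ones≡∑ (z ∷ a) = cong (ind z +_) (ones≡∑ a)

zeros≡∑ : ∀ {q} (a : Vec Bool q) → zeros a ≡ ∑ (Vec.toList a) (ind ∘ not)
zeros≡∑ []      = refl
zeros≡∑ (z ∷ a) = cong (ind (not z) +_) (zeros≡∑ a)

ones+zeros : ∀ {q} (a : Vec Bool q) → ones a + zeros a ≡ q
ones+zeros []          = refl
ones+zeros (true  ∷ a) = cong suc (ones+zeros a)
ones+zeros (false ∷ a) = trans (+-suc (ones a) (zeros a)) (cong suc (ones+zeros a))

-- From x + y = q and a bias of at most q/(2e), each part is at most (1/2 + 1/(4e))q. The tolerance
-- `2 * e` keeps this excess well below the excess 1/e of the degrees.
balanced-bounds : ∀ e {q} (a : Vec Bool q) → unbalanced (2 * e) a ≡ false →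
                  4 * e * ones a ≤ (2 * e + 1) * q × 4 * e * zeros a ≤ (2 * e + 1) * q
balanced-bounds e {q} a eq =
    half (ones a) (zeros a) (ones+zeros a) (≮⇒≥ not-skew)
  , half (zeros a) (ones a) (trans (+-comm (zeros a) (ones a)) (ones+zeros a))
      (subst (λ x → 2 * e * x ≤ q) (∣-∣-comm (ones a) (zeros a)) (≮⇒≥ not-skew))
  where
  not-skew : ¬ (q < 2 * e * bias a)
  not-skew lt = case trans (sym eq) (dec-true (q <? 2 * e * bias a) lt) of λ ()
  ≤-dist : ∀ x y → x ≤ y + ∣ x - y ∣
  ≤-dist zero    y       = z≤n
  ≤-dist (suc x) zero    = ≤-refl
  ≤-dist (suc x) (suc y) = s≤s (≤-dist x y)
  half : ∀ x y → x + y ≡ q → 2 * e * ∣ x - y ∣ ≤ q → 4 * e * x ≤ (2 * e + 1) * q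
  half x y refl le = begin
    4 * e * x                                   ≡⟨ halves e x ⟩
    2 * e * x + 2 * e * x                       ≤⟨ +-monoʳ-≤ (2 * e * x) (*-monoʳ-≤ (2 * e) (≤-dist x y)) ⟩
    2 * e * x + 2 * e * (y + ∣ x - y ∣)         ≡⟨ collect e x y ∣ x - y ∣ ⟩
    2 * e * (x + y) + 2 * e * ∣ x - y ∣         ≤⟨ +-monoʳ-≤ (2 * e * (x + y)) le ⟩
    2 * e * (x + y) + (x + y)                   ≡⟨ factor e (x + y) ⟩
    (2 * e + 1) * (x + y)                       ∎
    where
    open ≤-Reasoning
    halves : ∀ e x → 4 * e * x ≡ 2 * e * x + 2 * e * x
    halves = solve-∀
    collect : ∀ e x y z → 2 * e * x + 2 * e * (y + z) ≡ 2 * e * (x + y) + 2 * e * z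
    collect = solve-∀
    factor : ∀ e x → 2 * e * x + x ≡ (2 * e + 1) * x
    factor = solve-∀

lookup-tuples : {xs : List A} → ∀ {s v} → v ∈ tuples xs s → ∀ i → lookup v i ∈ xs
lookup-tuples {xs = xs} {suc s} v∈ i with ∈-concatMap⁻ (λ x → map (x ∷_) (tuples xs s)) xs v∈
... | x , x∈ , p with ∈-map⁻ (x ∷_) p
lookup-tuples v∈ zero    | x , x∈ , p | _ , q , refl = x∈
lookup-tuples v∈ (suc i) | x , x∈ , p | _ , q , refl = lookup-tuples q i

∏≢0 : ∀ {s} (v : Vec A s) (f : A → ℕ) → ∏ v f ≢ 0 → ∀ i → f (lookup v i) ≢ 0
∏≢0 (x ∷ v) f ne zero    eq = ne (cong (_* ∏ v f) eq)
∏≢0 (x ∷ v) f ne (suc i) eq = ∏≢0 v f (λ e → ne (trans (cong (f x *_) e) (*-zeroʳ (f x)))) i eq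

-- Inclusion of multisets, tested against all functions with natural values; in this form it passes
-- directly to tuples and to counts of bad tuples.
_≼_ : List A → List A → Set
xs ≼ ys = ∀ F → ∑ xs F ≤ ∑ ys F

tuples-≼ : {xs ys : List A} → xs ≼ ys → ∀ s → tuples xs s ≼ tuples ys s
tuples-≼ {xs = xs} {ys} le zero    F = ≤-refl
tuples-≼ {xs = xs} {ys} le (suc s) F = begin
  ∑ (tuples xs (suc s)) F                                ≡⟨ ∑-tuples-suc xs s F ⟩
  ∑ xs (λ x → ∑ (tuples xs s) (λ v → F (x ∷ v)))         ≤⟨ ∑-mono xs (λ x → tuples-≼ le s (λ v → F (x ∷ v))) ⟩
  ∑ xs (λ x → ∑ (tuples ys s) (λ v → F (x ∷ v)))         ≤⟨ le _ ⟩
  ∑ ys (λ x → ∑ (tuples ys s) (λ v → F (x ∷ v)))         ≡⟨ ∑-tuples-suc ys s F ⟨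
  ∑ (tuples ys (suc s)) F                                ∎
  where open ≤-Reasoning

module Density {n} (T D : Digraph n) (tournament : IsTournament T) (sub : ∀ u v → D u v ≡ true → T u v ≡ true) where

  private
    V = vertices n

  T-asym : ∀ {u v} → T u v ≡ true → T v u ≡ false
  T-asym {u} {v} uv with u Fin.≟ v
  ... | yes refl = proj₁ tournament u
  ... | no u≢v = Bool.not-injective (trans (sym (proj₂ tournament u v u≢v)) uv)

  D-asym : Asymmetric D
  D-asym {u} {v} uv vu = case trans (sym (T-asym (sub u v uv))) (sub v u vu) of λ ()

  adj : Fin n → Fin n → ℕ
  adj u v = ind (D u v) + ind (D v u)

  adj-sym : ∀ u v → adj u v ≡ adj v u
  adj-sym u v = +-comm (ind (D u v)) _

  adj≤1 : ∀ u v → adj u v ≤ 1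
  adj≤1 u v with D u v in uv | D v u in vu
  ... | true  | true  = contradiction vu (D-asym uv)
  ... | true  | false = ≤-refl
  ... | false | true  = ≤-refl
  ... | false | false = z≤n

  adj-T : ∀ {u v} → adj u v ≢ 0 → ∀ {z} → T u v ≡ z → (z ≡ true → D u v ≡ true) × (z ≡ false → D v u ≡ true)
  adj-T {u} {v} ne {z} eq with D u v in uv | D v u in vu
  ... | true  | _     = (λ _ → refl) , λ { refl → case trans (sym eq) (sub u v uv) of λ () }
  ... | false | true  = (λ { refl → case trans (sym (T-asym (sub v u vu))) eq of λ () }) , λ _ → refl
  ... | false | false = contradiction refl ne

  complete : ∀ {s t} → Vec (Fin n) s → Vec (Fin n) t → ℕ
  complete x v = ∏ v (λ y → ∏ x (λ z → adj z y))

  module _ {s t d} {x : Vec (Fin n) s} {v : Vec (Fin n) t} (full : complete x v ≢ 0) (sh : Shatter d (mat T x v)) where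
    private module Sh = Shatter sh

    pattern-at : ∀ a i → T (lookup x (lookup Sh.P i)) (lookup v (Sh.Q a)) ≡ lookup a i
    pattern-at a i = trans (sym (trans (cong (λ r → lookup r (lookup Sh.P i)) (Vec.lookup-map (Sh.Q a) (row T x) v))
      (Vec.lookup-map (lookup Sh.P i) _ x))) (Sh.realise-lookup a i)

    -- The pattern is that of `T`. Completeness says that each of these pairs is still joined in
    -- `D`, necessarily by the arc of `T`.
    toHub : Hub D d
    toHub = record
      { asym = D-asym
      ; P    = λ i → lookup x (lookup Sh.P i)
      ; Q    = λ a → lookup v (Sh.Q a)
      ; PQ   = λ a i eq → proj₁ (adj-T (joined a i) (pattern-at a i)) eq
      ; QP   = λ a i eq → proj₂ (adj-T (joined a i) (pattern-at a i)) eq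
      }
      where
      joined : ∀ a i → adj (lookup x (lookup Sh.P i)) (lookup v (Sh.Q a)) ≢ 0
      joined a i = ∏≢0 x _ (∏≢0 v _ full (Sh.Q a)) (lookup Sh.P i)

    open Hub toHub using (P; Q)

    private
      side-bounds : ∀ e w {q} {I : Set} (is : List I) (F : I → Fin n) (r : Vec Bool q) →
        Vec.toList r ≡ map (λ i → T (F i) w) is → unbalanced (2 * e) r ≡ false →
        4 * e * ∑ is (λ i → ind (D w (F i))) ≤ (2 * e + 1) * q × 4 * e * ∑ is (λ i → ind (D (F i) w)) ≤ (2 * e + 1) * q
      side-bounds e w is F r eq bal = ≤-trans (*-monoʳ-≤ (4 * e) out≤) (proj₂ bounds) , ≤-trans (*-monoʳ-≤ (4 * e) in≤) (proj₁ bounds)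
        where
        bounds = balanced-bounds e r bal
        in≤ : ∑ is (λ i → ind (D (F i) w)) ≤ ones r
        in≤ = ≤-trans (∑-mono is (λ i → mono (F i))) (≤-reflexive (sym (trans (ones≡∑ r) (trans (cong (λ l → ∑ l ind) eq) (∑-map _ is ind)))))
          where
          mono : ∀ u → ind (D u w) ≤ ind (T u w)
          mono u with D u w in uw
          ... | false = z≤n
          ... | true rewrite sub u w uw = ≤-refl
        out≤ : ∑ is (λ i → ind (D w (F i))) ≤ zeros r
        out≤ = ≤-trans (∑-mono is (λ i → mono (F i))) (≤-reflexive (sym (trans (zeros≡∑ r) (trans (cong (λ l → ∑ l (ind ∘ not)) eq) (∑-map _ is (ind ∘ not))))))
          where
          mono : ∀ u → ind (D w u) ≤ ind (not (T u w))
          mono u with D w u in wu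
          ... | false = z≤n
          ... | true rewrite T-asym (sub w u wu) = ≤-refl

      row-at : ∀ w i → lookup (row T (x Vec.++ v) w) i ≡ T (lookup (x Vec.++ v) i) w
      row-at w i = Vec.lookup-map i _ (x Vec.++ v)

      rows-list : ∀ w → Vec.toList (Vec.map (lookup (row T (x Vec.++ v) w)) (rows sh)) ≡ map (λ i → T (P i) w) (allFin d)
      rows-list w = begin
        Vec.toList (Vec.map (lookup r) (Vec.map (_↑ˡ t) Sh.P))     ≡⟨ cong Vec.toList (sym (Vec.map-∘ (lookup r) (_↑ˡ t) Sh.P)) ⟩
        Vec.toList (Vec.map (λ i → lookup r (i ↑ˡ t)) Sh.P)        ≡⟨ cong Vec.toList (Vec.map-cong (λ i → trans (row-at w (i ↑ˡ t)) (cong (λ z → T z w) (Vec.lookup-++ˡ x v i))) Sh.P) ⟩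
        Vec.toList (Vec.map (λ i → T (lookup x i) w) Sh.P)         ≡⟨ toList-lookup (λ i → T (lookup x i) w) Sh.P ⟩
        map (λ i → T (P i) w) (allFin d)                           ∎
        where
        open ≡-Reasoning
        r = row T (x Vec.++ v) w
        toList-lookup : ∀ {q} {A B : Set} (f : A → B) (v : Vec A q) → Vec.toList (Vec.map f v) ≡ map (f ∘ lookup v) (allFin q)
        toList-lookup f []      = refl
        toList-lookup {suc q} f (y ∷ v) = cong (f y ∷_) (trans (toList-lookup f v)
          (trans (map-tabulate id (f ∘ lookup v)) (sym (map-tabulate suc (f ∘ lookup (y ∷ v))))))

      cols-list : ∀ w → Vec.toList (Vec.map (lookup (row T (x Vec.++ v) w)) (cols sh)) ≡ map (λ a → T (Q a) w) (bitVecs d)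
      cols-list w = begin
        Vec.toList (Vec.map (lookup r) (cols sh))                                ≡⟨ cong Vec.toList (sym (Vec.map-∘ (lookup r) _ (Vec.fromList (bitVecs d)))) ⟩
        Vec.toList (Vec.map (λ a → lookup r (s ↑ʳ Sh.Q a)) (Vec.fromList (bitVecs d))) ≡⟨ Vec.toList-map _ (Vec.fromList (bitVecs d)) ⟩
        map (λ a → lookup r (s ↑ʳ Sh.Q a)) (Vec.toList (Vec.fromList (bitVecs d))) ≡⟨ cong (map _) (Vec.toList∘fromList (bitVecs d)) ⟩
        map (λ a → lookup r (s ↑ʳ Sh.Q a)) (bitVecs d)                           ≡⟨ map-cong (λ a → trans (row-at w (s ↑ʳ Sh.Q a)) (cong (λ z → T z w) (Vec.lookup-++ʳ x v (Sh.Q a)))) (bitVecs d) ⟩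
        map (λ a → T (Q a) w) (bitVecs d)                                        ∎
        where
        open ≡-Reasoning
        r = row T (x Vec.++ v) w

    -- The factors give `P` and `Q` the same total mass `d * 2 ^ d`, although they have `d` and
    -- `2 ^ d` members, because only the density towards both sides together matters.
    weight : Fin n → ℕ
    weight w = 2 ^ d * ∑ (allFin d) (λ i → adj w (P i)) + d * ∑ (bitVecs d) (λ a → adj w (Q a))

    -- A balanced vertex falls under the second alternative of `hub-dichotomy`. A skewed one gets
    -- the trivial bound, each side contributing at most `d * 2 ^ d`.
    weight-bound : ∀ e k w → 3 ≤ k → k ≤ e → 16 * (e * e) ≤ d → ¬ HasCycle D k →
      e * weight w ≤ d * 2 ^ d * (e + 1) + e * (d * 2 ^ d) * ind (skewed sh (2 * e) (row T (x Vec.++ v) w))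
    weight-bound e k w 3≤k k≤e e²≤d acyclic = go (skewed sh (2 * e) r) refl
      where
      open ≤-Reasoning
      r = row T (x Vec.++ v) w
      q = 2 ^ d
      unfold : weight w ≡ q * (∑ (allFin d) (λ i → ind (D w (P i))) + ∑ (allFin d) (λ i → ind (D (P i) w)))
                        + d * (∑ (bitVecs d) (λ a → ind (D w (Q a))) + ∑ (bitVecs d) (λ a → ind (D (Q a) w)))
      unfold = cong₂ (λ y z → q * y + d * z) (∑-+ (allFin d) _ _) (∑-+ (bitVecs d) _ _)
      ∨-false : ∀ {y z} → (y ∨ z) ≡ false → y ≡ false × z ≡ false
      ∨-false {false} eq = refl , eq
      go : ∀ z → skewed sh (2 * e) r ≡ z → e * weight w ≤ d * q * (e + 1) + e * (d * q) * ind z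
      go true _ = begin
        e * weight w                                       ≤⟨ *-monoʳ-≤ e (+-mono-≤ (*-monoʳ-≤ q (∑-mono (allFin d) (λ i → adj≤1 w (P i)))) (*-monoʳ-≤ d (∑-mono (bitVecs d) (λ a → adj≤1 w (Q a))))) ⟩
        e * (q * ∑ (allFin d) (λ _ → 1) + d * ∑ (bitVecs d) (λ _ → 1)) ≡⟨ cong₂ (λ y z → e * (q * y + d * z)) (trans (sym (length≡∑1 (allFin d))) (length-tabulate {n = d} id)) (trans (sym (length≡∑1 (bitVecs d))) (length-tuples bools d)) ⟩
        e * (q * d + d * q)                                ≤⟨ m≤n+m _ (d * q) ⟩
        d * q + e * (q * d + d * q)                        ≡⟨ collect e q d ⟩
        d * q * (e + 1) + e * (d * q) * 1                  ∎
        where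
        collect : ∀ e q d → d * q + e * (q * d + d * q) ≡ d * q * (e + 1) + e * (d * q) * 1
        collect = solve-∀
      go false eq with ∨-false eq
      ... | balP , balQ with side-bounds e w (allFin d) P _ (rows-list w) balP | side-bounds e w (bitVecs d) Q _ (cols-list w) balQ
      ...   | oP , iP | oQ , iQ with hub-dichotomy toHub e k w 3≤k k≤e e²≤d oP iP
                                       (≤-trans oQ (≤-reflexive (cong ((2 * e + 1) *_) (length-tuples bools d))))
                                       (≤-trans iQ (≤-reflexive (cong ((2 * e + 1) *_) (length-tuples bools d))))
      ...     | inj₁ cyc = contradiction cyc acyclic
      ...     | inj₂ le  = begin
        e * weight w                                       ≡⟨ cong (e *_) unfold ⟩
        _                                                  ≤⟨ le ⟩
        d * q * (e + 1)                                    ≤⟨ m≤m+n (d * q * (e + 1)) _ ⟩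
        d * q * (e + 1) + e * (d * q) * 0                  ∎

  module _ (U : List (Fin n)) (U≼V : U ≼ V) (e : ℕ) (dense : ∀ y → y ∈ U → (e + 2) * length U ≤ 2 * e * ∑ U (λ z → adj z y)) where
    private
      m = length U
      deg : Fin n → ℕ
      deg y = ∑ U (λ z → adj z y)

    completeCount : ℕ → ℕ → ℕ
    completeCount s t = ∑ (tuples U s) (λ x → ∑ (tuples U t) (complete x))

    -- Summed over `x`, the numbers `cod x` of common neighbours give the `s`-th powers of the
    -- degrees, each degree being at least (1/2 + 1/e)|U|. Convexity then passes to the power
    -- `suc t`. The factor 2 in `K` lifts the mean of `c′` to `2 * α`, so that the crude `tangent`
    -- at `α` can replace Jensen's inequality.
    many-complete : ∀ s t → ((e + 2) ^ s * m) ^ suc t * m ^ s ≤ (2 * (2 * e) ^ s) ^ suc t * completeCount s (suc t)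
    many-complete s t = +-cancelʳ-≤ (αᵗ * m ^ s) _ _ (begin
      αᵗ * m ^ s + αᵗ * m ^ s                                      ≡⟨ twice α (α ^ t) (m ^ s) ⟩
      α ^ t * (2 * α * m ^ s)                                      ≤⟨ *-monoʳ-≤ (α ^ t) average ⟩
      α ^ t * ∑ X c′                                               ≡⟨ ∑-*ˡ X (α ^ t) c′ ⟨
      ∑ X (λ x → α ^ t * c′ x)                                     ≤⟨ ∑-mono X (λ x → tangent (c′ x)) ⟩
      ∑ X (λ x → c′ x ^ suc t + αᵗ)                                ≡⟨ ∑-+ X _ _ ⟩
      ∑ X (λ x → c′ x ^ suc t) + ∑ X (λ _ → αᵗ)                    ≡⟨ cong₂ _+_ powers (trans (∑-const X αᵗ) (trans (cong (_* αᵗ) (length-tuples U s)) (*-comm (m ^ s) αᵗ))) ⟩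
      K ^ suc t * completeCount s (suc t) + αᵗ * m ^ s             ∎)
      where
      open ≤-Reasoning
      α = (e + 2) ^ s * m
      αᵗ = α ^ suc t
      K = 2 * (2 * e) ^ s
      X = tuples U s
      cod c′ : Vec (Fin n) s → ℕ
      cod x = ∑ U (λ y → ∏ x (λ z → adj z y))
      c′ x = K * cod x
      twice : ∀ α B C → α * B * C + α * B * C ≡ B * (2 * α * C)
      twice = solve-∀
      tangent : ∀ c → α ^ t * c ≤ c ^ suc t + αᵗ
      tangent c with ≤-total α c
      ... | inj₁ A≤c = ≤-trans (≤-trans (≤-reflexive (*-comm (α ^ t) c)) (*-monoʳ-≤ c (^-monoˡ-≤ t A≤c))) (m≤m+n _ αᵗ)
      ... | inj₂ c≤A = ≤-trans (≤-trans (≤-reflexive (*-comm (α ^ t) c)) (*-monoˡ-≤ (α ^ t) c≤A)) (m≤n+m αᵗ _)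
      ∑cod : ∑ X cod ≡ ∑ U (λ y → deg y ^ s)
      ∑cod = trans (∑-swap X U _) (∑-cong U (λ y → ∑-tuples-∏ U s (λ z → adj z y)))
      average : 2 * α * m ^ s ≤ ∑ X c′
      average = begin
        2 * ((e + 2) ^ s * m) * m ^ s                     ≡⟨ reorder ((e + 2) ^ s) m (m ^ s) ⟩
        2 * (m * ((e + 2) ^ s * m ^ s))                   ≡⟨ cong (λ z → 2 * (m * z)) (^-distribʳ-* (e + 2) m s) ⟨
        2 * (m * ((e + 2) * m) ^ s)                       ≡⟨ cong (2 *_) (∑-const U _) ⟨
        2 * ∑ U (λ _ → ((e + 2) * m) ^ s)                 ≤⟨ *-monoʳ-≤ 2 (∑-mono-∈ U (λ y y∈ → ^-monoˡ-≤ s (dense y y∈))) ⟩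
        2 * ∑ U (λ y → (2 * e * deg y) ^ s)               ≡⟨ cong (2 *_) (∑-cong U (λ y → ^-distribʳ-* (2 * e) (deg y) s)) ⟩
        2 * ∑ U (λ y → (2 * e) ^ s * deg y ^ s)           ≡⟨ cong (2 *_) (∑-*ˡ U ((2 * e) ^ s) _) ⟩
        2 * ((2 * e) ^ s * ∑ U (λ y → deg y ^ s))         ≡⟨ *-assoc 2 ((2 * e) ^ s) _ ⟨
        K * ∑ U (λ y → deg y ^ s)                         ≡⟨ cong (K *_) ∑cod ⟨
        K * ∑ X cod                                       ≡⟨ ∑-*ˡ X K cod ⟨
        ∑ X c′                                            ∎
        where
        reorder : ∀ a b c → 2 * (a * b) * c ≡ 2 * (b * (a * c))
        reorder = solve-∀
      powers : ∑ X (λ x → c′ x ^ suc t) ≡ K ^ suc t * completeCount s (suc t)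
      powers = trans (∑-cong X (λ x → ^-distribʳ-* K (cod x) (suc t))) (trans (∑-*ˡ X (K ^ suc t) _)
        (cong (K ^ suc t *_) (∑-cong X (λ x → sym (∑-tuples-∏ U (suc t) (λ y → ∏ x (λ z → adj z y)))))))

    -- Without a k-cycle, every well-joined vertex of U is skewed with respect to (x , v).
    many-skewed : ∀ {s t} d k (x : Vec (Fin n) s) (v : Vec (Fin n) t) → (∀ i → lookup x i ∈ U) → (∀ j → lookup v j ∈ U) →
      3 ≤ k → k ≤ e → 16 * (e * e) ≤ d → ¬ HasCycle D k → complete x v ≢ 0 → few (sauer s d) (mat T x v) ≡ false →
      m ≤ e * skewCount T d (2 * e) x v
    many-skewed {s} {t} d k x v x∈ v∈ 3≤k k≤e e²≤d acyclic full notFew =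
      -- In units of `d * q`, the weights over `U` add up to at least (1 + 2/e)m. All vertices
      -- together account for (1 + 1/e)m, and each skewed one for at most 1 more, so m/e vertices
      -- are skewed.
      ≤-trans (+-cancelˡ-≤ ((e + 1) * m) _ _ (*-cancelˡ-≤ (d * q) {{>-nonZero (*-mono-≤ 1≤d (m^n>0 2 d))}} (begin
        d * q * ((e + 1) * m + m)                                      ≡⟨ expand d q e m ⟩
        q * (d * ((e + 2) * m)) + d * q * 0                            ≡⟨ trans (cong (q * (d * ((e + 2) * m)) +_) (*-zeroʳ (d * q))) (+-identityʳ _) ⟩
        q * (d * ((e + 2) * m))                                        ≤⟨ *-cancelˡ-≤ 2 doubled ⟩
        e * ∑ U W                                                      ≡⟨ ∑-*ˡ U e W ⟨
        ∑ U (λ w → e * W w)                                            ≤⟨ ∑-mono U (λ w → weight-bound full sh e k w 3≤k k≤e e²≤d acyclic) ⟩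
        ∑ U (λ w → d * q * (e + 1) + e * (d * q) * S w)                ≡⟨ ∑-+ U _ _ ⟩
        ∑ U (λ _ → d * q * (e + 1)) + ∑ U (λ w → e * (d * q) * S w)    ≡⟨ cong₂ _+_ (∑-const U _) (∑-*ˡ U (e * (d * q)) S) ⟩
        m * (d * q * (e + 1)) + e * (d * q) * ∑ U S                    ≡⟨ regroup m (d * q) e (∑ U S) ⟩
        d * q * ((e + 1) * m + e * ∑ U S)                              ∎)))
        (*-monoʳ-≤ e (≤-trans (U≼V S) (≤-reflexive (∑-cong V skew-eq))))
      where
      open ≤-Reasoning
      q = 2 ^ d
      sh : Shatter d (mat T x v)
      sh = proj₁ (skew-shatter d (2 * e) (mat T x v) notFew)
      open Hub (toHub full sh) using (P; Q)
      W S : Fin n → ℕ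
      W = weight full sh
      S w = ind (skewed sh (2 * e) (row T (x Vec.++ v) w))
      1≤d : 1 ≤ d
      1≤d = ≤-trans (≤-trans (*-mono-≤ 1≤e 1≤e) (m≤n*m (e * e) 16)) e²≤d
        where 1≤e = ≤-trans (s≤s z≤n) (≤-trans 3≤k k≤e)
      skew-eq : ∀ w → S w ≡ skew d (2 * e) (mat T x v) (row T (x Vec.++ v) w)
      skew-eq w = sym (proj₂ (skew-shatter d (2 * e) (mat T x v) notFew) (row T (x Vec.++ v) w))
      expand : ∀ d q e m → d * q * ((e + 1) * m + m) ≡ q * (d * ((e + 2) * m)) + d * q * 0
      expand = solve-∀
      regroup : ∀ m a e s → m * (a * (e + 1)) + e * a * s ≡ a * ((e + 1) * m + e * s)
      regroup = solve-∀
      side : ∀ {I : Set} (is : List I) (F : I → Fin n) → (∀ i → F i ∈ U) →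
             length is * ((e + 2) * m) ≤ 2 * e * ∑ U (λ w → ∑ is (λ i → adj w (F i)))
      side is F F∈ = begin
        length is * ((e + 2) * m)                         ≡⟨ ∑-const is _ ⟨
        ∑ is (λ _ → (e + 2) * m)                          ≤⟨ ∑-mono is (λ i → dense (F i) (F∈ i)) ⟩
        ∑ is (λ i → 2 * e * deg (F i))                    ≡⟨ ∑-*ˡ is (2 * e) _ ⟩
        2 * e * ∑ is (λ i → deg (F i))                    ≡⟨ cong (2 * e *_) (∑-swap is U _) ⟩
        2 * e * ∑ U (λ w → ∑ is (λ i → adj w (F i)))      ∎
      doubled : 2 * (q * (d * ((e + 2) * m))) ≤ 2 * (e * ∑ U W)
      doubled = begin
        2 * (q * (d * ((e + 2) * m)))                                     ≡⟨ two q d ((e + 2) * m) ⟩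
        q * (d * ((e + 2) * m)) + d * (q * ((e + 2) * m))                 ≤⟨ +-mono-≤
            (*-monoʳ-≤ q (≤-trans (≤-reflexive (cong (_* ((e + 2) * m)) (sym (length-tabulate {n = d} id)))) (side (allFin d) P (λ i → x∈ _))))
            (*-monoʳ-≤ d (≤-trans (≤-reflexive (cong (_* ((e + 2) * m)) (sym (length-tuples bools d)))) (side (bitVecs d) Q (λ a → v∈ _)))) ⟩
        q * (2 * e * SP) + d * (2 * e * SQ)                               ≡⟨ pull q d e SP SQ ⟩
        2 * (e * (q * SP + d * SQ))                                       ≡⟨ cong (λ z → 2 * (e * z)) (trans (cong₂ _+_ (sym (∑-*ˡ U q _)) (sym (∑-*ˡ U d _))) (sym (∑-+ U _ _))) ⟩
        2 * (e * ∑ U W)                                                   ∎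
        where
        SP = ∑ U (λ w → ∑ (allFin d) (λ i → adj w (P i)))
        SQ = ∑ U (λ w → ∑ (bitVecs d) (λ a → adj w (Q a)))
        two : ∀ q d x → 2 * (q * (d * x)) ≡ q * (d * x) + d * (q * x)
        two = solve-∀
        pull : ∀ q d e a b → q * (2 * e * a) + d * (2 * e * b) ≡ 2 * (e * (q * a + d * b))
        pull = solve-∀

-- At least λ′ / κ · n^(s + t) of the tuples (x , v) are complete; the factor (2e)^(s + t) of κ comes from
-- n ≤ 2e|U|, the rest from comparing the number of common neighbours of x with half its average.
κ λ′ : ℕ → ℕ → ℕ → ℕ
κ e s t = (2 * e) ^ (s + t) * (2 * (2 * e) ^ s) ^ t
λ′ e s t = ((e + 2) ^ s) ^ t

module _ {n} (T D : Digraph n) (tournament : IsTournament T) (sub : ∀ u v → D u v ≡ true → T u v ≡ true) where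
  open Density T D tournament sub

  private
    V = vertices n

    edgeSum : List (Fin n) → ℕ
    edgeSum U = ∑ U (λ y → ∑ U (λ z → adj z y))

    Dense : ℕ → List (Fin n) → Set
    Dense e U = ∀ y → y ∈ U → (e + 2) * length U ≤ 2 * e * ∑ U (λ z → adj z y)

    -- By the first count at least half of the guaranteed complete tuples have many patterns, and
    -- each of these has m/e skewed vertices by `many-skewed`. The `u`-th powers of these numbers
    -- alone exceed the bound on `skewMoment`. Acyclicity enters as an assumption to be refuted,
    -- whence the double negation.
    no-dense : ∀ U → U ≼ V → ∀ e → Dense e U → ∀ k d s t u → n ≤ 2 * e * length U → 3 ≤ k → k ≤ e → 16 * (e * e) ≤ d →
      2 * κ e s (suc t) * fewCount T d s (suc t) ≤ λ′ e s (suc t) * n ^ (s + suc t) →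
      2 * κ e s (suc t) * ((2 * e * e) ^ u * skewMoment T d (2 * e) s (suc t) u) < λ′ e s (suc t) * n ^ (s + suc t + u) →
      ¬ ¬ HasCycle D k
    no-dense U U≼V e dense k d s t′ u n≤ 3≤k k≤e e²≤d c₁ c₂ acyclic = <-irrefl refl (begin-strict
      Λ * n ^ (p + u)                                        ≡⟨ cong (Λ *_) (^-distribˡ-+-* n p u) ⟩
      Λ * (n ^ p * n ^ u)                                    ≡⟨ *-assoc Λ (n ^ p) (n ^ u) ⟨
      Λ * n ^ p * n ^ u                                      ≤⟨ *-mono-≤ good-half (^-monoˡ-≤ u n≤) ⟩
      2 * K * N′ * (2 * e * m) ^ u                           ≡⟨ cong (2 * K * N′ *_) (^-distribʳ-* (2 * e) m u) ⟩
      2 * K * N′ * ((2 * e) ^ u * m ^ u)                     ≡⟨ reorder (2 * K) N′ ((2 * e) ^ u) (m ^ u) ⟩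
      2 * K * ((2 * e) ^ u * (m ^ u * N′))                   ≤⟨ *-monoʳ-≤ (2 * K) (*-monoʳ-≤ ((2 * e) ^ u) moment) ⟩
      2 * K * ((2 * e) ^ u * (e ^ u * M))                    ≡⟨ cong (2 * K *_) (sym (*-assoc ((2 * e) ^ u) (e ^ u) M)) ⟩
      2 * K * ((2 * e) ^ u * e ^ u * M)                      ≡⟨ cong (λ z → 2 * K * (z * M)) (^-distribʳ-* (2 * e) e u) ⟨
      2 * K * ((2 * e * e) ^ u * M)                          <⟨ c₂ ⟩
      Λ * n ^ (p + u)                                        ∎)
      where
      open ≤-Reasoning
      t = suc t′
      p = s + t
      m = length U
      K = κ e s t
      Λ = λ′ e s t
      M = skewMoment T d (2 * e) s t u
      X = tuples U s
      Y = tuples U t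
      notFew : Vec (Fin n) s → Vec (Fin n) t → ℕ
      notFew x v = ind (not (few (sauer s d) (mat T x v)))
      N N′ : ℕ
      N  = completeCount U U≼V e dense s t
      N′ = ∑ X (λ x → ∑ Y (λ v → complete x v * notFew x v))
      reorder : ∀ a b c d → a * b * (c * d) ≡ a * (c * (d * b))
      reorder = solve-∀
      complete≤1 : ∀ x v → complete x v ≤ 1
      complete≤1 x v = ∏-≤1 v _ (λ y → ∏-≤1 x _ (λ z → adj≤1 z y))
      split : N ≤ N′ + fewCount T d s t
      split = begin
        ∑ X (λ x → ∑ Y (complete x))                                                        ≤⟨ ∑-mono X (λ x → ∑-mono Y (λ v → pointwise x v)) ⟩
        ∑ X (λ x → ∑ Y (λ v → complete x v * notFew x v + F x v))                           ≡⟨ trans (∑-cong X (λ x → ∑-+ Y _ _)) (∑-+ X _ _) ⟩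
        N′ + ∑ X (λ x → ∑ Y (F x))                                                          ≤⟨ +-monoʳ-≤ N′ (≤-trans (∑-mono X (λ x → tuples-≼ {xs = U} {V} U≼V t (F x))) (tuples-≼ {xs = U} {V} U≼V s _)) ⟩
        N′ + fewCount T d s t                                                               ∎
        where
        F : Vec (Fin n) s → Vec (Fin n) t → ℕ
        F x v = ind (few (sauer s d) (mat T x v))
        cases : ∀ c b → c ≤ 1 → c ≤ c * ind (not b) + ind b
        cases c true  c≤1 = ≤-trans c≤1 (m≤n+m 1 (c * 0))
        cases c false c≤1 = ≤-reflexive (sym (trans (+-identityʳ _) (*-identityʳ c)))
        pointwise : ∀ x v → complete x v ≤ complete x v * notFew x v + F x v
        pointwise x v = cases (complete x v) (few (sauer s d) (mat T x v)) (complete≤1 x v)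
      enough : Λ * n ^ p ≤ K * N
      enough = begin
        Λ * n ^ p                                                              ≤⟨ *-monoʳ-≤ Λ (^-monoˡ-≤ p n≤) ⟩
        Λ * (2 * e * m) ^ p                                                    ≡⟨ cong (Λ *_) (^-distribʳ-* (2 * e) m p) ⟩
        Λ * ((2 * e) ^ p * m ^ p)                                              ≡⟨ cong (λ z → Λ * ((2 * e) ^ p * z)) (^-distribˡ-+-* m s t) ⟩
        Λ * ((2 * e) ^ p * (m ^ s * m ^ t))                                    ≡⟨ shuffle Λ ((2 * e) ^ p) (m ^ s) (m ^ t) ⟩
        (2 * e) ^ p * (Λ * m ^ t * m ^ s)                                      ≡⟨ cong (λ z → (2 * e) ^ p * (z * m ^ s)) (^-distribʳ-* ((e + 2) ^ s) m t) ⟨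
        (2 * e) ^ p * (((e + 2) ^ s * m) ^ t * m ^ s)                          ≤⟨ *-monoʳ-≤ ((2 * e) ^ p) (many-complete U U≼V e dense s t′) ⟩
        (2 * e) ^ p * ((2 * (2 * e) ^ s) ^ t * N)                              ≡⟨ *-assoc ((2 * e) ^ p) _ N ⟨
        K * N                                                                  ∎
        where
        shuffle : ∀ a b c d → a * (b * (c * d)) ≡ b * (a * d * c)
        shuffle = solve-∀
      good-half : Λ * n ^ p ≤ 2 * K * N′
      good-half = +-cancelʳ-≤ (Λ * n ^ p) _ _ (begin
        Λ * n ^ p + Λ * n ^ p                        ≤⟨ +-mono-≤ enough enough ⟩
        K * N + K * N                                ≡⟨ twice K N ⟩
        2 * K * N                                    ≤⟨ *-monoʳ-≤ (2 * K) split ⟩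
        2 * K * (N′ + fewCount T d s t)              ≡⟨ *-distribˡ-+ (2 * K) N′ _ ⟩
        2 * K * N′ + 2 * K * fewCount T d s t        ≤⟨ +-monoʳ-≤ (2 * K * N′) c₁ ⟩
        2 * K * N′ + Λ * n ^ p                       ∎)
        where
        twice : ∀ a b → a * b + a * b ≡ 2 * a * b
        twice = solve-∀
      moment : m ^ u * N′ ≤ e ^ u * M
      moment = begin
        m ^ u * N′                                                            ≡⟨ trans (sym (∑-*ˡ X (m ^ u) _)) (∑-cong X (λ x → sym (∑-*ˡ Y (m ^ u) _))) ⟩
        ∑ X (λ x → ∑ Y (λ v → m ^ u * (complete x v * notFew x v)))           ≤⟨ ∑-mono-∈ X (λ x x∈ → ∑-mono-∈ Y (λ v v∈ → pointwise x v x∈ v∈)) ⟩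
        ∑ X (λ x → ∑ Y (λ v → e ^ u * skewCount T d (2 * e) x v ^ u))         ≡⟨ trans (∑-cong X (λ x → ∑-*ˡ Y (e ^ u) _)) (∑-*ˡ X (e ^ u) _) ⟩
        e ^ u * ∑ X (λ x → ∑ Y (λ v → skewCount T d (2 * e) x v ^ u))         ≤⟨ *-monoʳ-≤ (e ^ u) (≤-trans (∑-mono X (λ x → tuples-≼ {xs = U} {V} U≼V t (λ v → skewCount T d (2 * e) x v ^ u))) (tuples-≼ {xs = U} {V} U≼V s _)) ⟩
        e ^ u * M                                                             ∎
        where
        pointwise : ∀ x v → x ∈ X → v ∈ Y → m ^ u * (complete x v * notFew x v) ≤ e ^ u * skewCount T d (2 * e) x v ^ u
        pointwise x v x∈ v∈ = cases (few (sauer s d) (mat T x v)) refl (complete x v ≟ 0)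
          where
          cases : ∀ b → few (sauer s d) (mat T x v) ≡ b → Dec (complete x v ≡ 0) →
                  m ^ u * (complete x v * ind (not b)) ≤ e ^ u * skewCount T d (2 * e) x v ^ u
          cases true  _ _ = ≤-trans (≤-reflexive (trans (cong (m ^ u *_) (*-zeroʳ (complete x v))) (*-zeroʳ (m ^ u)))) z≤n
          cases false _ (yes eq) = ≤-trans (≤-reflexive (trans (cong (λ z → m ^ u * (z * 1)) eq) (*-zeroʳ (m ^ u)))) z≤n
          cases false nf (no full) = begin
            m ^ u * (complete x v * 1)                     ≤⟨ *-monoʳ-≤ (m ^ u) (*-monoˡ-≤ 1 (complete≤1 x v)) ⟩
            m ^ u * 1                                      ≡⟨ *-identityʳ (m ^ u) ⟩
            m ^ u                                          ≤⟨ ^-monoˡ-≤ u (many-skewed U U≼V e dense d k x v (lookup-tuples x∈) (lookup-tuples v∈) 3≤k k≤e e²≤d acyclic full nf) ⟩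
            (e * skewCount T d (2 * e) x v) ^ u            ≡⟨ ^-distribʳ-* e _ u ⟩
            e ^ u * skewCount T d (2 * e) x v ^ u          ∎

    edgeSum-↭ : ∀ {U U′} → U ↭ U′ → edgeSum U ≡ edgeSum U′
    edgeSum-↭ {U} {U′} p = trans (∑-↭ _ p) (∑-cong U′ (λ y → ∑-↭ _ p))

    edgeSum-∷ : ∀ y U → edgeSum (y ∷ U) ≤ edgeSum U + 2 * ∑ (y ∷ U) (λ z → adj z y)
    edgeSum-∷ y U = begin
      (adj y y + S) + ∑ U (λ w → adj y w + ∑ U (λ z → adj z w))     ≡⟨ cong ((adj y y + S) +_) (∑-+ U _ _) ⟩
      (adj y y + S) + (∑ U (adj y) + edgeSum U)                     ≡⟨ cong (λ r → (adj y y + S) + (r + edgeSum U)) (∑-cong U (λ w → adj-sym y w)) ⟩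
      (adj y y + S) + (S + edgeSum U)                               ≤⟨ m≤m+n _ (adj y y) ⟩
      (adj y y + S) + (S + edgeSum U) + adj y y                     ≡⟨ collect (adj y y) S (edgeSum U) ⟩
      edgeSum U + 2 * (adj y y + S)                                 ∎
      where
      open ≤-Reasoning
      S = ∑ U (λ z → adj z y)
      collect : ∀ a s e → (a + s) + (s + e) + a ≡ e + 2 * (a + s)
      collect = solve-∀

    -- Deleting a vertex of too small degree keeps the edge sum above the quadratic threshold.
    prune : ∀ e c fuel U → length U ≤ fuel → U ≼ V → (e + 2) * (length U * length U + length U) + c ≤ 2 * e * edgeSum U →
      ∃ λ U′ → U′ ≼ V × Dense e U′ × c ≤ 2 * e * edgeSum U′
    prune e c zero       []      _   U≼V le = [] , U≼V , (λ _ ()) , ≤-trans (m≤n+m c _) le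
    prune e c (suc fuel) U       len U≼V le with All.all? (λ y → (e + 2) * length U ≤? 2 * e * ∑ U (λ z → adj z y)) U
    ... | yes all = U , U≼V , (λ y y∈ → All.lookup all y∈) , ≤-trans (m≤n+m c _) le
    ... | no ¬all with find (All.¬All⇒Any¬ (λ y → (e + 2) * length U ≤? 2 * e * ∑ U (λ z → adj z y)) U ¬all)
    ...   | y , y∈ , ¬deg with ∈-∃++ y∈
    ...     | ys , zs , refl = prune e c fuel U′ (s≤s⁻¹ (≤-trans (≤-reflexive (sym len-U)) len)) U′≼V
        (+-cancelʳ-≤ (2 * ((e + 2) * suc l)) _ _ (begin
        -- `l * l + l` grows by `2 * suc l` when `l` does. This matches the loss from a vertex below
        -- the degree threshold, as the edge sum counts every edge twice.
        (e + 2) * (l * l + l) + c + 2 * ((e + 2) * suc l)           ≡⟨ square e l c ⟩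
        (e + 2) * (suc l * suc l + suc l) + c                       ≡⟨ cong (λ l → (e + 2) * (l * l + l) + c) len-U ⟨
        (e + 2) * (length U * length U + length U) + c              ≤⟨ le ⟩
        2 * e * edgeSum U                                           ≡⟨ cong (2 * e *_) (edgeSum-↭ shuffled) ⟩
        2 * e * edgeSum (y ∷ U′)                                    ≤⟨ *-monoʳ-≤ (2 * e) (edgeSum-∷ y U′) ⟩
        2 * e * (edgeSum U′ + 2 * ∑ (y ∷ U′) (λ z → adj z y))       ≡⟨ cong (λ r → 2 * e * (edgeSum U′ + 2 * r)) (sym (∑-↭ _ shuffled)) ⟩
        2 * e * (edgeSum U′ + 2 * degree)                           ≡⟨ distribute e (edgeSum U′) degree ⟩
        2 * e * edgeSum U′ + 2 * (2 * e * degree)                   ≤⟨ +-monoʳ-≤ (2 * e * edgeSum U′) (*-monoʳ-≤ 2 (<⇒≤ (≰⇒> ¬deg))) ⟩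
        2 * e * edgeSum U′ + 2 * ((e + 2) * length U)               ≡⟨ cong (λ r → 2 * e * edgeSum U′ + 2 * ((e + 2) * r)) len-U ⟩
        2 * e * edgeSum U′ + 2 * ((e + 2) * suc l)                  ∎))
      where
      open ≤-Reasoning
      U′ = ys ++ zs
      l = length U′
      shuffled : U ↭ y ∷ U′
      shuffled = Perm.shift y ys zs
      len-U : length U ≡ suc l
      len-U = Perm.↭-length shuffled
      U′≼V : U′ ≼ V
      U′≼V F = ≤-trans (m≤n+m (∑ U′ F) (F y)) (≤-trans (≤-reflexive (sym (∑-↭ F shuffled))) (U≼V F))
      degree = ∑ U (λ z → adj z y)
      square : ∀ e l c → (e + 2) * (l * l + l) + c + 2 * ((e + 2) * suc l) ≡ (e + 2) * (suc l * suc l + suc l) + c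
      square = solve-∀
      distribute : ∀ e a b → 2 * e * (a + 2 * b) ≡ 2 * e * a + 2 * (2 * e * b)
      distribute = solve-∀

  -- The surplus `n * n` survives the pruning as a bound on the edge sum of `U`. That sum is at most
  -- the square of the size of `U`, so `U` has at least n/(2e) vertices.
  dense-cycle : ∀ e k d s t u → 3 ≤ k → k ≤ e → 16 * (e * e) ≤ d →
    2 * κ e s (suc t) * fewCount T d s (suc t) ≤ λ′ e s (suc t) * n ^ (s + suc t) →
    2 * κ e s (suc t) * ((2 * e * e) ^ u * skewMoment T d (2 * e) s (suc t) u) < λ′ e s (suc t) * n ^ (s + suc t + u) →
    (e + 2) * (n * n + n) + n * n ≤ 2 * e * ∑ V (λ y → ∑ V (λ z → adj z y)) →
    ¬ ¬ HasCycle D k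
  dense-cycle e k d s t u 3≤k k≤e e²≤d c₁ c₂ le with prune e (n * n) n V (≤-reflexive (length-vertices n)) (λ F → ≤-refl)
                                                  (subst (λ l → (e + 2) * (l * l + l) + n * n ≤ 2 * e * edgeSum V) (sym (length-vertices n)) le)
  ... | U , U≼V , dense , n²≤ = no-dense U U≼V e dense k d s t u (≮⇒≥ large) 3≤k k≤e e²≤d c₁ c₂
    where
    open ≤-Reasoning
    m = length U
    large : ¬ (2 * e * m < n)
    large lt = <-irrefl refl (begin-strict
      n * n                                          ≤⟨ n²≤ ⟩
      2 * e * ∑ U (λ y → ∑ U (λ z → adj z y))        ≤⟨ *-monoʳ-≤ (2 * e) (∑-mono U (λ y → ∑-mono U (λ z → adj≤1 z y))) ⟩
      2 * e * ∑ U (λ y → ∑ U (λ z → 1))              ≡⟨ cong (2 * e *_) (trans (∑-const U _) (cong (m *_) (sym (length≡∑1 U)))) ⟩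
      2 * e * (m * m)                                ≤⟨ *-monoˡ-≤ (m * m) (m≤m*n (2 * e) (2 * e) {{>-nonZero (≤-trans (≤-trans (≤-trans (s≤s z≤n) 3≤k) k≤e) (m≤n*m e 2))}}) ⟩
      2 * e * (2 * e) * (m * m)                      ≡⟨ square (2 * e) m ⟩
      (2 * e * m) * (2 * e * m)                      <⟨ *-mono-< lt lt ⟩
      n * n                                          ∎)
      where
      square : ∀ a b → a * a * (b * b) ≡ (a * b) * (a * b)
      square = solve-∀

-- Deleting `S` leaves an edge sum of at least n² - n - 2|S|. The 4 in `e` covers the excess 2 of
-- the degree threshold, the surplus `n * n` of `dense-cycle` and the terms linear in `n`; the `k`
-- in `e` yields `k ≤ e`.
transversal-lower : ∀ {n} (T : Digraph n) → IsTournament T → ∀ k m e d s t u → e ≡ (4 + k) * suc m →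
  3 ≤ k → 16 * (e * e) ≤ d → 3 * e + 2 ≤ n →
  2 * κ e s (suc t) * fewCount T d s (suc t) ≤ λ′ e s (suc t) * n ^ (s + suc t) →
  2 * κ e s (suc t) * ((2 * e * e) ^ u * skewMoment T d (2 * e) s (suc t) u) < λ′ e s (suc t) * n ^ (s + suc t + u) →
  ∀ S → IsTransversal T k S → m * (n * n) ≤ suc m * (4 * length S)
transversal-lower {n} T tournament k m e d s t u refl 3≤k e²≤d n-large c₁ c₂ S (S⊆T , S-unique , hits) =
  ≮⇒≥ (λ small → dense-cycle T D tournament sub e k d s t u 3≤k k≤e e²≤d c₁ c₂ (many-edges small) acyclic)
  where
  open ≤-Reasoning
  V = vertices n
  k≤e : k ≤ e
  k≤e = ≤-trans (m≤n+m k 4) (m≤m*n (4 + k) (suc m))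
  _∈S? : ∀ a → Dec (a ∈ S)
  a ∈S? = Any.any? (a ≟ᵃ_) S
  D : Digraph n
  D u v = T u v ∧ not (does ((u , v) ∈S?))
  sub : ∀ u v → D u v ≡ true → T u v ≡ true
  sub u v eq = proj₁ (∧-true eq)
  not-S : ∀ {u v} → D u v ≡ true → (u , v) ∉ S
  not-S {u} {v} eq a∈ = case trans (sym (proj₂ (∧-true {T u v} eq))) (cong not (dec-true ((u , v) ∈S?) a∈)) of λ ()
  open Density T D tournament sub using (adj)
  acyclic : ¬ HasCycle D k
  acyclic (c , refl , unique , arcs) with canonicalCopy T c (≤-trans (s≤s z≤n) 3≤k) unique (All.map (λ {a} → sub _ _) arcs)
  ... | c′ , ic , same with find (hits c′ ic)
  ...   | a , a∈ , a∈S = not-S (All.lookup arcs (Perm.∈-resp-↭ same a∈)) a∈S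
  mult : Arc n → ℕ
  mult a = ∑ S (λ b → ind (does (b ≟ᵃ a)))
  1≤mult : ∀ {a} → a ∈ S → 1 ≤ mult a
  1≤mult a∈ = ≤-reflexive (sym (count-∈ _≟ᵃ_ S-unique a∈))
  covered : ∀ y z → 1 ≤ adj z y + δ z y + (mult (z , y) + mult (y , z))
  covered y z with z Fin.≟ y
  ... | yes _  = ≤-trans (m≤n+m 1 (adj z y)) (m≤m+n (adj z y + 1) _)
  ... | no z≢y = cases (T z y) refl
    where
    one-side : ∀ u v → T u v ≡ true → 1 ≤ ind (D u v) + mult (u , v)
    one-side u v uv = go ((u , v) ∈S?)
      where
      go : Dec ((u , v) ∈ S) → 1 ≤ ind (D u v) + mult (u , v)
      go (yes p) = ≤-trans (1≤mult p) (m≤n+m _ (ind (D u v)))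
      go (no ¬p) = ≤-trans (≤-reflexive (sym (cong ind (cong₂ (λ x y → x ∧ not y) uv (dec-false ((u , v) ∈S?) ¬p))))) (m≤m+n (ind (D u v)) _)
    a = ind (D z y)
    b = ind (D y z)
    cases : ∀ x → T z y ≡ x → 1 ≤ adj z y + 0 + (mult (z , y) + mult (y , z))
    cases true  zy = ≤-trans (one-side z y zy) (+-mono-≤ (≤-trans (m≤m+n a b) (m≤m+n (a + b) 0)) (m≤m+n (mult (z , y)) (mult (y , z))))
    cases false zy = ≤-trans (one-side y z (trans (proj₂ tournament y z (z≢y ∘ sym)) (cong not zy)))
      (+-mono-≤ (≤-trans (m≤n+m b a) (m≤m+n (a + b) 0)) (m≤n+m (mult (y , z)) (mult (z , y))))
  ∑∑mult : ∑ V (λ y → ∑ V (λ z → mult (z , y))) ≤ length S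
  ∑∑mult = begin
    ∑ V (λ y → ∑ V (λ z → mult (z , y)))                              ≡⟨ ∑-cong V (λ y → ∑-swap V S _) ⟩
    ∑ V (λ y → ∑ S (λ b → ∑ V (λ z → ind (does (b ≟ᵃ (z , y))))))     ≡⟨ ∑-swap V S _ ⟩
    ∑ S (λ b → ∑ V (λ y → ∑ V (λ z → ind (does (b ≟ᵃ (z , y))))))     ≤⟨ ∑-mono S once ⟩
    ∑ S (λ _ → 1)                                                     ≡⟨ length≡∑1 S ⟨
    length S                                                          ∎
    where
    once : ∀ b → ∑ V (λ y → ∑ V (λ z → ind (does (b ≟ᵃ (z , y))))) ≤ 1
    once (b₁ , b₂) = begin
      ∑ V (λ y → ∑ V (λ z → ind (does ((b₁ , b₂) ≟ᵃ (z , y)))))   ≤⟨ ∑-mono V (λ y → ∑-mono V (λ z → pair z y)) ⟩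
      ∑ V (λ y → ∑ V (λ z → δ z b₁ * δ y b₂))                     ≡⟨ ∑-cong V (λ y → trans (∑-*ʳ V (λ z → δ z b₁) (δ y b₂)) (trans (cong (_* δ y b₂) (∑-vertices-δ b₁)) (*-identityˡ (δ y b₂)))) ⟩
      ∑ V (λ y → δ y b₂)                                          ≡⟨ ∑-vertices-δ b₂ ⟩
      1                                                           ∎
      where
      pair : ∀ z y → ind (does ((b₁ , b₂) ≟ᵃ (z , y))) ≤ δ z b₁ * δ y b₂
      pair z y = ind-≤ ((b₁ , b₂) ≟ᵃ (z , y)) (λ { refl → *-mono-≤ (same b₁) (same b₂) })
        where
        same : ∀ x → 1 ≤ δ x x
        same x = ≤-reflexive (sym (cong ind (dec-true (x Fin.≟ x) refl)))
  E = ∑ V (λ y → ∑ V (λ z → adj z y))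
  n²≤ : n * n ≤ E + n + (length S + length S)
  n²≤ = begin
    n * n                                                                       ≡⟨ cong (λ x → x * x) (length-vertices n) ⟨
    length V * length V                                                         ≡⟨ trans (∑-const V _) (cong (length V *_) (sym (length≡∑1 V))) ⟨
    ∑ V (λ _ → ∑ V (λ _ → 1))                                                   ≤⟨ ∑-mono V (λ y → ∑-mono V (covered y)) ⟩
    ∑ V (λ y → ∑ V (λ z → adj z y + δ z y + (mult (z , y) + mult (y , z))))     ≡⟨ ∑-cong V (λ y → trans (∑-+ V _ _) (cong₂ _+_ (∑-+ V _ _) (∑-+ V _ _))) ⟩
    ∑ V (λ y → ∑ V (λ z → adj z y) + ∑ V (λ z → δ z y) + (∑ V (λ z → mult (z , y)) + ∑ V (λ z → mult (y , z))))
                                                                                ≡⟨ trans (∑-+ V _ _) (cong₂ _+_ (∑-+ V _ _) (∑-+ V _ _)) ⟩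
    E + ∑ V (λ y → ∑ V (λ z → δ z y)) + (∑ V (λ y → ∑ V (λ z → mult (z , y))) + ∑ V (λ y → ∑ V (λ z → mult (y , z))))
                                                                                ≤⟨ +-mono-≤ (+-monoʳ-≤ E (≤-reflexive diagonal)) (+-mono-≤ ∑∑mult (≤-trans (≤-reflexive (∑-swap V V _)) ∑∑mult)) ⟩
    E + n + (length S + length S)                                               ∎
    where
    diagonal : ∑ V (λ y → ∑ V (λ z → δ z y)) ≡ n
    diagonal = trans (∑-cong V ∑-vertices-δ) (trans (sym (length≡∑1 V)) (length-vertices n))
  many-edges : suc m * (4 * length S) < m * (n * n) → (e + 2) * (n * n + n) + n * n ≤ 2 * e * E
  many-edges small = +-cancelʳ-≤ (2 * e * (n + (length S + length S))) _ _ (begin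
    (e + 2) * (n * n + n) + n * n + 2 * e * (n + (length S + length S))          ≡⟨ expand e n (length S) ⟩
    (e + 3) * (n * n) + (3 * e + 2) * n + e * (4 * length S)                     ≤⟨ +-mono-≤ (+-monoʳ-≤ ((e + 3) * (n * n)) (*-monoˡ-≤ n n-large)) S-small ⟩
    (e + 3) * (n * n) + n * n + (4 + k) * (m * (n * n))                          ≤⟨ m≤m+n _ (k * (n * n)) ⟩
    (e + 3) * (n * n) + n * n + (4 + k) * (m * (n * n)) + k * (n * n)            ≡⟨ collect k m (n * n) ⟩
    2 * e * (n * n)                                                              ≤⟨ *-monoʳ-≤ (2 * e) n²≤ ⟩
    2 * e * (E + n + (length S + length S))                                      ≡⟨ split (2 * e) E n (length S + length S) ⟩
    2 * e * E + 2 * e * (n + (length S + length S))                              ∎)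
    where
    expand : ∀ e n l → (e + 2) * (n * n + n) + n * n + 2 * e * (n + (l + l)) ≡ (e + 3) * (n * n) + (3 * e + 2) * n + e * (4 * l)
    expand = solve-∀
    collect : ∀ k m x → ((4 + k) * suc m + 3) * x + x + (4 + k) * (m * x) + k * x ≡ 2 * ((4 + k) * suc m) * x
    collect = solve-∀
    split : ∀ a b c d → a * (b + c + d) ≡ a * b + a * (c + d)
    split = solve-∀
    S-small : e * (4 * length S) ≤ (4 + k) * (m * (n * n))
    S-small = ≤-trans (≤-reflexive (*-assoc (4 + k) (suc m) _)) (*-monoʳ-≤ (4 + k) (<⇒≤ small))

-- Choice of the parameters

bernoulli : ∀ e j → e ^ j * (e + j) ≤ e * suc e ^ j
bernoulli e zero    = ≤-reflexive (trans (+-identityʳ (e + 0)) (trans (+-identityʳ e) (sym (*-identityʳ e))))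
bernoulli e (suc j) = begin
  e * e ^ j * (e + suc j)             ≤⟨ m≤m+n _ (e ^ j * j) ⟩
  e * e ^ j * (e + suc j) + e ^ j * j ≡⟨ expand e j (e ^ j) ⟩
  suc e * (e ^ j * (e + j))           ≤⟨ *-monoʳ-≤ (suc e) (bernoulli e j) ⟩
  suc e * (e * suc e ^ j)             ≡⟨ exchange (suc e) e (suc e ^ j) ⟩
  e * suc e ^ suc j                   ∎
  where
  open ≤-Reasoning
  expand : ∀ e j x → e * x * (e + suc j) + x * j ≡ suc e * (x * (e + j))
  expand = solve-∀
  exchange : ∀ a b c → a * (b * c) ≡ b * (a * c)
  exchange = solve-∀

-- By Bernoulli's inequality (1 + 2/e)^e is at least 2, so `s = e * r` gains a factor `2 ^ r`. The
-- number `y` absorbs `C` and the coefficients, and `r = y * suc d` leaves one factor `2 ^ y` for it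
-- after the `d`-th power has been paid.
poly≤exp : ∀ e d C → 1 ≤ e → ∃ λ s → C * suc s ^ d * e ^ s ≤ (e + 2) ^ s
poly≤exp e d C 1≤e = e * r , (begin
  C * suc (e * r) ^ d * e ^ (e * r)             ≤⟨ *-monoˡ-≤ (e ^ (e * r)) poly ⟩
  2 ^ r * e ^ (e * r)                           ≡⟨ cong (2 ^ r *_) (^-*-assoc e e r) ⟨
  2 ^ r * (e ^ e) ^ r                           ≡⟨ ^-distribʳ-* 2 (e ^ e) r ⟨
  (2 * e ^ e) ^ r                               ≤⟨ ^-monoˡ-≤ r double ⟩
  ((e + 2) ^ e) ^ r                             ≡⟨ ^-*-assoc (e + 2) e r ⟩
  (e + 2) ^ (e * r)                             ∎)
  where
  open ≤-Reasoning
  y = C * (e * suc d) ^ d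
  r = y * suc d
  instance
    e≢0 : NonZero e
    e≢0 = >-nonZero 1≤e
  double : 2 * e ^ e ≤ (e + 2) ^ e
  double = ≤-trans (*-cancelˡ-≤ e (begin
    e * (2 * e ^ e)         ≡⟨ rearrange e (e ^ e) ⟩
    e ^ e * (e + e)         ≤⟨ bernoulli e e ⟩
    e * suc e ^ e           ∎)) (^-monoˡ-≤ e (≤-trans (n≤1+n (suc e)) (≤-reflexive (+-comm 2 e))))
    where
    rearrange : ∀ a b → a * (2 * b) ≡ b * (a + a)
    rearrange = solve-∀
  linear : suc (e * r) ≤ e * suc d * 2 ^ y
  linear = begin
    suc (e * (y * suc d))            ≡⟨ +-comm 1 (e * (y * suc d)) ⟩
    e * (y * suc d) + 1              ≤⟨ +-monoʳ-≤ (e * (y * suc d)) (*-mono-≤ 1≤e (s≤s (z≤n {d}))) ⟩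
    e * (y * suc d) + e * suc d      ≡⟨ factor e y (suc d) ⟩
    e * suc d * suc y                ≤⟨ *-monoʳ-≤ (e * suc d) (n<2^n y) ⟩
    e * suc d * 2 ^ y                ∎
    where
    factor : ∀ e y d → e * (y * d) + e * d ≡ e * d * suc y
    factor = solve-∀
  poly : C * suc (e * r) ^ d ≤ 2 ^ r
  poly = begin
    C * suc (e * r) ^ d              ≤⟨ *-monoʳ-≤ C (^-monoˡ-≤ d linear) ⟩
    C * (e * suc d * 2 ^ y) ^ d      ≡⟨ cong (C *_) (^-distribʳ-* (e * suc d) (2 ^ y) d) ⟩
    C * ((e * suc d) ^ d * (2 ^ y) ^ d) ≡⟨ *-assoc C _ _ ⟨
    y * (2 ^ y) ^ d                  ≤⟨ *-monoˡ-≤ ((2 ^ y) ^ d) (<⇒≤ (n<2^n y)) ⟩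
    (2 ^ y) ^ suc d                  ≡⟨ ^-*-assoc 2 y (suc d) ⟩
    2 ^ r                            ∎

-- `s` makes the exponential gain of a density above 1/2 beat the polynomial bound on `sauer`, with
-- a factor 2 to spare in `base`. The power `2 ^ t` of that factor then swallows `C₀`, which does
-- not depend on `t`.
few-parameters : ∀ e d → 1 ≤ e → ∃ λ s → ∃ λ t →
  8 * κ e s (suc t) * ((2 ^ s) ^ sauer s d * sauer s d ^ suc t) ≤ (2 ^ s) ^ suc t * λ′ e s (suc t)
few-parameters e d 1≤e with poly≤exp e d (8 * e) 1≤e
... | s , le = s , C₀ , (begin
  8 * κ e s t * ((2 ^ s) ^ g * g ^ t)                         ≡⟨ cong (λ z → 8 * (z * (2 * (2 * e) ^ s) ^ t) * ((2 ^ s) ^ g * g ^ t)) (^-distribˡ-+-* (2 * e) s t) ⟩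
  8 * ((2 * e) ^ s * (2 * e) ^ t * (2 * (2 * e) ^ s) ^ t) * ((2 ^ s) ^ g * g ^ t)
    ≡⟨ regroup ((2 * e) ^ s) ((2 * e) ^ t) ((2 * (2 * e) ^ s) ^ t) ((2 ^ s) ^ g) (g ^ t) ⟩
  C₀ * ((2 * e) ^ t * (2 * (2 * e) ^ s) ^ t * g ^ t)          ≡⟨ cong (C₀ *_) (trans (cong (_* g ^ t) (sym (^-distribʳ-* (2 * e) _ t))) (sym (^-distribʳ-* (2 * e * (2 * (2 * e) ^ s)) g t))) ⟩
  C₀ * b₀ ^ t                                                 ≤⟨ *-monoˡ-≤ (b₀ ^ t) (≤-trans (<⇒≤ (n<2^n C₀)) (^-monoʳ-≤ 2 (n≤1+n C₀))) ⟩
  2 ^ t * b₀ ^ t                                              ≡⟨ ^-distribʳ-* 2 b₀ t ⟨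
  (2 * b₀) ^ t                                                ≤⟨ ^-monoˡ-≤ t base ⟩
  (2 ^ s * (e + 2) ^ s) ^ t                                   ≡⟨ ^-distribʳ-* (2 ^ s) ((e + 2) ^ s) t ⟩
  (2 ^ s) ^ t * λ′ e s t                                      ∎)
  where
  open ≤-Reasoning
  g = sauer s d
  C₀ = 8 * (2 * e) ^ s * (2 ^ s) ^ g
  t = suc C₀
  b₀ = 2 * e * (2 * (2 * e) ^ s) * g
  regroup : ∀ a b c x y → 8 * (a * b * c) * (x * y) ≡ 8 * a * x * (b * c * y)
  regroup = solve-∀
  base : 2 * b₀ ≤ 2 ^ s * (e + 2) ^ s
  base = begin
    2 * (2 * e * (2 * (2 * e) ^ s) * g)        ≤⟨ *-monoʳ-≤ 2 (*-monoʳ-≤ (2 * e * (2 * (2 * e) ^ s)) (sauer≤ s d)) ⟩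
    2 * (2 * e * (2 * (2 * e) ^ s) * suc s ^ d) ≡⟨ cong (λ z → 2 * (2 * e * (2 * z) * suc s ^ d)) (^-distribʳ-* 2 e s) ⟩
    2 * (2 * e * (2 * (2 ^ s * e ^ s)) * suc s ^ d) ≡⟨ shuffle e (2 ^ s) (e ^ s) (suc s ^ d) ⟩
    2 ^ s * (8 * e * suc s ^ d * e ^ s)        ≤⟨ *-monoʳ-≤ (2 ^ s) le ⟩
    2 ^ s * (e + 2) ^ s                        ∎
    where
    shuffle : ∀ e a b c → 2 * (2 * e * (2 * (a * b)) * c) ≡ a * (8 * e * c * b)
    shuffle = solve-∀

λ′-positive : ∀ e s t → 1 ≤ λ′ e s t
λ′-positive e s t = m^n>0 ((e + 2) ^ s) {{m^n≢0 (e + 2) s {{>-nonZero (≤-trans (s≤s z≤n) (m≤n+m 2 e))}}}} t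

-- The factor 8 is 2 · 2 · 2: from the doubled `κ` in the conditions of `dense-cycle`, from the
-- halved budget in `markov`, and from the clashes, which `N` forces to cost no more than is allowed
-- to the generic tuples.
good-orientation-with : ∀ k m (3≤k : 3 ≤ k) e d s t′ u → e ≡ (4 + k) * suc m → 16 * (e * e) ≤ d →
  8 * κ e s (suc t′) * ((2 ^ s) ^ sauer s d * sauer s d ^ suc t′) ≤ (2 ^ s) ^ suc t′ * λ′ e s (suc t′) →
  8 * κ e s (suc t′) * (2 * e * e) ^ u * (2 * (2 * e * (2 * e))) ^ u < d ^ u * λ′ e s (suc t′) →
  ∃ λ N → ∀ n (CS : CycleSystem k n) i₀ → N ≤ n →
  ∃ λ b → ∀ S → IsTransversal (Orientation.tour CS i₀ 3≤k b) k S → m * (n * n) ≤ suc m * (4 * length S)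
good-orientation-with k m 3≤k e d s t′ u e≡ e²≤d fewness skewness = N , build
  where
  t = suc t′
  p = s + t
  K = κ e s t
  Λ = λ′ e s t
  h = p + u
  B₁ = p * p * p * suc k
  B₂ = h * h * h * suc k
  Z = 2 * e * e
  few-N : ℕ
  few-N = (2 ^ s) ^ sauer s d * sauer s d ^ t
  N = (3 * e + 2) + (8 * K * B₁ + 8 * K * Z ^ u * B₂)
  1≤Λ : 1 ≤ Λ
  1≤Λ = λ′-positive e s t
  build : ∀ n (CS : CycleSystem k n) i₀ → N ≤ n →
    ∃ λ b → ∀ S → IsTransversal (Orientation.tour CS i₀ 3≤k b) k S → m * (n * n) ≤ suc m * (4 * length S)
  build n CS i₀ N≤n = conclude (markov f g (Λ * n ^ p) (Λ * n ^ h) (*-mono-≤ 1≤Λ (m^n>0 n p)) (*-mono-≤ 1≤Λ (m^n>0 n h)) f-small g-small)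
    where
    open ≤-Reasoning
    open Orientation CS i₀ 3≤k
    open FirstMoment CS i₀ 3≤k
    𝔹 = bitVecs L
    f g : Vec Bool L → ℕ
    f b = 2 * K * fewCount (tour b) d s t
    g b = 2 * K * (Z ^ u * skewMoment (tour b) d (2 * e) s t u)
    3e≤n : 3 * e + 2 ≤ n
    3e≤n = ≤-trans (m≤m+n _ _) N≤n
    B₁≤n : 8 * K * B₁ ≤ n
    B₁≤n = ≤-trans (≤-trans (m≤m+n _ _) (m≤n+m _ (3 * e + 2))) N≤n
    B₂≤n : 8 * K * Z ^ u * B₂ ≤ n
    B₂≤n = ≤-trans (≤-trans (m≤n+m _ (8 * K * B₁)) (m≤n+m _ (3 * e + 2))) N≤n
    instance
      n≢0 : NonZero n
      n≢0 = >-nonZero (≤-trans (m≤n+m 1 (3 * e + 1)) (≤-trans (≤-reflexive (+-assoc (3 * e) 1 1)) 3e≤n))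
    f-small : 2 * ∑ 𝔹 f ≤ 2 ^ L * (Λ * n ^ p)
    f-small = *-cancelˡ-≤ (2 * (n * (2 ^ s) ^ t)) {{m*n≢0 2 (n * (2 ^ s) ^ t) {{_}} {{m*n≢0 n ((2 ^ s) ^ t) {{n≢0}} {{m^n≢0 (2 ^ s) t {{m^n≢0 2 s}}}}}}}} (begin
      2 * (n * R) * (2 * ∑ 𝔹 f)                                            ≡⟨ cong (λ z → 2 * (n * R) * (2 * z)) (∑-*ˡ 𝔹 (2 * K) _) ⟩
      2 * (n * R) * (2 * (2 * K * ∑ 𝔹 F))                                  ≡⟨ pull n R K (∑ 𝔹 F) ⟩
      8 * K * (n * (R * ∑ 𝔹 F))                                            ≤⟨ *-monoʳ-≤ (8 * K) (few-moment d s t) ⟩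
      8 * K * (2 ^ L * (n ^ p * (n * few-N + R * B₁)))                     ≡⟨ spread (8 * K) (2 ^ L) (n ^ p) n few-N R B₁ ⟩
      2 ^ L * n ^ p * (n * (8 * K * few-N) + R * (8 * K * B₁))             ≤⟨ *-monoʳ-≤ (2 ^ L * n ^ p) (+-mono-≤ (*-monoʳ-≤ n fewness) (*-monoʳ-≤ R (≤-trans B₁≤n (m≤m*n n Λ {{>-nonZero 1≤Λ}})))) ⟩
      2 ^ L * n ^ p * (n * (R * Λ) + R * (n * Λ))                          ≡⟨ collect (2 ^ L) (n ^ p) n R Λ ⟩
      2 * (n * R) * (2 ^ L * (Λ * n ^ p))                                  ∎)
      where
      R = (2 ^ s) ^ t
      F : Vec Bool L → ℕ
      F b = fewCount (tour b) d s t
      pull : ∀ n R K x → 2 * (n * R) * (2 * (2 * K * x)) ≡ 8 * K * (n * (R * x))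
      pull = solve-∀
      spread : ∀ K l m n x R B → K * (l * (m * (n * x + R * B))) ≡ l * m * (n * (K * x) + R * (K * B))
      spread = solve-∀
      collect : ∀ l m n R Λ → l * m * (n * (R * Λ) + R * (n * Λ)) ≡ 2 * (n * R) * (l * (Λ * m))
      collect = solve-∀
    g-small : 2 * ∑ 𝔹 g < 2 ^ L * (Λ * n ^ h)
    g-small = *-cancelˡ-< (2 * (n * d ^ u)) _ _ (begin-strict
      2 * (n * d ^ u) * (2 * ∑ 𝔹 g)                                        ≡⟨ cong (λ z → 2 * (n * d ^ u) * (2 * z)) (trans (∑-*ˡ 𝔹 (2 * K) _) (cong (2 * K *_) (∑-*ˡ 𝔹 (Z ^ u) _))) ⟩
      2 * (n * d ^ u) * (2 * (2 * K * (Z ^ u * ∑ 𝔹 G)))                    ≡⟨ pull n (d ^ u) K (Z ^ u) (∑ 𝔹 G) ⟩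
      8 * K * Z ^ u * (n * (d ^ u * ∑ 𝔹 G))                                ≤⟨ *-monoʳ-≤ (8 * K * Z ^ u) (skew-moment d (2 * e) s t u) ⟩
      8 * K * Z ^ u * (2 ^ L * (n ^ h * (n * Y + d ^ u * B₂)))             ≡⟨ spread (8 * K * Z ^ u) (2 ^ L) (n ^ h) n Y (d ^ u) B₂ ⟩
      2 ^ L * n ^ h * (n * (8 * K * Z ^ u * Y) + d ^ u * (8 * K * Z ^ u * B₂)) <⟨ *-monoʳ-< (2 ^ L * n ^ h) {{m*n≢0 (2 ^ L) (n ^ h) {{m^n≢0 2 L}} {{m^n≢0 n h}}}}
                                                                              (+-mono-<-≤ (*-monoʳ-< n skewness) (*-monoʳ-≤ (d ^ u) (≤-trans B₂≤n (m≤m*n n Λ {{>-nonZero 1≤Λ}})))) ⟩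
      2 ^ L * n ^ h * (n * (d ^ u * Λ) + d ^ u * (n * Λ))                  ≡⟨ collect (2 ^ L) (n ^ h) n (d ^ u) Λ ⟩
      2 * (n * d ^ u) * (2 ^ L * (Λ * n ^ h))                              ∎)
      where
      Y = (2 * (2 * e * (2 * e))) ^ u
      G : Vec Bool L → ℕ
      G b = skewMoment (tour b) d (2 * e) s t u
      pull : ∀ n R K z x → 2 * (n * R) * (2 * (2 * K * (z * x))) ≡ 8 * K * z * (n * (R * x))
      pull = solve-∀
      spread : ∀ K l m n x R B → K * (l * (m * (n * x + R * B))) ≡ l * m * (n * (K * x) + R * (K * B))
      spread = solve-∀
      collect : ∀ l m n R Λ → l * m * (n * (R * Λ) + R * (n * Λ)) ≡ 2 * (n * R) * (l * (Λ * m))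
      collect = solve-∀
    conclude : (∃ λ b → f b ≤ Λ * n ^ p × g b < Λ * n ^ h) →
      ∃ λ b → ∀ S → IsTransversal (tour b) k S → m * (n * n) ≤ suc m * (4 * length S)
    conclude (b , c₁ , c₂) = b , transversal-lower (tour b) (tour-tournament b) k m e d s t′ u e≡ 3≤k e²≤d 3e≤n c₁ c₂

-- Each of the `u` vertices contributes the Chebyshev factor 8e²/d and a loss 2e², as only n/(2e²)
-- skewed vertices are guaranteed. Taking `d` as twice the product 16e⁴ makes every further moment
-- halve the estimate, and `u = 8 * K` suffices because `8 * K < 2 ^ u`.
skew-parameter : ∀ e K Λ → 1 ≤ e → 1 ≤ Λ → ∃ λ u →
  8 * K * (2 * e * e) ^ u * (2 * (2 * e * (2 * e))) ^ u < (2 * (16 * (e * e * (e * e)))) ^ u * Λ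
skew-parameter e K Λ 1≤e 1≤Λ = u , (begin-strict
  8 * K * Z ^ u * Y ^ u                                ≡⟨ *-assoc (8 * K) (Z ^ u) _ ⟩
  8 * K * (Z ^ u * Y ^ u)                              ≡⟨ cong (8 * K *_) (trans (sym (^-distribʳ-* Z Y u)) (cong (_^ u) (sixteen e))) ⟩
  8 * K * W ^ u                                        <⟨ *-monoˡ-< (W ^ u) {{m^n≢0 W u {{>-nonZero (*-mono-≤ {1} {16} (s≤s z≤n) (*-mono-≤ (*-mono-≤ 1≤e 1≤e) (*-mono-≤ 1≤e 1≤e)))}}}} (n<2^n u) ⟩
  2 ^ u * W ^ u                                        ≡⟨ ^-distribʳ-* 2 W u ⟨
  (2 * W) ^ u                                          ≤⟨ m≤m*n ((2 * W) ^ u) Λ {{>-nonZero 1≤Λ}} ⟩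
  (2 * W) ^ u * Λ                                      ∎)
  where
  open ≤-Reasoning
  u = 8 * K
  Z = 2 * e * e
  Y = 2 * (2 * e * (2 * e))
  W = 16 * (e * e * (e * e))
  sixteen : ∀ e → 2 * e * e * (2 * (2 * e * (2 * e))) ≡ 16 * (e * e * (e * e))
  sixteen = solve-∀

good-orientation : ∀ k m (3≤k : 3 ≤ k) → ∃ λ N → ∀ n (CS : CycleSystem k n) i₀ → N ≤ n →
  ∃ λ b → ∀ S → IsTransversal (Orientation.tour CS i₀ 3≤k b) k S → m * (n * n) ≤ suc m * (4 * length S)
good-orientation k m 3≤k = choose ((4 + k) * suc m) refl
  where
  choose : ∀ e → e ≡ (4 + k) * suc m → ∃ λ N → ∀ n (CS : CycleSystem k n) i₀ → N ≤ n →
    ∃ λ b → ∀ S → IsTransversal (Orientation.tour CS i₀ 3≤k b) k S → m * (n * n) ≤ suc m * (4 * length S)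
  choose e e≡ =
    let d = 2 * (16 * (e * e * (e * e)))
        s , t , fewness = few-parameters e d 1≤e
        u , skewness    = skew-parameter e (κ e s (suc t)) (λ′ e s (suc t)) 1≤e (λ′-positive e s (suc t))
    in good-orientation-with k m 3≤k e d s t u e≡ e²≤d fewness skewness
    where
    1≤e : 1 ≤ e
    1≤e = subst (1 ≤_) (sym e≡) (s≤s z≤n)
    e²≤d : 16 * (e * e) ≤ 2 * (16 * (e * e * (e * e)))
    e²≤d = ≤-trans (*-monoʳ-≤ 16 (m≤m*n (e * e) (e * e) {{>-nonZero (*-mono-≤ 1≤e 1≤e)}})) (m≤n*m _ 2)

-- Residues

module Residues (N-1 : ℕ) where

  private
    N = suc N-1

  infix 4 _≈_
  record _≈_ (x y : ℕ) : Set where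
    constructor mod
    field unmod : x % N ≡ y % N

  ≡⇒≈ : ∀ {x y} → x ≡ y → x ≈ y
  ≡⇒≈ refl = mod refl

  ≈-sym : ∀ {x y} → x ≈ y → y ≈ x
  ≈-sym (mod eq) = mod (sym eq)

  ≈-trans : ∀ {x y z} → x ≈ y → y ≈ z → x ≈ z
  ≈-trans (mod eq) (mod eq′) = mod (trans eq eq′)

  +-cong-≈ : ∀ {x y} z → x ≈ y → x + z ≈ y + z
  +-cong-≈ {x} {y} z (mod eq) = mod (trans (%-distribˡ-+ x z N) (trans (cong (λ r → (r + z % N) % N) eq) (sym (%-distribˡ-+ y z N))))

  multiple : ∀ x c → x + c * N ≈ x
  multiple x c = mod ([m+kn]%n≡m%n x c N)

  +N : ∀ x → x + N ≈ x
  +N x = mod ([m+n]%n≡m%n x N)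

  -- Multiplication by `N-1` is negation modulo `N`, so adding `z * N-1` undoes adding `z`.
  +-cancel-≈ : ∀ {x y} z → x + z ≈ y + z → x ≈ y
  +-cancel-≈ {x} {y} z eq = ≈-trans (≈-sym (undo x)) (≈-trans (+-cong-≈ (z * N-1) eq) (undo y))
    where
    undo : ∀ x → x + z + z * N-1 ≈ x
    undo x = ≈-trans (≡⇒≈ (trans (+-assoc x z (z * N-1)) (cong (x +_) (sym (*-suc z N-1))))) (multiple x z)

  residue : ℕ → Fin N
  residue x = fromℕ< (m%n<n x N)

  residue-cong : ∀ {x y} → x ≈ y → residue x ≡ residue y
  residue-cong {x} {y} (mod eq) = Fin.toℕ-injective (trans (Fin.toℕ-fromℕ< (m%n<n x N)) (trans eq (sym (Fin.toℕ-fromℕ< (m%n<n y N)))))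

  residue⁻ : ∀ {x y} → residue x ≡ residue y → x ≈ y
  residue⁻ {x} {y} eq = mod (trans (sym (Fin.toℕ-fromℕ< (m%n<n x N))) (trans (cong toℕ eq) (Fin.toℕ-fromℕ< (m%n<n y N))))

  toℕ-residue : ∀ x → toℕ (residue x) ≈ x
  toℕ-residue x = mod (trans (cong (_% N) (Fin.toℕ-fromℕ< (m%n<n x N))) (m%n%n≡m%n x N))

  residue-toℕ : ∀ a → residue (toℕ a) ≡ a
  residue-toℕ a = Fin.toℕ-injective (trans (Fin.toℕ-fromℕ< (m%n<n (toℕ a) N)) (m<n⇒m%n≡m (Fin.toℕ<n a)))

  ≈⇒≡ : ∀ {x y} → x < N → y < N → x ≈ y → x ≡ y
  ≈⇒≡ x< y< (mod eq) = trans (sym (m<n⇒m%n≡m x<)) (trans eq (m<n⇒m%n≡m y<))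

  residue-injective : ∀ t {o o′} → o < N → o′ < N → residue (t + o) ≡ residue (t + o′) → o ≡ o′
  residue-injective t {o} {o′} o< o′< eq = ≈⇒≡ o< o′<
    (+-cancel-≈ t (≈-trans (≡⇒≈ (+-comm o t)) (≈-trans (residue⁻ {t + o} {t + o′} eq) (≡⇒≈ (+-comm t o′)))))

  -- The translation is a - o₁, the negative again being a multiple of `N-1`. An edge of a base
  -- cycle, once developed, therefore covers every pair with the same difference.
  translate : ∀ (a b : Fin N) o₁ o₂ → toℕ a + o₂ ≈ toℕ b + o₁ →
              ∃ λ (t : Fin N) → residue (toℕ t + o₁) ≡ a × residue (toℕ t + o₂) ≡ b
  translate a b o₁ o₂ eq = t
    , trans (residue-cong (≈-trans (shift o₁) (≈-trans (≡⇒≈ (back (toℕ a))) (multiple (toℕ a) o₁)))) (residue-toℕ a)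
    , trans (residue-cong (≈-trans (shift o₂) (≈-trans (≡⇒≈ (exchange (toℕ a) o₂)) (≈-trans (+-cong-≈ (o₁ * N-1) eq)
        (≈-trans (≡⇒≈ (trans (sym (exchange (toℕ b) o₁)) (back (toℕ b)))) (multiple (toℕ b) o₁)))))) (residue-toℕ b)
    where
    t = residue (toℕ a + o₁ * N-1)
    shift : ∀ o → toℕ t + o ≈ toℕ a + o₁ * N-1 + o
    shift o = +-cong-≈ o (toℕ-residue (toℕ a + o₁ * N-1))
    back : ∀ x → x + o₁ * N-1 + o₁ ≡ x + o₁ * N
    back x = trans (+-assoc x (o₁ * N-1) o₁) (cong (x +_) (trans (+-comm (o₁ * N-1) o₁) (sym (*-suc o₁ N-1))))
    exchange : ∀ x o → x + o₁ * N-1 + o ≡ x + o + o₁ * N-1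
    exchange x o = trans (+-assoc x _ o) (trans (cong (x +_) (+-comm _ o)) (sym (+-assoc x o _)))

  Diff : Fin N → Fin N → ℕ → Set
  Diff a b D = toℕ a + D ≈ toℕ b

  difference : ∀ (a b : Fin N) → ∃ λ D → D < N × Diff a b D
  difference a b = X % N , m%n<n X N ,
    ≈-trans (≡⇒≈ (+-comm (toℕ a) (X % N))) (≈-trans (+-cong-≈ (toℕ a) (mod {X % N} {X} (m%n%n≡m%n X N)))
    (≈-trans (≡⇒≈ (trans (+-assoc (toℕ b) _ _) (cong (toℕ b +_) (trans (+-comm _ (toℕ a)) (sym (*-suc (toℕ a) N-1))))))
    (multiple (toℕ b) (toℕ a))))
    where X = toℕ b + toℕ a * N-1

  difference-0 : ∀ {a b} → Diff a b 0 → a ≡ b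
  difference-0 {a} {b} eq = trans (sym (residue-toℕ a)) (trans (residue-cong (≈-trans (≡⇒≈ (sym (+-identityʳ (toℕ a)))) eq)) (residue-toℕ b))

  difference-back : ∀ {a b D D′} → D + D′ ≡ N → Diff a b D → Diff b a D′
  difference-back {a} {b} {D} {D′} sum eq = ≈-trans (+-cong-≈ D′ (≈-sym eq)) (≈-trans (≡⇒≈ (trans (+-assoc (toℕ a) D D′) (cong (toℕ a +_) sum))) (+N (toℕ a)))

  translate-diff : ∀ {a b D} o₁ o₂ → Diff a b D → o₁ + D ≈ o₂ →
                   ∃ λ (t : Fin N) → residue (toℕ t + o₁) ≡ a × residue (toℕ t + o₂) ≡ b
  translate-diff {a} {b} {D} o₁ o₂ diff eq = translate a b o₁ o₂
    (≈-trans (≡⇒≈ (+-comm (toℕ a) o₂)) (≈-trans (+-cong-≈ (toℕ a) (≈-sym eq))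
    (≈-trans (≡⇒≈ (rotate o₁ D (toℕ a))) (+-cong-≈ o₁ diff))))
    where
    rotate : ∀ x y z → x + y + z ≡ z + y + x
    rotate = solve-∀

-- Alternating sequences

alt : (ℕ → A) → (ℕ → A) → ℕ → A
alt f g 0             = f 0
alt f g 1             = g 0
alt f g (suc (suc i)) = alt (f ∘ suc) (g ∘ suc) i

alt-even : ∀ (f g : ℕ → A) i → alt f g (i * 2) ≡ f i
alt-even f g zero    = refl
alt-even f g (suc i) = alt-even (f ∘ suc) (g ∘ suc) i

alt-odd : ∀ (f g : ℕ → A) i → alt f g (suc (i * 2)) ≡ g i
alt-odd f g zero    = refl
alt-odd f g (suc i) = alt-odd (f ∘ suc) (g ∘ suc) i

data Half : ℕ → Set where
  even : ∀ i → Half (i * 2)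
  odd  : ∀ i → Half (suc (i * 2))

half : ∀ n → Half n
half zero = even 0
half (suc n) with half n
... | even i = odd i
... | odd i  = even (suc i)

half-< : ∀ {i m} → i * 2 < m * 2 → i < m
half-< {i} {m} lt = *-cancelʳ-< 2 i m lt

half-<-odd : ∀ {i m} → suc (i * 2) < m * 2 → i < m
half-<-odd lt = half-< (<-trans (n<1+n _) lt)

alt-injective : ∀ {f g : ℕ → A} {m} → (∀ {i j} → i < m → j < m → f i ≡ f j → i ≡ j) →
  (∀ {i j} → i < m → j < m → g i ≡ g j → i ≡ j) → (∀ {i j} → i < m → j < m → f i ≢ g j) →
  ∀ {i j} → i < m * 2 → j < m * 2 → alt f g i ≡ alt f g j → i ≡ j
alt-injective {f = f} {g} {m} ff gg fg {i} {j} i< j< eq with half i | half j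
... | even a | even b = cong (_* 2) (ff (half-< i<) (half-< j<) (trans (sym (alt-even f g a)) (trans eq (alt-even f g b))))
... | odd a  | odd b  = cong (λ c → suc (c * 2)) (gg (half-<-odd i<) (half-<-odd j<) (trans (sym (alt-odd f g a)) (trans eq (alt-odd f g b))))
... | even a | odd b  = contradiction (trans (sym (alt-even f g a)) (trans eq (alt-odd f g b))) (fg (half-< i<) (half-<-odd j<))
... | odd a  | even b = contradiction (trans (sym (alt-even f g b)) (trans (sym eq) (alt-odd f g a))) (fg (half-< j<) (half-<-odd i<))

unique-applyUpTo : ∀ {v : ℕ → A} {m} → (∀ {i j} → i < m → j < m → v i ≡ v j → i ≡ j) → Unique (applyUpTo v m)
unique-applyUpTo inj = Unique.applyUpTo⁺₁ _ _ (λ i<j j<m eq → <⇒≢ i<j (inj (<-trans i<j j<m) j<m eq))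

-- Covered pairs, numbering of the vertices and families of translates

Joined : List (List A) → A → A → Set
Joined cs u v = ∃ λ c → c ∈ cs × ((u , v) ∈ closedWalk c ⊎ (v , u) ∈ closedWalk c)

joined-sym : ∀ {cs : List (List A)} {u v} → Joined cs u v → Joined cs v u
joined-sym (c , c∈ , inj₁ p) = c , c∈ , inj₂ p
joined-sym (c , c∈ , inj₂ p) = c , c∈ , inj₁ p

module _ {c d : ℕ} where

  encode : Maybe (Fin c × Fin d) → Fin (suc (c * d))
  encode nothing        = zero
  encode (just (x , a)) = suc (Fin.combine x a)

  decode : Fin (suc (c * d)) → Maybe (Fin c × Fin d)
  decode zero    = nothing
  decode (suc i) = just (Fin.remQuot d i)

  decode-encode : ∀ v → decode (encode v) ≡ v
  decode-encode nothing        = refl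
  decode-encode (just (x , a)) = cong just (Fin.remQuot-combine x a)

  encode-decode : ∀ i → encode (decode i) ≡ i
  encode-decode zero    = refl
  encode-decode (suc i) = cong suc (Fin.combine-remQuot {c} d i)

  encodeSystem : ∀ {k} (cs : List (List (Maybe (Fin c × Fin d)))) → All (λ C → length C ≡ k) cs → All Unique cs →
    (∀ u v → u ≢ v → Joined cs u v) → 2 * (k * length cs) ≡ suc (c * d) * (c * d) → CycleSystem k (suc (c * d))
  encodeSystem {k} cs size distinct cover count = record
    { cycles   = map (map encode) cs
    ; size     = All.map⁺ (All.map (λ {C} eq → trans (length-map encode C) eq) size)
    ; distinct = All.map⁺ (All.map (Unique.map⁺ encode-injective) distinct)
    ; cover    = λ u v u≢v → let C , C∈ , p = cover (decode u) (decode v) (u≢v ∘ decode-injective) in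
                   map encode C , ∈-map⁺ (map encode) C∈ , transport u v C p
    ; count    = trans (cong (λ l → 2 * (k * l)) (length-map (map encode) cs)) count
    }
    where
    encode-injective : ∀ {u v} → encode u ≡ encode v → u ≡ v
    encode-injective {u} {v} eq = trans (sym (decode-encode u)) (trans (cong decode eq) (decode-encode v))
    decode-injective : ∀ {u v} → decode u ≡ decode v → u ≡ v
    decode-injective {u} {v} eq = trans (sym (encode-decode u)) (trans (cong encode eq) (encode-decode v))
    arc : ∀ u v C → (decode u , decode v) ∈ closedWalk C → (u , v) ∈ closedWalk (map encode C)
    arc u v C p = subst ((u , v) ∈_) (sym (closedWalk-map encode C))
      (subst (_∈ map (Prod.map encode encode) (closedWalk C)) (cong₂ _,_ (encode-decode u) (encode-decode v)) (∈-map⁺ (Prod.map encode encode) p))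
    transport : ∀ u v C → (decode u , decode v) ∈ closedWalk C ⊎ (decode v , decode u) ∈ closedWalk C →
                (u , v) ∈ closedWalk (map encode C) ⊎ (v , u) ∈ closedWalk (map encode C)
    transport u v C (inj₁ p) = inj₁ (arc u v C p)
    transport u v C (inj₂ p) = inj₂ (arc v u C p)

length-concatMap : ∀ (h : A → List B) xs {l} → (∀ x → length (h x) ≡ l) → length (concatMap h xs) ≡ length xs * l
length-concatMap h []       eq = refl
length-concatMap h (x ∷ xs) eq = trans (length-++ (h x)) (cong₂ _+_ (eq x) (length-concatMap h xs eq))

length-translates : ∀ {m} (h : Fin m → B) → length (map h (allFin m)) ≡ m
length-translates {m = m} h = trans (length-map h (allFin m)) (length-tabulate {n = m} id)

All-concatMap : ∀ {P : B → Set} (h : A → List B) xs → (∀ x → x ∈ xs → All P (h x)) → All P (concatMap h xs)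
All-concatMap h []       all = []
All-concatMap h (x ∷ xs) all = All.++⁺ (all x (here refl)) (All-concatMap h xs (λ y y∈ → all y (there y∈)))

All-translates : ∀ {P : B → Set} {m} (h : Fin m → B) → (∀ t → P (h t)) → All P (map h (allFin m))
All-translates {m = m} h all = All.map⁺ {xs = allFin m} (All.tabulate (λ {t} _ → all t))

-- Cycle systems for even k: the vertices are a point at infinity and r groups ℤ_{4p}, where k = 2p.
-- One zigzag base cycle, developed inside each group extended by the point at infinity and between
-- any two groups, represents each difference d or its mirror image 4p - 1 - d.

upper lower : ℕ → ℕ → ℕ → ℕ → ℕ
upper p q J i = p + i + (if does (i <? q) then 0 else J)
lower p q J i = p ∸ i

-- The first index is that of the lower point. `flat` and `down` are the steps of the zigzag lower
-- 0, upper 0, lower 1, upper 1, ..., and `close` joins its last upper point to its first lower one.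
data Edge (p : ℕ) : ℕ → ℕ → Set where
  flat  : ∀ {i} → i < p → Edge p i i
  down  : ∀ {i} → suc i < p → Edge p (suc i) i
  close : ∀ {i} → suc i ≡ p → Edge p 0 i

record Zig (p q J D : ℕ) : Set where
  field
    {top bottom} : ℕ
    edge         : Edge p bottom top
    differs      : upper p q J top ≡ lower p q J bottom + D ⊎ upper p q J top + suc D ≡ lower p q J bottom + p * 4

upper-< : ∀ p q J {i} → i < q → upper p q J i ≡ p + i
upper-< p q J {i} i<q rewrite dec-true (i <? q) i<q = +-identityʳ (p + i)

upper-≥ : ∀ p q J {i} → q ≤ i → upper p q J i ≡ p + i + J
upper-≥ p q J {i} q≤i rewrite dec-false (i <? q) (≤⇒≯ q≤i) = refl

-- Before the jump the steps realise 0, ..., 2q - 1. After it, flat steps have the difference 2i + J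
-- and down steps 2i + 1 + J; with J = 2p + 1 - 2q these are the mirror images of the remaining even
-- differences and of the remaining odd ones below 2p - 1. The closing edge has the difference 3p -
-- 2q, which is 2p - 1 or its mirror image 2p for the two choices of `q`.
zigzag-small : ∀ p q J → q < p → J + (q + q) ≡ suc (p + p) → q + q ≡ p ⊎ q + q ≡ suc p →
               ∀ d → d < p * 2 → Zig p q J d
zigzag-small p q J q<p Jeq choice d d< with half d
zigzag-small p q J q<p Jeq choice .(δ * 2) d< | even δ with δ <? q | half-< {δ} {p} d<
... | yes δ<q | δ<p = record { edge = flat δ<p ; differs = inj₁ (trans (upper-< p q J δ<q) (sym (begin
    p ∸ δ + δ * 2         ≡⟨ cong (p ∸ δ +_) (twice δ) ⟩
    p ∸ δ + (δ + δ)       ≡⟨ +-assoc (p ∸ δ) δ δ ⟨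
    p ∸ δ + δ + δ         ≡⟨ cong (_+ δ) (m∸n+n≡m (<⇒≤ δ<p)) ⟩
    p + δ                 ∎))) }
  where
  open ≡-Reasoning
  twice : ∀ x → x * 2 ≡ x + x
  twice = solve-∀
... | no δ≮q | δ<p with m≤n⇒∃[o]m+o≡n (≮⇒≥ δ≮q) | m≤n⇒∃[o]m+o≡n δ<p
...   | a , refl | c , refl = record { edge = flat (≤-trans (m≤m+n (suc (q + c)) a) (≤-reflexive (reorder q a c))) ; differs = inj₂ (begin
    upper (suc (q + a) + c) q J (q + c) + suc ((q + a) * 2)           ≡⟨ cong (_+ suc ((q + a) * 2)) (upper-≥ (suc (q + a) + c) q J (m≤m+n q c)) ⟩
    suc (q + a) + c + (q + c) + J + suc ((q + a) * 2)                 ≡⟨ cong (λ J → suc (q + a) + c + (q + c) + J + suc ((q + a) * 2)) J≡ ⟩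
    suc (q + a) + c + (q + c) + (3 + 2 * a + 2 * c) + suc ((q + a) * 2) ≡⟨ final q a c ⟩
    suc a + (suc (q + a) + c) * 4                                     ≡⟨ cong (_+ (suc (q + a) + c) * 4) (sym (trans (cong (_∸ (q + c)) (rest q a c)) (m+n∸m≡n (q + c) (suc a)))) ⟩
    suc (q + a) + c ∸ (q + c) + (suc (q + a) + c) * 4                 ∎) }
  where
  open ≡-Reasoning
  reorder : ∀ q a c → suc (q + c) + a ≡ suc (q + a) + c
  reorder = solve-∀
  rest : ∀ q a c → suc (q + a) + c ≡ (q + c) + suc a
  rest = solve-∀
  expand : ∀ q a c → suc (suc (q + a) + c + (suc (q + a) + c)) ≡ 3 + 2 * a + 2 * c + (q + q)
  expand = solve-∀
  J≡ : J ≡ 3 + 2 * a + 2 * c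
  J≡ = +-cancelʳ-≡ (q + q) _ _ (trans Jeq (expand q a c))
  final : ∀ q a c → suc (q + a) + c + (q + c) + (3 + 2 * a + 2 * c) + suc ((q + a) * 2) ≡ suc a + (suc (q + a) + c) * 4
  final = solve-∀
zigzag-small p q J q<p Jeq choice .(suc (δ * 2)) d< | odd δ with δ <? q | m≤n⇒m<n∨m≡n (half-<-odd {δ} {p} d<)
... | yes δ<q | _ = record { edge = down (≤-<-trans δ<q q<p) ; differs = inj₁ (trans (upper-< p q J δ<q) (sym (begin
    p ∸ suc δ + suc (δ * 2)         ≡⟨ cong (p ∸ suc δ +_) (twice δ) ⟩
    p ∸ suc δ + (suc δ + δ)         ≡⟨ +-assoc (p ∸ suc δ) (suc δ) δ ⟨
    p ∸ suc δ + suc δ + δ           ≡⟨ cong (_+ δ) (m∸n+n≡m (≤-trans δ<q (<⇒≤ q<p))) ⟩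
    p + δ                           ∎))) }
  where
  open ≡-Reasoning
  twice : ∀ x → suc (x * 2) ≡ suc x + x
  twice = solve-∀
... | no δ≮q | inj₁ δ<p-1 with m≤n⇒∃[o]m+o≡n (≮⇒≥ δ≮q) | m≤n⇒∃[o]m+o≡n δ<p-1
...   | a , refl | c , refl = record { edge = down (≤-trans (m≤m+n (suc (suc (q + c))) a) (≤-reflexive (reorder q a c))) ; differs = inj₂ (begin
    upper P q J (q + c) + suc (suc ((q + a) * 2))                     ≡⟨ cong (_+ suc (suc ((q + a) * 2))) (upper-≥ P q J (m≤m+n q c)) ⟩
    P + (q + c) + J + suc (suc ((q + a) * 2))                         ≡⟨ cong (λ J → P + (q + c) + J + suc (suc ((q + a) * 2))) J≡ ⟩
    P + (q + c) + (5 + 2 * a + 2 * c) + suc (suc ((q + a) * 2))       ≡⟨ final q a c ⟩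
    suc a + P * 4                                                     ≡⟨ cong (_+ P * 4) (sym (trans (cong (_∸ suc (q + c)) (rest q a c)) (m+n∸m≡n (suc (q + c)) (suc a)))) ⟩
    P ∸ suc (q + c) + P * 4                                           ∎) }
  where
  open ≡-Reasoning
  P = suc (suc (q + a)) + c
  reorder : ∀ q a c → suc (suc (q + c)) + a ≡ suc (suc (q + a)) + c
  reorder = solve-∀
  rest : ∀ q a c → suc (suc (q + a)) + c ≡ suc (q + c) + suc a
  rest = solve-∀
  expand : ∀ q a c → suc (suc (suc (q + a)) + c + (suc (suc (q + a)) + c)) ≡ 5 + 2 * a + 2 * c + (q + q)
  expand = solve-∀
  J≡ : J ≡ 5 + 2 * a + 2 * c
  J≡ = +-cancelʳ-≡ (q + q) _ _ (trans Jeq (expand q a c))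
  final : ∀ q a c → suc (suc (q + a)) + c + (q + c) + (5 + 2 * a + 2 * c) + suc (suc ((q + a) * 2)) ≡ suc a + (suc (suc (q + a)) + c) * 4
  final = solve-∀
zigzag-small p q J q<p Jeq choice .(suc (δ * 2)) d< | odd δ | no δ≮q | inj₂ refl = record { edge = close refl ; differs = closing choice }
  where
  open ≡-Reasoning
  closing : q + q ≡ suc δ ⊎ q + q ≡ suc (suc δ) →
    upper (suc δ) q J δ ≡ suc δ + suc (δ * 2) ⊎ upper (suc δ) q J δ + suc (suc (δ * 2)) ≡ suc δ + suc δ * 4
  closing (inj₁ eq) = inj₂ (begin
    upper (suc δ) q J δ + suc (suc (δ * 2))      ≡⟨ cong (_+ suc (suc (δ * 2))) (upper-≥ (suc δ) q J (≮⇒≥ δ≮q)) ⟩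
    suc δ + δ + J + suc (suc (δ * 2))            ≡⟨ cong (λ J → suc δ + δ + J + suc (suc (δ * 2))) J≡ ⟩
    suc δ + δ + suc (suc δ) + suc (suc (δ * 2))  ≡⟨ final δ ⟩
    suc δ + suc δ * 4                            ∎)
    where
    shift : ∀ δ → suc (suc δ + suc δ) ≡ suc (suc δ) + suc δ
    shift = solve-∀
    J≡ : J ≡ suc (suc δ)
    J≡ = +-cancelʳ-≡ (suc δ) _ _ (trans (cong (J +_) (sym eq)) (trans Jeq (shift δ)))
    final : ∀ δ → suc δ + δ + suc (suc δ) + suc (suc (δ * 2)) ≡ suc δ + suc δ * 4
    final = solve-∀
  closing (inj₂ eq) = inj₁ (begin
    upper (suc δ) q J δ                          ≡⟨ upper-≥ (suc δ) q J (≮⇒≥ δ≮q) ⟩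
    suc δ + δ + J                                ≡⟨ cong (suc δ + δ +_) J≡ ⟩
    suc δ + δ + suc δ                            ≡⟨ final δ ⟩
    suc δ + suc (δ * 2)                          ∎)
    where
    shift : ∀ δ → suc (suc δ + suc δ) ≡ suc δ + suc (suc δ)
    shift = solve-∀
    J≡ : J ≡ suc δ
    J≡ = +-cancelʳ-≡ (suc (suc δ)) _ _ (trans (cong (J +_) (sym eq)) (trans Jeq (shift δ)))
    final : ∀ δ → suc δ + δ + suc δ ≡ suc δ + suc (δ * 2)
    final = solve-∀

-- The two alternatives of `differs` are exchanged when D is replaced by 4p - 1 - D, so the upper
-- half of the range follows from the lower one.
zigzag : ∀ p q J → q < p → J + (q + q) ≡ suc (p + p) → q + q ≡ p ⊎ q + q ≡ suc p → ∀ D → D < p * 4 → Zig p q J D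
zigzag p q J q<p Jeq choice D D< with D <? p * 2
... | yes small = zigzag-small p q J q<p Jeq choice D small
... | no large with m≤n⇒∃[o]m+o≡n D<
...   | d , sum = mirror (zigzag-small p q J q<p Jeq choice d d<)
  where
  four : ∀ p → p * 4 ≡ p * 2 + p * 2
  four = solve-∀
  d< : d < p * 2
  d< = +-cancelˡ-< (p * 2) _ _ (≤-<-trans (+-monoˡ-≤ d (≮⇒≥ large)) (≤-trans (≤-reflexive sum) (≤-reflexive (four p))))
  mirror : Zig p q J d → Zig p q J D
  mirror z = record { edge = Zig.edge z ; differs = flip (Zig.differs z) }
    where
    u = upper p q J (Zig.top z)
    l = lower p q J (Zig.bottom z)
    flip : u ≡ l + d ⊎ u + suc d ≡ l + p * 4 → u ≡ l + D ⊎ u + suc D ≡ l + p * 4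
    flip (inj₁ eq) = inj₂ (trans (cong (_+ suc D) eq) (trans (+-assoc l d (suc D)) (cong (l +_) (trans (+-comm d (suc D)) sum))))
    flip (inj₂ eq) = inj₁ (+-cancelʳ-≡ (suc d) _ _ (trans eq (trans (cong (l +_) (trans (sym sum) (sym (+-suc D d)))) (sym (+-assoc l D (suc d))))))

alternate-arc : ∀ (f g : ℕ → A) p {i j} → Edge (suc p) j i →
  let c = applyUpTo (alt f g) (suc p * 2) in (f j , g i) ∈ closedWalk c ⊎ (g i , f j) ∈ closedWalk c
alternate-arc f g p {i} (flat (s≤s i≤p)) = inj₁ (subst₂ (λ u v → (u , v) ∈ closedWalk (applyUpTo (alt f g) (suc p * 2)))
  (alt-even f g i) (alt-odd f g i) (walk-applyUpTo (alt f g) (suc (p * 2)) (f 0) (s≤s (*-monoˡ-≤ 2 i≤p))))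
alternate-arc f g p {i} (down (s≤s i<p)) = inj₂ (subst₂ (λ u v → (u , v) ∈ closedWalk (applyUpTo (alt f g) (suc p * 2)))
  (alt-odd f g i) (alt-even f g (suc i)) (walk-applyUpTo (alt f g) (suc (p * 2)) (f 0) (s≤s (≤-trans (n≤1+n _) (*-monoˡ-≤ 2 i<p)))))
alternate-arc f g p {i} (close refl) = inj₂ (subst (λ u → (u , f 0) ∈ closedWalk (applyUpTo (alt f g) (suc p * 2)))
  (alt-odd f g p) (walk-applyUpTo-last (alt f g) (suc (p * 2)) (f 0)))

module EvenSystem (p′ q J r : ℕ) (1≤q : 1 ≤ q) (q<p : q < suc p′) (Jeq : J + (q + q) ≡ suc (suc p′ + suc p′))
                  (choice : q + q ≡ suc p′ ⊎ q + q ≡ suc (suc p′)) where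

  private
    p = suc p′
    module Z  = Residues (3 + p′ * 4)
    module Z⁺ = Residues (p * 4)

    Vertex : Set
    Vertex = Maybe (Fin r × Fin (p * 4))

    lo hi : ℕ → ℕ
    lo = lower p q J
    hi = upper p q J

    2≤p : 2 ≤ p
    2≤p = ≤-trans (s≤s 1≤q) q<p

    J≤ : J ≤ suc p
    J≤ = +-cancelʳ-≤ p _ _ (≤-trans (+-monoʳ-≤ J (low choice)) (≤-reflexive Jeq))
      where
      low : q + q ≡ p ⊎ q + q ≡ suc p → p ≤ q + q
      low (inj₁ eq) = ≤-reflexive (sym eq)
      low (inj₂ eq) = ≤-trans (n≤1+n p) (≤-reflexive (sym eq))

    hi< : ∀ {i} → i < p → suc (hi i) < p * 4
    hi< {i} i<p = begin-strict
      suc (hi i)                ≤⟨ s≤s (+-monoʳ-≤ (p + i) (jump≤ (does (i <? q)))) ⟩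
      suc (p + i + J)           ≤⟨ s≤s (+-monoʳ-≤ (p + i) J≤) ⟩
      suc (p + i + suc p)       ≡⟨ reorder p i ⟩
      suc i + (p + p) + 1       <⟨ +-mono-≤-< (+-monoˡ-≤ (p + p) i<p) 2≤p ⟩
      p + (p + p) + p           ≡⟨ four p ⟩
      p * 4                     ∎
      where
      open ≤-Reasoning
      jump≤ : ∀ b → (if b then 0 else J) ≤ J
      jump≤ true  = z≤n
      jump≤ false = ≤-refl
      reorder : ∀ p i → suc (p + i + suc p) ≡ suc i + (p + p) + 1
      reorder = solve-∀
      four : ∀ p → p + (p + p) + p ≡ p * 4
      four = solve-∀

    lo≤ : ∀ i → lo i ≤ p
    lo≤ i = m∸n≤m p i

    p<4p : p < p * 4
    p<4p = m<m*n p 4 (s≤s (s≤s z≤n))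

    lo-injective : ∀ {i j} → i < p → j < p → lo i ≡ lo j → i ≡ j
    lo-injective {i} {j} i< j< eq = trans (sym (m∸[m∸n]≡n (<⇒≤ i<))) (trans (cong (p ∸_) eq) (m∸[m∸n]≡n (<⇒≤ j<)))

    hi-injective : ∀ {i j} → i < p → j < p → hi i ≡ hi j → i ≡ j
    hi-injective {i} {j} _ _ eq = go (i <? q) (j <? q)
      where
      cross : ∀ {i j} → i < q → q ≤ j → hi i ≢ hi j
      cross {i} {j} i<q q≤j eq = <⇒≢ (≤-trans (≤-trans i<q q≤j) (m≤m+n j J))
        (+-cancelˡ-≡ p _ _ (trans (sym (upper-< p q J i<q)) (trans eq (trans (upper-≥ p q J q≤j) (+-assoc p j J)))))
      go : Dec (i < q) → Dec (j < q) → i ≡ j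
      go (yes i<q) (yes j<q) = +-cancelˡ-≡ p _ _ (trans (sym (upper-< p q J i<q)) (trans eq (upper-< p q J j<q)))
      go (no i≮q)  (no j≮q)  = +-cancelˡ-≡ p _ _ (+-cancelʳ-≡ J _ _ (trans (sym (upper-≥ p q J (≮⇒≥ i≮q))) (trans eq (upper-≥ p q J (≮⇒≥ j≮q)))))
      go (yes i<q) (no j≮q)  = contradiction eq (cross i<q (≮⇒≥ j≮q))
      go (no i≮q)  (yes j<q) = contradiction (sym eq) (cross j<q (≮⇒≥ i≮q))

    inGroup : Fin r → Fin (suc (p * 4)) → Vertex
    inGroup g zero    = nothing
    inGroup g (suc a) = just (g , a)

    inGroup-injective : ∀ g {a b} → inGroup g a ≡ inGroup g b → a ≡ b
    inGroup-injective g {zero}  {zero}  eq = refl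
    inGroup-injective g {suc a} {suc b} refl = refl

    -- Within a group the upper offsets are raised by 1, and between two groups by ε ∈ {0 , 1}.
    innerLo innerHi : Fin r → Fin (suc (p * 4)) → ℕ → Vertex
    innerLo g t i = inGroup g (Z⁺.residue (toℕ t + lo i))
    innerHi g t i = inGroup g (Z⁺.residue (toℕ t + suc (hi i)))

    inner : Fin r → Fin (suc (p * 4)) → List Vertex
    inner g t = applyUpTo (alt (innerLo g t) (innerHi g t)) (p * 2)

    outerLo outerHi : (g h : Fin r) (ε : ℕ) → Fin (p * 4) → ℕ → Vertex
    outerLo g h ε t i = just (g , Z.residue (toℕ t + lo i))
    outerHi g h ε t i = just (h , Z.residue (toℕ t + (ε + hi i)))

    outer : (g h : Fin r) (ε : ℕ) → Fin (p * 4) → List Vertex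
    outer g h ε t = applyUpTo (alt (outerLo g h ε t) (outerHi g h ε t)) (p * 2)

    outers : Fin r × Fin r → List (List Vertex)
    outers (g , h) = map (outer g h 0) (allFin (p * 4)) ++ map (outer h g 1) (allFin (p * 4))

    inners cross system : List (List Vertex)
    inners = concatMap (λ g → map (inner g) (allFin (suc (p * 4)))) (allFin r)
    cross  = concatMap outers (pairs (allFin r))
    system = inners ++ cross

    inner-unique : ∀ g t → Unique (inner g t)
    inner-unique g t = unique-applyUpTo (alt-injective
      (λ {i} {j} i< j< eq → lo-injective i< j< (Z⁺.residue-injective (toℕ t) (lo< i) (lo< j) (inGroup-injective g eq)))
      (λ {i} {j} i< j< eq → hi-injective i< j< (suc-injective (Z⁺.residue-injective (toℕ t) (m<n⇒m<1+n (hi< i<)) (m<n⇒m<1+n (hi< j<)) (inGroup-injective g eq))))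
      (λ {i} {j} i< j< eq → <⇒≢ (≤-trans (s≤s (lo≤ i)) (s≤s (≤-trans (m≤m+n p j) (m≤m+n (p + j) _))))
        (Z⁺.residue-injective (toℕ t) (lo< i) (m<n⇒m<1+n (hi< j<)) (inGroup-injective g eq))))
      where
      lo< : ∀ i → lo i < suc (p * 4)
      lo< i = s≤s (≤-trans (lo≤ i) (<⇒≤ p<4p))

    outer-unique : ∀ {g h} ε t → ε ≤ 1 → g ≢ h → Unique (outer g h ε t)
    outer-unique {g} {h} ε t ε≤1 g≢h = unique-applyUpTo (alt-injective
      (λ {i} {j} i< j< eq → lo-injective i< j< (Z.residue-injective (toℕ t) (≤-<-trans (lo≤ i) p<4p) (≤-<-trans (lo≤ j) p<4p) (level eq)))
      (λ {i} {j} i< j< eq → hi-injective i< j< (+-cancelˡ-≡ ε _ _ (Z.residue-injective (toℕ t) (εhi< i<) (εhi< j<) (level eq))))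
      (λ i< j< eq → g≢h (group eq)))
      where
      εhi< : ∀ {i} → i < p → ε + hi i < p * 4
      εhi< {i} i< = ≤-<-trans (+-monoˡ-≤ (hi i) ε≤1) (hi< i<)
      level : ∀ {g h : Fin r} {a b : Fin (p * 4)} → _≡_ {A = Vertex} (just (g , a)) (just (h , b)) → a ≡ b
      level refl = refl
      group : ∀ {g h : Fin r} {a b : Fin (p * 4)} → _≡_ {A = Vertex} (just (g , a)) (just (h , b)) → g ≡ h
      group refl = refl

    inner∈ : ∀ g t → inner g t ∈ system
    inner∈ g t = ∈-++⁺ˡ (∈-concatMap (∈-allFin g) (∈-map⁺ (inner g) (∈-allFin t)))

    outer₀∈ : ∀ {g h} t → (g , h) ∈ pairs (allFin r) → outer g h 0 t ∈ system
    outer₀∈ {g} {h} t gh = ∈-++⁺ʳ inners (∈-concatMap gh (∈-++⁺ˡ (∈-map⁺ (outer g h 0) (∈-allFin t))))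

    outer₁∈ : ∀ {g h} t → (g , h) ∈ pairs (allFin r) → outer h g 1 t ∈ system
    outer₁∈ {g} {h} t gh = ∈-++⁺ʳ inners (∈-concatMap gh (∈-++⁺ʳ (map (outer g h 0) (allFin (p * 4))) (∈-map⁺ (outer h g 1) (∈-allFin t))))

    -- Modulo 4p + 1 the raised difference D + 1 and its raised mirror image 4p - D are negatives of
    -- each other, so the mirror case covers the same pair in the other order. This is why the upper
    -- offsets are raised by 1.
    cover-inner : ∀ g a b → a ≢ b → Joined system (inGroup g a) (inGroup g b)
    cover-inner g a b a≢b with Z⁺.difference a b
    ... | zero  , _        , diff = contradiction (Z⁺.difference-0 {a} {b} diff) a≢b
    ... | suc D , s≤s D<4p , diff with m≤n⇒∃[o]m+o≡n D<4p
    ...   | D′ , sum with zigzag p q J q<p Jeq choice D D<4p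
    ...     | record { top = i ; bottom = j ; edge = e ; differs = inj₁ eq } with Z⁺.translate-diff {a} {b} (lo j) (suc (hi i)) diff (Z⁺.≡⇒≈ (trans (+-suc (lo j) D) (cong suc (sym eq))))
    ...       | t , refl , refl = inner g t , inner∈ g t , alternate-arc (innerLo g t) (innerHi g t) p′ e
    cover-inner g a b a≢b | suc D , s≤s D<4p , diff | D′ , sum
            | record { top = i ; bottom = j ; edge = e ; differs = inj₂ eq } with Z⁺.translate-diff {b} {a} (lo j) (suc (hi i))
                (Z⁺.difference-back {a} {b} {D = suc D} {D′ = suc D′} (trans (+-suc (suc D) D′) (cong suc sum)) diff) (Z⁺.≡⇒≈ offset)
      where
      offset : lo j + suc D′ ≡ suc (hi i)
      offset = +-cancelʳ-≡ (suc D) _ _ (begin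
        lo j + suc D′ + suc D        ≡⟨ reorder (lo j) D′ (suc D) ⟩
        suc (lo j + (suc D + D′))    ≡⟨ cong (λ x → suc (lo j + x)) sum ⟩
        suc (lo j + p * 4)           ≡⟨ cong suc eq ⟨
        suc (hi i) + suc D           ∎)
        where
        open ≡-Reasoning
        reorder : ∀ l x y → l + suc x + y ≡ suc (l + (y + x))
        reorder = solve-∀
    ...       | t , refl , refl = joined-sym (inner g t , inner∈ g t , alternate-arc (innerLo g t) (innerHi g t) p′ e)

    -- Raised by 1 and read from `h` to `g`, the mirror image 4p - 1 - D becomes -D modulo 4p. So
    -- `outer g h 0` and `outer h g 1` share the differences between the two groups.
    cover-outer : ∀ {g h} a b → (g , h) ∈ pairs (allFin r) → Joined system (just (g , a)) (just (h , b))
    cover-outer {g} {h} a b gh with Z.difference a b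
    ... | D , D<4p , diff with m≤n⇒∃[o]m+o≡n D<4p | zigzag p q J q<p Jeq choice D D<4p
    ...   | D′ , sum | record { top = i ; bottom = j ; edge = e ; differs = inj₁ eq } with Z.translate-diff {a} {b} (lo j) (hi i) diff (Z.≡⇒≈ (sym eq))
    ...     | t , refl , refl = outer g h 0 t , outer₀∈ t gh , alternate-arc (outerLo g h 0 t) (outerHi g h 0 t) p′ e
    cover-outer {g} {h} a b gh | D , D<4p , diff | D′ , sum | record { top = i ; bottom = j ; edge = e ; differs = inj₂ eq } with Z.translate-diff {b} {a} (lo j) (suc (hi i))
                (Z.difference-back {a} {b} {D = D} {D′ = suc D′} (trans (+-suc D D′) sum) diff) (Z.≡⇒≈ offset)
      where
      offset : lo j + suc D′ ≡ suc (hi i)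
      offset = +-cancelʳ-≡ D _ _ (begin
        lo j + suc D′ + D            ≡⟨ reorder (lo j) D′ D ⟩
        lo j + (suc D + D′)          ≡⟨ cong (lo j +_) sum ⟩
        lo j + p * 4                 ≡⟨ eq ⟨
        hi i + suc D                 ≡⟨ +-suc (hi i) D ⟩
        suc (hi i) + D               ∎)
        where
        open ≡-Reasoning
        reorder : ∀ l x y → l + suc x + y ≡ l + (suc y + x)
        reorder = solve-∀
    ...     | t , refl , refl = joined-sym (outer h g 1 t , outer₁∈ t gh , alternate-arc (outerLo h g 1 t) (outerHi h g 1 t) p′ e)

    cover : ∀ u v → u ≢ v → Joined system u v
    cover nothing        nothing        u≢v = contradiction refl u≢v
    cover nothing        (just (h , b)) u≢v = cover-inner h zero (suc b) (λ ())
    cover (just (g , a)) nothing        u≢v = cover-inner g (suc a) zero (λ ())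
    cover (just (g , a)) (just (h , b)) u≢v with g Fin.≟ h
    ... | yes refl = cover-inner g (suc a) (suc b) (λ { refl → u≢v refl })
    ... | no g≢h with ∈-pairs (∈-allFin g) (∈-allFin h) g≢h
    ...   | inj₁ gh = cover-outer a b gh
    ...   | inj₂ hg = joined-sym (cover-outer b a hg)

    length-system : 2 * (p * 2 * length system) ≡ suc (r * (p * 4)) * (r * (p * 4))
    length-system = begin
      2 * (p * 2 * length system)                                      ≡⟨ cong (λ l → 2 * (p * 2 * l)) (trans (length-++ inners) (cong₂ _+_ len-inners len-cross)) ⟩
      2 * (p * 2 * (r * suc (p * 4) + P * (p * 4 + p * 4)))            ≡⟨ expand p r P ⟩
      p * 4 * (r * suc (p * 4) + p * 4 * (2 * P))                      ≡⟨ cong (λ x → p * 4 * (r * suc (p * 4) + p * 4 * x)) double ⟩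
      p * 4 * (r * suc (p * 4) + p * 4 * (r * (r ∸ 1)))                ≡⟨ triangle r ⟩
      suc (r * (p * 4)) * (r * (p * 4))                                ∎
      where
      open ≡-Reasoning
      P = length (pairs (allFin r))
      double : 2 * P ≡ r * (r ∸ 1)
      double = trans (length-pairs (allFin r)) (cong (λ l → l * (l ∸ 1)) (length-tabulate {n = r} id))
      len-inners : length inners ≡ r * suc (p * 4)
      len-inners = trans (length-concatMap _ (allFin r) (λ g → length-translates (inner g))) (cong (_* suc (p * 4)) (length-tabulate {n = r} id))
      len-cross : length cross ≡ P * (p * 4 + p * 4)
      len-cross = length-concatMap outers (pairs (allFin r)) (λ (g , h) →
        trans (length-++ (map (outer g h 0) (allFin (p * 4)))) (cong₂ _+_ (length-translates (outer g h 0)) (length-translates (outer h g 1))))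
      expand : ∀ p r P → 2 * (p * 2 * (r * suc (p * 4) + P * (p * 4 + p * 4))) ≡ p * 4 * (r * suc (p * 4) + p * 4 * (2 * P))
      expand = solve-∀
      triangle : ∀ r → p * 4 * (r * suc (p * 4) + p * 4 * (r * (r ∸ 1))) ≡ suc (r * (p * 4)) * (r * (p * 4))
      triangle zero    = trans (cong (p * 4 *_) (*-zeroʳ (p * 4))) (*-zeroʳ (p * 4))
      triangle (suc r) = step (p * 4) r
        where
        step : ∀ x r → x * (suc r * suc x + x * (suc r * r)) ≡ suc (suc r * x) * (suc r * x)
        step = solve-∀

  evenSystem : CycleSystem (p * 2) (suc (r * (p * 4)))
  evenSystem = encodeSystem system
    (All.++⁺ (All-concatMap _ (allFin r) (λ g _ → All-translates (inner g) (λ t → length-applyUpTo (alt (innerLo g t) (innerHi g t)) (p * 2))))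
             (All-concatMap outers (pairs (allFin r)) (λ (g , h) _ → All.++⁺ (All-translates (outer g h 0) (λ t → outer-length g h 0 t))
                                                                              (All-translates (outer h g 1) (λ t → outer-length h g 1 t)))))
    (All.++⁺ (All-concatMap _ (allFin r) (λ g _ → All-translates (inner g) (inner-unique g)))
             (All-concatMap outers (pairs (allFin r)) (λ (g , h) gh →
               All.++⁺ (All-translates (outer g h 0) (λ t → outer-unique 0 t z≤n (pairs-≢ (Unique.allFin⁺ r) gh)))
                       (All-translates (outer h g 1) (λ t → outer-unique 1 t ≤-refl (pairs-≢ (Unique.allFin⁺ r) gh ∘ sym))))))
    cover length-system
    where
    outer-length : ∀ g h ε t → length (outer g h ε t) ≡ p * 2
    outer-length g h ε t = length-applyUpTo (alt (outerLo g h ε t) (outerHi g h ε t)) (p * 2)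

-- Cycle systems for odd k = 2M + 3, generalising Skolem's triple systems: the vertices are a point at infinity
-- and 2r columns ℤ_k, and the apex of the cycles on the columns x and y lies in the column x ∘ y,
-- where ∘ is a half-idempotent commutative quasigroup.

module HalfIdempotent (r′ : ℕ) where

  r : ℕ
  r = suc r′

  open Residues (r′ + suc r′)

  -- Doubling modulo 2r sends both `i` and `r + i` to 2i. Coding the columns `i ↑ˡ r` and `r ↑ʳ i`
  -- as 2i and 2i + 1 turns addition into a product under which both have the square `i ↑ˡ r`.
  code : Fin (r + r) → ℕ
  code x with Fin.splitAt r x
  ... | inj₁ i = toℕ i * 2
  ... | inj₂ i = suc (toℕ i * 2)

  code-ˡ : ∀ (i : Fin r) → code (i ↑ˡ r) ≡ toℕ i * 2
  code-ˡ i rewrite Fin.splitAt-↑ˡ r i r = refl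

  code-ʳ : ∀ (i : Fin r) → code (r ↑ʳ i) ≡ suc (toℕ i * 2)
  code-ʳ i rewrite Fin.splitAt-↑ʳ r r i = refl

  data Side : Fin (r + r) → Set where
    left  : ∀ (i : Fin r) → Side (i ↑ˡ r)
    right : ∀ (i : Fin r) → Side (r ↑ʳ i)

  side : ∀ x → Side x
  side x with Fin.splitAt r x in eq
  ... | inj₁ i = subst Side (Fin.splitAt⁻¹-↑ˡ eq) (left i)
  ... | inj₂ i = subst Side (Fin.splitAt⁻¹-↑ʳ {r} eq) (right i)

  private
    twice : r + r ≡ r * 2
    twice = double r
      where
      double : ∀ r → r + r ≡ r * 2
      double = solve-∀

  *2≢1+*2 : ∀ i j → i * 2 ≢ suc (j * 2)
  *2≢1+*2 i j eq = even≢odd i j (trans (*-comm 2 i) (trans eq (cong suc (*-comm j 2))))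

  *2-injective : ∀ {i j : Fin r} → toℕ i * 2 ≡ toℕ j * 2 → i ≡ j
  *2-injective eq = Fin.toℕ-injective (*-cancelʳ-≡ _ _ 2 eq)

  code-injective : ∀ {x y} → code x ≡ code y → x ≡ y
  code-injective {x} {y} eq with side x | side y
  ... | left i  | left j  = cong (_↑ˡ r) (*2-injective (trans (sym (code-ˡ i)) (trans eq (code-ˡ j))))
  ... | right i | right j = cong (r ↑ʳ_) (*2-injective (suc-injective (trans (sym (code-ʳ i)) (trans eq (code-ʳ j)))))
  ... | left i  | right j = contradiction (trans (sym (code-ˡ i)) (trans eq (code-ʳ j))) (*2≢1+*2 (toℕ i) (toℕ j))
  ... | right i | left j  = contradiction (trans (sym (code-ˡ j)) (trans (sym eq) (code-ʳ i))) (*2≢1+*2 (toℕ j) (toℕ i))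

  code-< : ∀ x → code x < r + r
  code-< x with side x
  ... | left i  = subst₂ _<_ (sym (code-ˡ i)) (sym twice) (*-monoˡ-< 2 (Fin.toℕ<n i))
  ... | right i = subst₂ _<_ (sym (code-ʳ i)) (sym twice) (*-monoˡ-≤ 2 (Fin.toℕ<n i))

  decodeColumn : ∀ m → m < r + r → ∃ λ x → code x ≡ m
  decodeColumn m m< with half m
  ... | even i = fromℕ< i<r ↑ˡ r , trans (code-ˡ (fromℕ< i<r)) (cong (_* 2) (Fin.toℕ-fromℕ< i<r))
    where
    i<r : i < r
    i<r = half-< {i} {r} (subst (i * 2 <_) twice m<)
  ... | odd i = r ↑ʳ fromℕ< i<r , trans (code-ʳ (fromℕ< i<r)) (cong (λ j → suc (j * 2)) (Fin.toℕ-fromℕ< i<r))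
    where
    i<r : i < r
    i<r = half-<-odd {i} {r} (subst (suc (i * 2) <_) twice m<)

  infixl 7 _∘′_
  _∘′_ : Fin (r + r) → Fin (r + r) → Fin (r + r)
  x ∘′ y = proj₁ (decodeColumn (toℕ (residue (toℕ x + toℕ y))) (Fin.toℕ<n _))

  code-∘ : ∀ x y → code (x ∘′ y) ≈ toℕ x + toℕ y
  code-∘ x y = ≈-trans (≡⇒≈ (proj₂ (decodeColumn (toℕ (residue (toℕ x + toℕ y))) (Fin.toℕ<n _)))) (toℕ-residue (toℕ x + toℕ y))

  ∘-unique : ∀ x z y → toℕ x + toℕ z ≈ code y → x ∘′ z ≡ y
  ∘-unique x z y eq = code-injective (≈⇒≡ (code-< (x ∘′ z)) (code-< y) (≈-trans (code-∘ x z) eq))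

  divide : ∀ x y → ∃ λ z → toℕ x + toℕ z ≈ code y
  divide x y with difference x (residue (code y))
  ... | D , D< , diff = fromℕ< D< , ≈-trans (≡⇒≈ (cong (toℕ x +_) (Fin.toℕ-fromℕ< D<))) (≈-trans diff (toℕ-residue (code y)))

  private
    code-ˡ-< : ∀ (i : Fin r) → toℕ i * 2 < r + r
    code-ˡ-< i = subst (_< r + r) (code-ˡ i) (code-< (i ↑ˡ r))

    code-ʳ-< : ∀ (i : Fin r) → suc (toℕ i * 2) < r + r
    code-ʳ-< i = subst (_< r + r) (code-ʳ i) (code-< (r ↑ʳ i))

    double-ˡ : ∀ (j : Fin r) → toℕ j * 2 ≈ toℕ (j ↑ˡ r) + toℕ (j ↑ˡ r)
    double-ˡ j = ≡⇒≈ (sym (trans (cong (λ z → z + z) (Fin.toℕ-↑ˡ j r)) (double (toℕ j))))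
      where
      double : ∀ x → x + x ≡ x * 2
      double = solve-∀

    double-ʳ : ∀ (j : Fin r) → toℕ j * 2 ≈ toℕ (r ↑ʳ j) + toℕ (r ↑ʳ j)
    double-ʳ j = ≈-trans (≈-sym (+N (toℕ j * 2))) (≡⇒≈ (sym (trans (cong (λ z → z + z) (Fin.toℕ-↑ʳ r j)) (wrap r (toℕ j)))))
      where
      wrap : ∀ r x → (r + x) + (r + x) ≡ x * 2 + (r + r)
      wrap = solve-∀

  -- Pins down when x ∘ z = y is solved by z = x. No main cycle on two different columns is
  -- available then, and other cycles must step in.
  squares : ∀ x y → toℕ x + toℕ x ≈ code y → ∃ λ i → y ≡ i ↑ˡ r × (x ≡ i ↑ˡ r ⊎ x ≡ r ↑ʳ i)
  squares x y eq with side x | side y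
  ... | left j  | left i  = i , refl , inj₁ (cong (_↑ˡ r) (*2-injective (≈⇒≡ (code-ˡ-< j) (code-ˡ-< i) (≈-trans (double-ˡ j) (≈-trans eq (≡⇒≈ (code-ˡ i)))))))
  ... | right j | left i  = i , refl , inj₂ (cong (r ↑ʳ_) (*2-injective (≈⇒≡ (code-ˡ-< j) (code-ˡ-< i) (≈-trans (double-ʳ j) (≈-trans eq (≡⇒≈ (code-ˡ i)))))))
  ... | left j  | right i = contradiction (≈⇒≡ (code-ˡ-< j) (code-ʳ-< i) (≈-trans (double-ˡ j) (≈-trans eq (≡⇒≈ (code-ʳ i))))) (*2≢1+*2 (toℕ j) (toℕ i))
  ... | right j | right i = contradiction (≈⇒≡ (code-ˡ-< j) (code-ʳ-< i) (≈-trans (double-ʳ j) (≈-trans eq (≡⇒≈ (code-ʳ i))))) (*2≢1+*2 (toℕ j) (toℕ i))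

-- The sequence 0 , c , 1 , c - 1 , 2 , … whose consecutive differences are c , c - 1 , c - 2 , …

zz : ℕ → ℕ → ℕ
zz c = alt id (c ∸_)

zz-edge : ∀ c j → j ≤ c → zz c j + (c ∸ j) ≡ zz c (suc j) ⊎ zz c (suc j) + (c ∸ j) ≡ zz c j
zz-edge c j j≤c with half j
... | even i with m≤n⇒∃[o]m+o≡n j≤c
...   | o , refl = inj₁ (begin
  zz c (i * 2) + (c ∸ i * 2)     ≡⟨ cong₂ _+_ (alt-even id (c ∸_) i) (m+n∸m≡n (i * 2) o) ⟩
  i + o                          ≡⟨ m+n∸m≡n i (i + o) ⟨
  i + (i + o) ∸ i                ≡⟨ cong (_∸ i) (assoc i o) ⟩
  c ∸ i                          ≡⟨ alt-odd id (c ∸_) i ⟨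
  zz c (suc (i * 2))             ∎)
  where
  open ≡-Reasoning
  assoc : ∀ i o → i + (i + o) ≡ i * 2 + o
  assoc = solve-∀
zz-edge c j j≤c | odd i with m≤n⇒∃[o]m+o≡n j≤c
...   | o , refl = inj₂ (begin
  zz c (suc i * 2) + (c ∸ suc (i * 2))     ≡⟨ cong₂ _+_ (alt-even id (c ∸_) (suc i)) (m+n∸m≡n (suc (i * 2)) o) ⟩
  suc i + o                                ≡⟨ m+n∸m≡n i (suc i + o) ⟨
  i + (suc i + o) ∸ i                      ≡⟨ cong (_∸ i) (assoc i o) ⟩
  c ∸ i                                    ≡⟨ alt-odd id (c ∸_) i ⟨
  zz c (suc (i * 2))                       ∎)
  where
  open ≡-Reasoning
  assoc : ∀ i o → i + (suc i + o) ≡ suc (i * 2) + o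
  assoc = solve-∀

zz-≤ : ∀ c {j} → j ≤ c → zz c j ≤ c
zz-≤ c {j} j≤c with half j
... | even i = ≤-trans (≤-reflexive (alt-even id (c ∸_) i)) (≤-trans (m≤m*n i 2) j≤c)
... | odd i  = ≤-trans (≤-reflexive (alt-odd id (c ∸_) i)) (m∸n≤m c i)

zz-parts : ∀ c a b → a * 2 ≤ c → suc (b * 2) ≤ c → a ≢ c ∸ b
zz-parts c a b a≤ b≤ e = <-irrefl refl (begin-strict
  c + c                        ≡⟨ cong (λ x → x + x) (trans (sym (m∸n+n≡m (≤-trans (≤-trans (m≤m*n b 2) (n≤1+n _)) b≤))) (cong (_+ b) (sym e))) ⟩
  (a + b) + (a + b)            ≡⟨ regroup a b ⟩
  a * 2 + b * 2                <⟨ +-mono-≤-< a≤ b≤ ⟩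
  c + c                        ∎)
  where
  open ≤-Reasoning
  regroup : ∀ a b → (a + b) + (a + b) ≡ a * 2 + b * 2
  regroup = solve-∀

zz-injective : ∀ c {i j} → i ≤ c → j ≤ c → zz c i ≡ zz c j → i ≡ j
zz-injective c {i} {j} i≤ j≤ eq with half i | half j
... | even a | even b = cong (_* 2) {a} {b} (trans (sym (alt-even id (c ∸_) a)) (trans eq (alt-even id (c ∸_) b)))
... | odd a  | odd b  = cong (λ x → suc (x * 2)) {a} {b} (∸-cancelˡ-≡ (bound {a} i≤) (bound {b} j≤) (trans (sym (alt-odd id (c ∸_) a)) (trans eq (alt-odd id (c ∸_) b))))
  where
  bound : ∀ {a} → suc (a * 2) ≤ c → a ≤ c
  bound {a} le = ≤-trans (≤-trans (m≤m*n a 2) (n≤1+n _)) le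
... | even a | odd b  = contradiction (trans (sym (alt-even id (c ∸_) a)) (trans eq (alt-odd id (c ∸_) b))) (zz-parts c a b i≤ j≤)
... | odd a  | even b = contradiction (trans (sym (alt-even id (c ∸_) b)) (trans (sym eq) (alt-odd id (c ∸_) a))) (zz-parts c b a j≤ i≤)

module OddSystem (M r′ : ℕ) where
  open HalfIdempotent r′
  private
    k = 3 + M * 2
    module Z = Residues (2 + M * 2)

    Column : Set
    Column = Fin (r + r)

    Vertex : Set
    Vertex = Maybe (Column × Fin k)

    pt : Column → ℕ → Fin k → Vertex
    pt x o t = just (x , Z.residue (toℕ t + o))

    level : ∀ {x y : Column} {a b : Fin k} → _≡_ {A = Vertex} (just (x , a)) (just (y , b)) → a ≡ b
    level refl = refl

    column : ∀ {x y : Column} {a b : Fin k} → _≡_ {A = Vertex} (just (x , a)) (just (y , b)) → x ≡ y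
    column refl = refl

    pt-injective : ∀ {x y t o o′} → o < k → o′ < k → pt x o t ≡ pt y o′ t → o ≡ o′
    pt-injective {t = t} o< o′< eq = Z.residue-injective (toℕ t) o< o′< (level eq)

    M<k : M < k
    M<k = s≤s (≤-trans (m≤m*n M 2) (m≤n+m (M * 2) 2))

    -- The zigzag begins in column `x` and ends in column `y`, both times at offset `M`; the apex
    -- lies `suc M` above both ends.
    apexOffset : ℕ
    apexOffset = suc (M + M)

    apexOffset<k : apexOffset < k
    apexOffset<k = ≤-trans (≤-reflexive (cong (2 +_) (double M))) (n≤1+n (suc (suc (M * 2))))
      where
      double : ∀ m → m + m ≡ m * 2
      double = solve-∀

    mainX mainY : Column → Column → Fin k → ℕ → Vertex
    mainX x y t i = pt x (M ∸ i) t
    mainY x y t i = pt y i t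

    -- Between the two columns the zigzag runs through the differences -M, ..., M. The remaining
    -- residues M + 1 and -(M + 1) come from apex edges, or from the special cycles where a column
    -- meets its own square.
    mainTail main : Column → Column → Fin k → List Vertex
    mainTail x y t = applyUpTo (alt (mainX x y t) (mainY x y t)) (suc M * 2)
    main x y t = pt (x ∘′ y) apexOffset t ∷ mainTail x y t

    -- Gives the edge from path A to path B the difference M + 2 = -(M + 1), the one between
    -- `r ↑ʳ i` and its square `i ↑ˡ r` that no main cycle provides.
    special-offset : ℕ
    special-offset = zz (suc M) M + (2 + M)

    specialA specialB : Fin r → Fin k → ℕ → Vertex
    specialA i t j = pt (i ↑ˡ r) (zz (suc M) j) t
    specialB i t j = pt (r ↑ʳ i) (special-offset + zz M j) t

    special : Fin r → Fin k → List Vertex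
    special i t = nothing ∷ (applyUpTo (specialA i t) (suc M) ++ applyUpTo (specialB i t) (suc M))

    -- Path A realises the differences M + 1, ..., 2 in a left column. Difference 1 is left over,
    -- and since `k` steps of 1 close up, the whole column forms the missing cycle.
    rotation : Fin r → List Vertex
    rotation i = applyUpTo (λ j → just (i ↑ˡ r , Z.residue j)) k

    columnPairs : List (Column × Column)
    columnPairs = pairs (allFin (r + r))

    mains specials system : List (List Vertex)
    mains    = concatMap (λ (x , y) → map (main x y) (allFin k)) columnPairs
    specials = concatMap (λ i → map (special i) (allFin k)) (allFin r)
    system   = mains ++ (specials ++ map rotation (allFin r))

    main∈ : ∀ {x y} t → (x , y) ∈ columnPairs → main x y t ∈ system
    main∈ {x} {y} t xy = ∈-++⁺ˡ (∈-concatMap xy (∈-map⁺ (main x y) (∈-allFin t)))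

    special∈ : ∀ i t → special i t ∈ system
    special∈ i t = ∈-++⁺ʳ mains (∈-++⁺ˡ (∈-concatMap {h = λ i → map (special i) (allFin k)} (∈-allFin i) (∈-map⁺ (special i) (∈-allFin t))))

    rotation∈ : ∀ i → rotation i ∈ system
    rotation∈ i = ∈-++⁺ʳ mains (∈-++⁺ʳ specials (∈-map⁺ rotation (∈-allFin i)))

    main-unique : ∀ {x y} t → x ≢ y → Unique (main x y t)
    main-unique {x} {y} t x≢y = All.tabulate apex∉ ∷ unique-applyUpTo (alt-injective
      (λ {i} {j} i< j< eq → ∸-cancelˡ-≡ (s≤s⁻¹ i<) (s≤s⁻¹ j<) (pt-injective {x} {x} {t} (≤-<-trans (m∸n≤m M i) M<k) (≤-<-trans (m∸n≤m M j) M<k) eq))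
      (λ i< j< eq → pt-injective {y} {y} {t} (≤-<-trans (s≤s⁻¹ i<) M<k) (≤-<-trans (s≤s⁻¹ j<) M<k) eq)
      (λ i< j< eq → x≢y (column eq)))
      where
      M<apex : ∀ {o} → o ≤ M → o < apexOffset
      M<apex o≤M = s≤s (≤-trans o≤M (m≤m+n M M))
      apex∉ : ∀ {z} → z ∈ mainTail x y t → pt (x ∘′ y) apexOffset t ≢ z
      apex∉ z∈ refl with ∈-applyUpTo⁻ (alt (mainX x y t) (mainY x y t)) z∈
      ... | j , j< , eq with half j
      ...   | even i = <⇒≢ (M<apex (m∸n≤m M i)) (sym (pt-injective {x ∘′ y} {x} {t} apexOffset<k (≤-<-trans (m∸n≤m M i) M<k) (trans eq (alt-even (mainX x y t) (mainY x y t) i))))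
      ...   | odd i  = <⇒≢ (M<apex i≤M) (sym (pt-injective {x ∘′ y} {y} {t} apexOffset<k (≤-<-trans i≤M M<k) (trans eq (alt-odd (mainX x y t) (mainY x y t) i))))
        where
        i≤M : i ≤ M
        i≤M = s≤s⁻¹ (half-<-odd {i} {suc M} j<)

    special-unique : ∀ i t → Unique (special i t)
    special-unique i t = All.++⁺ (All.applyUpTo⁺₂ (specialA i t) (suc M) (λ _ ())) (All.applyUpTo⁺₂ (specialB i t) (suc M) (λ _ ()))
      ∷ Unique.++⁺
          (unique-applyUpTo (λ {j} {j′} j< j′< eq → zz-injective (suc M) (<⇒≤ j<) (<⇒≤ j′<)
            (pt-injective {i ↑ˡ r} {i ↑ˡ r} {t} (zz< j<) (zz< j′<) eq)))
          (unique-applyUpTo (λ {j} {j′} j< j′< eq → zz-injective M (s≤s⁻¹ j<) (s≤s⁻¹ j′<)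
            (Z.residue-injective (toℕ t + special-offset) (≤-<-trans (zz-≤ M (s≤s⁻¹ j<)) M<k) (≤-<-trans (zz-≤ M (s≤s⁻¹ j′<)) M<k)
              (trans (cong Z.residue (+-assoc (toℕ t) special-offset (zz M j))) (trans (level {r ↑ʳ i} {r ↑ʳ i} eq) (cong Z.residue (sym (+-assoc (toℕ t) special-offset (zz M j′)))))))))
          disjoint
      where
      zz< : ∀ {j} → j < suc M → zz (suc M) j < k
      zz< j< = ≤-<-trans (zz-≤ (suc M) (<⇒≤ j<)) (s≤s (s≤s (≤-trans (m≤m*n M 2) (n≤1+n _))))
      disjoint : Disjoint (applyUpTo (specialA i t) (suc M)) (applyUpTo (specialB i t) (suc M))
      disjoint (p , q) with ∈-applyUpTo⁻ (specialA i t) p | ∈-applyUpTo⁻ (specialB i t) q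
      ... | _ , _ , refl | _ , _ , eq = ↑ˡ≢↑ʳ i i (column eq)

    rotation-unique : ∀ i → Unique (rotation i)
    rotation-unique i = unique-applyUpTo (λ {j} {j′} j< j′< eq → Z.residue-injective 0 j< j′< (level {i ↑ˡ r} {i ↑ˡ r} eq))

    walkA : ∀ i t {a} → a ∈ walk (specialA i t 0) (applyUpTo (specialA i t ∘ suc) M) (specialB i t 0) → a ∈ closedWalk (special i t)
    walkA i t {a} a∈ = subst (a ∈_) (sym (walk-++ nothing (applyUpTo (specialA i t) (suc M)) (specialB i t 0) (applyUpTo (specialB i t ∘ suc) M) nothing))
      (there (∈-++⁺ˡ a∈))

    walkB : ∀ i t {a} → a ∈ walk (specialB i t 0) (applyUpTo (specialB i t ∘ suc) M) nothing → a ∈ closedWalk (special i t)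
    walkB i t {a} a∈ = subst (a ∈_) (sym (walk-++ nothing (applyUpTo (specialA i t) (suc M)) (specialB i t 0) (applyUpTo (specialB i t ∘ suc) M) nothing))
      (∈-++⁺ʳ (walk nothing (applyUpTo (specialA i t) (suc M)) (specialB i t 0)) a∈)

    cover-∞ : ∀ x b → Joined system nothing (just (x , b))
    cover-∞ x b with side x
    ... | left i with Z.translate b b 0 0 (Z.≡⇒≈ refl)
    ...   | t , refl , _ = special i t , special∈ i t , inj₁ (here refl)
    cover-∞ x b | right i with Z.translate b b (special-offset + zz M M) (special-offset + zz M M) (Z.≡⇒≈ refl)
    ...   | t , refl , _ = special i t , special∈ i t , inj₂ (walkB i t (walk-applyUpTo-last (specialB i t) M nothing))

    cover-rotation : ∀ i a b → Z.Diff a b 1 → Joined system (just (i ↑ˡ r , a)) (just (i ↑ˡ r , b))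
    cover-rotation i a b diff = rotation i , rotation∈ i , inj₁ (subst₂ (λ u v → (just (i ↑ˡ r , u) , just (i ↑ˡ r , v)) ∈ closedWalk (rotation i))
        (Z.residue-toℕ a) (trans (Z.residue-cong (Z.≈-trans (Z.≡⇒≈ (+-comm 1 (toℕ a))) diff)) (Z.residue-toℕ b)) (step (m≤n⇒m<n∨m≡n (s≤s⁻¹ (Fin.toℕ<n a)))))
      where
      f : ℕ → Vertex
      f j = just (i ↑ˡ r , Z.residue j)
      step : toℕ a < 2 + M * 2 ⊎ toℕ a ≡ 2 + M * 2 → (f (toℕ a) , f (suc (toℕ a))) ∈ closedWalk (rotation i)
      step (inj₁ a<) = walk-applyUpTo f (2 + M * 2) (f 0) a<
      step (inj₂ eq) = subst₂ (λ u v → (u , v) ∈ closedWalk (rotation i)) (cong f (sym eq))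
        (cong (λ z → just (i ↑ˡ r , z)) (Z.residue-cong (Z.≈-trans (Z.≈-sym (Z.+N 0)) (Z.≡⇒≈ (cong suc (sym eq))))))
        (walk-applyUpTo-last f (2 + M * 2) (f 0))

    step< : ∀ D → 2 ≤ D → D ≤ suc M → suc M ∸ D < M
    step< (suc (suc D)) _ (s≤s D≤) = ∸-monoʳ-< {M} {suc D} {0} (s≤s z≤n) D≤
    step< 0 () _
    step< 1 (s≤s ()) _

    cover-A : ∀ i a b D → 2 ≤ D → D ≤ suc M → Z.Diff a b D → Joined system (just (i ↑ˡ r , a)) (just (i ↑ˡ r , b))
    cover-A i a b D 2≤D D≤ diff with zz-edge (suc M) (suc M ∸ D) (m∸n≤m (suc M) D)
    ... | inj₁ eq with Z.translate-diff {a} {b} (zz (suc M) j) (zz (suc M) (suc j)) diff (Z.≡⇒≈ (trans (cong (zz (suc M) j +_) (sym (m∸[m∸n]≡n D≤))) eq))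
      where j = suc M ∸ D
    ...   | t , refl , refl = special i t , special∈ i t , inj₁ (walkA i t (walk-applyUpTo (specialA i t) M (specialB i t 0) (step< D 2≤D D≤)))
    cover-A i a b D 2≤D D≤ diff | inj₂ eq with Z.translate-diff {a} {b} (zz (suc M) (suc j)) (zz (suc M) j) diff (Z.≡⇒≈ (trans (cong (zz (suc M) (suc j) +_) (sym (m∸[m∸n]≡n D≤))) eq))
      where j = suc M ∸ D
    ...   | t , refl , refl = special i t , special∈ i t , inj₂ (walkA i t (walk-applyUpTo (specialA i t) M (specialB i t 0) (step< D 2≤D D≤)))

    cover-B : ∀ i a b D → 1 ≤ D → D ≤ M → Z.Diff a b D → Joined system (just (r ↑ʳ i , a)) (just (r ↑ʳ i , b))
    cover-B i a b D 1≤D D≤ diff with zz-edge M (M ∸ D) (m∸n≤m M D)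
    ... | inj₁ eq with Z.translate-diff {a} {b} (special-offset + zz M j) (special-offset + zz M (suc j)) diff
                         (Z.≡⇒≈ (trans (+-assoc special-offset (zz M j) D) (cong (special-offset +_) (trans (cong (zz M j +_) (sym (m∸[m∸n]≡n D≤))) eq))))
      where j = M ∸ D
    ...   | t , refl , refl = special i t , special∈ i t , inj₁ (walkB i t (walk-applyUpTo (specialB i t) M nothing (∸-monoʳ-< {M} {D} {0} 1≤D D≤)))
    cover-B i a b D 1≤D D≤ diff | inj₂ eq with Z.translate-diff {a} {b} (special-offset + zz M (suc j)) (special-offset + zz M j) diff
                         (Z.≡⇒≈ (trans (+-assoc special-offset (zz M (suc j)) D) (cong (special-offset +_) (trans (cong (zz M (suc j) +_) (sym (m∸[m∸n]≡n D≤))) eq))))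
      where j = M ∸ D
    ...   | t , refl , refl = special i t , special∈ i t , inj₂ (walkB i t (walk-applyUpTo (specialB i t) M nothing (∸-monoʳ-< {M} {D} {0} 1≤D D≤)))

    cover-AB : ∀ i a b → Z.Diff a b (suc M) → Joined system (just (r ↑ʳ i , a)) (just (i ↑ˡ r , b))
    cover-AB i a b diff with Z.translate-diff {b} {a} (zz (suc M) M) (special-offset + zz M 0) (Z.difference-back {a} {b} {suc M} {2 + M} (sum M) diff)
                               (Z.≡⇒≈ (sym (+-identityʳ special-offset)))
      where
      sum : ∀ m → suc m + (2 + m) ≡ 3 + m * 2
      sum = solve-∀
    ... | t , refl , refl = special i t , special∈ i t , inj₂ (walkA i t (walk-applyUpTo-last (specialA i t) M (specialB i t 0)))

    -- Main cycles realise the difference M + 1 between `x` and `y` at an apex, which requires `y`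
    -- to be the product of `x` with some other column `z`. Division finds `z`, and `squares` passes
    -- the case z = x on to the special cycles and rotations.
    cover-apex : ∀ x a y b → Z.Diff a b (suc M) → Joined system (just (x , a)) (just (y , b))
    cover-apex x a y b diff with divide x y
    ... | z , xz with x Fin.≟ z
    ...   | no x≢z with Z.translate-diff {a} {b} M apexOffset diff (Z.≡⇒≈ (+-suc M M)) | ∈-pairs (∈-allFin x) (∈-allFin z) x≢z
    ...     | t , refl , refl | inj₁ pair = main x z t , main∈ t pair , inj₂ (subst (λ y → (pt y apexOffset t , pt x M t) ∈ closedWalk (main x z t)) (∘-unique x z y xz) (here refl))
    ...     | t , refl , refl | inj₂ pair = main z x t , main∈ t pair , inj₁ (subst₂ (λ u v → (u , v) ∈ closedWalk (main z x t))
                (alt-odd (mainX z x t) (mainY z x t) M) (cong (λ y → pt y apexOffset t) (∘-unique z x y zx))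
                (there (walk-applyUpTo-last (alt (mainX z x t) (mainY z x t)) (suc (M * 2)) (pt (z ∘′ x) apexOffset t))))
      where
      open Residues (r′ + suc r′)
      zx : toℕ z + toℕ x ≈ code y
      zx = ≈-trans (≡⇒≈ (+-comm (toℕ z) (toℕ x))) xz
    cover-apex x a y b diff | z , xz | yes refl with squares x y xz
    ...   | i , refl , inj₂ refl = cover-AB i a b diff
    -- For M = 0 the difference M + 1 is 1 and belongs to the rotation; otherwise it is the first
    -- difference of path A.
    ...   | i , refl , inj₁ refl = diagonal M refl
      where
      diagonal : ∀ m → m ≡ M → Joined system (just (i ↑ˡ r , a)) (just (i ↑ˡ r , b))
      diagonal zero    refl = cover-rotation i a b diff
      diagonal (suc m) refl = cover-A i a b (suc M) (s≤s (s≤s z≤n)) ≤-refl diff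

    cover-pair : ∀ {x y} a b → (x , y) ∈ columnPairs → Joined system (just (x , a)) (just (y , b))
    cover-pair {x} {y} a b xy with Z.difference a b
    -- Shifted by `M`, the differences of the zigzag become 0, ..., 2M: even for equal indices of
    -- `mainX` and `mainY`, odd for the steps back. The values 2M + 1 and 2M + 2 stand for M + 1 and
    -- -(M + 1).
    ... | D , D< , diff = byOffset ((D + M) % k) (m%n<n (D + M) k) (Z.mod (sym (m%n%n≡m%n (D + M) k)))
      where
      byOffset : ∀ E → E < k → D + M Z.≈ E → Joined system (just (x , a)) (just (y , b))
      byOffset E E< eq with half E
      byOffset .(i * 2) E< eq | even i with i ≤? M
      ... | yes i≤M with Z.translate-diff {a} {b} (M ∸ i) i diff (Z.+-cancel-≈ i (Z.≈-trans (Z.≡⇒≈ (trans (shuffle (M ∸ i) D i) (cong (D +_) (m∸n+n≡m i≤M)))) (Z.≈-trans eq (Z.≡⇒≈ (double i)))))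
        where
        shuffle : ∀ m d i → m + d + i ≡ d + (m + i)
        shuffle = solve-∀
        double : ∀ i → i * 2 ≡ i + i
        double = solve-∀
      ...   | t , refl , refl = main x y t , main∈ t xy , inj₁ (subst₂ (λ u v → (u , v) ∈ closedWalk (main x y t))
                (alt-even (mainX x y t) (mainY x y t) i) (alt-odd (mainX x y t) (mainY x y t) i)
                (there (walk-applyUpTo (alt (mainX x y t) (mainY x y t)) (suc (M * 2)) (pt (x ∘′ y) apexOffset t) (s≤s (*-monoˡ-≤ 2 i≤M)))))
      byOffset .(i * 2) E< eq | even i | no i≰M = joined-sym (cover-apex y b x a back)
        where
        i≡ : i ≡ suc M
        i≡ = ≤-antisym (*-cancelʳ-≤ i (suc M) 2 (s≤s⁻¹ E<)) (≰⇒> i≰M)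
        back : Z.Diff b a (suc M)
        back = Z.≈-trans (Z.+-cong-≈ (suc M) (Z.≈-sym diff)) (Z.≈-trans (Z.≡⇒≈ (shuffle (toℕ a) D M)) (Z.≈-trans (Z.+-cong-≈ (suc (toℕ a)) eq)
          (Z.≈-trans (Z.≡⇒≈ (trans (cong (λ i → i * 2 + suc (toℕ a)) i≡) (wrap (toℕ a) M))) (Z.+N (toℕ a)))))
          where
          shuffle : ∀ a d m → a + d + suc m ≡ d + m + suc a
          shuffle = solve-∀
          wrap : ∀ a m → suc m * 2 + suc a ≡ a + (3 + m * 2)
          wrap = solve-∀
      byOffset .(suc (i * 2)) E< eq | odd i with m≤n⇒m<n∨m≡n (*-cancelʳ-≤ i M 2 (s≤s⁻¹ (s≤s⁻¹ (m<n⇒m<1+n-pred E<))))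
        where
        m<n⇒m<1+n-pred : suc (i * 2) < k → suc (suc (i * 2)) ≤ suc (suc (M * 2))
        m<n⇒m<1+n-pred (s≤s (s≤s le)) = s≤s (s≤s (even-≤ i M le))
          where
          even-≤ : ∀ i M → i * 2 ≤ suc (M * 2) → i * 2 ≤ M * 2
          even-≤ zero    M       _              = z≤n
          even-≤ (suc i) (suc M) (s≤s (s≤s le)) = s≤s (s≤s (even-≤ i M le))
          even-≤ (suc i) zero    (s≤s ())
      ... | inj₁ i<M with Z.translate-diff {a} {b} (M ∸ suc i) i diff (Z.+-cancel-≈ (suc i) (Z.≈-trans (Z.≡⇒≈ (trans (shuffle (M ∸ suc i) D (suc i)) (cong (D +_) (m∸n+n≡m i<M)))) (Z.≈-trans eq (Z.≡⇒≈ (double i)))))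
        where
        shuffle : ∀ m d i → m + d + i ≡ d + (m + i)
        shuffle = solve-∀
        double : ∀ i → suc (i * 2) ≡ i + suc i
        double = solve-∀
      ...   | t , refl , refl = main x y t , main∈ t xy , inj₂ (subst₂ (λ u v → (u , v) ∈ closedWalk (main x y t))
                (alt-odd (mainX x y t) (mainY x y t) i) (alt-even (mainX x y t) (mainY x y t) (suc i))
                (there (walk-applyUpTo (alt (mainX x y t) (mainY x y t)) (suc (M * 2)) (pt (x ∘′ y) apexOffset t) (s≤s (≤-trans (n≤1+n _) (*-monoˡ-≤ 2 i<M))))))
      byOffset .(suc (i * 2)) E< eq | odd i | inj₂ refl = cover-apex x a y b (Z.≈-trans (Z.≡⇒≈ (+-comm (toℕ a) (suc M))) (Z.≈-trans (Z.+-cong-≈ (toℕ a)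
          (Z.≈-sym (Z.+-cancel-≈ M (Z.≈-trans eq (Z.≡⇒≈ (double M)))))) (Z.≈-trans (Z.≡⇒≈ (+-comm D (toℕ a))) diff)))
        where
        double : ∀ m → suc (m * 2) ≡ suc m + m
        double = solve-∀

    cover-column : ∀ x a b D → 1 ≤ D → D ≤ suc M → Z.Diff a b D → Joined system (just (x , a)) (just (x , b))
    cover-column x a b D 1≤D D≤ diff with side x
    cover-column x a b 1             1≤D D≤ diff | left i = cover-rotation i a b diff
    cover-column x a b (suc (suc D)) 1≤D D≤ diff | left i = cover-A i a b (2 + D) (s≤s (s≤s z≤n)) D≤ diff
    cover-column x a b D             1≤D D≤ diff | right i with m≤n⇒m<n∨m≡n D≤
    ... | inj₁ D≤M  = cover-B i a b D 1≤D (s≤s⁻¹ D≤M) diff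
    ... | inj₂ refl = cover-apex (r ↑ʳ i) a (r ↑ʳ i) b diff

    cover : ∀ u v → u ≢ v → Joined system u v
    cover nothing        nothing        u≢v = contradiction refl u≢v
    cover nothing        (just (y , b)) u≢v = cover-∞ y b
    cover (just (x , a)) nothing        u≢v = joined-sym (cover-∞ x a)
    cover (just (x , a)) (just (y , b)) u≢v with x Fin.≟ y
    ... | no x≢y with ∈-pairs (∈-allFin x) (∈-allFin y) x≢y
    ...   | inj₁ xy = cover-pair a b xy
    ...   | inj₂ yx = joined-sym (cover-pair b a yx)
    cover (just (x , a)) (just (y , b)) u≢v | yes refl with Z.difference a b
    ... | zero  , _  , diff = contradiction (cong (λ c → just (x , c)) (Z.difference-0 {a} {b} diff)) u≢v
    ... | suc D , D< , diff with suc D ≤? suc M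
    ...   | yes D≤ = cover-column x a b (suc D) (s≤s z≤n) D≤ diff
    ...   | no D≰ with m≤n⇒∃[o]m+o≡n D<
    ...     | D′ , sum = joined-sym (cover-column x b a (suc D′) (s≤s z≤n) (s≤s D′≤) (Z.difference-back {a} {b} {suc D} {suc D′} (trans (+-suc (suc D) D′) sum) diff))
      where
      D′≤ : D′ ≤ M
      D′≤ = +-cancelˡ-≤ (3 + M) _ _ (≤-trans (+-monoˡ-≤ D′ (s≤s (≰⇒> D≰))) (≤-trans (≤-reflexive sum) (≤-reflexive (double M))))
        where
        double : ∀ m → 3 + m * 2 ≡ 3 + m + m
        double = solve-∀

    length-system : 2 * (k * length system) ≡ suc ((r + r) * k) * ((r + r) * k)
    length-system = begin
      2 * (k * length system)                                  ≡⟨ cong (λ l → 2 * (k * l)) (trans (length-++ mains) (cong₂ _+_ len-mains (trans (length-++ specials) (cong₂ _+_ len-specials (length-translates rotation))))) ⟩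
      2 * (k * (P * k + (r * k + r)))                          ≡⟨ expand k P r ⟩
      k * (2 * P * k + (r + r) * suc k)                        ≡⟨ cong (λ z → k * (z * k + (r + r) * suc k)) double ⟩
      k * ((r + r) * (r′ + suc r′) * k + (r + r) * suc k)      ≡⟨ final k r′ ⟩
      suc ((r + r) * k) * ((r + r) * k)                        ∎
      where
      open ≡-Reasoning
      P = length columnPairs
      double : 2 * P ≡ (r + r) * (r′ + suc r′)
      double = trans (length-pairs (allFin (r + r))) (cong (λ l → l * (l ∸ 1)) (length-tabulate {n = r + r} id))
      len-mains : length mains ≡ P * k
      len-mains = length-concatMap _ columnPairs (λ (x , y) → length-translates (main x y))
      len-specials : length specials ≡ r * k
      len-specials = trans (length-concatMap (λ i → map (special i) (allFin k)) (allFin r) (λ i → length-translates (special i))) (cong (_* k) (length-tabulate {n = r} id))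
      expand : ∀ k P r → 2 * (k * (P * k + (r * k + r))) ≡ k * (2 * P * k + (r + r) * suc k)
      expand = solve-∀
      final : ∀ k r′ → k * ((suc r′ + suc r′) * (r′ + suc r′) * k + (suc r′ + suc r′) * suc k) ≡ suc ((suc r′ + suc r′) * k) * ((suc r′ + suc r′) * k)
      final = solve-∀

  oddSystem : CycleSystem (3 + M * 2) (suc ((r + r) * (3 + M * 2)))
  oddSystem = encodeSystem system
    (All.++⁺ (All-concatMap _ columnPairs (λ (x , y) _ → All-translates (main x y) (λ t → cong suc (length-applyUpTo (alt (mainX x y t) (mainY x y t)) (suc M * 2)))))
      (All.++⁺ (All-concatMap _ (allFin r) (λ i _ → All-translates (special i) (special-length i)))
               (All-translates rotation (λ i → length-applyUpTo (λ j → just (i ↑ˡ r , Z.residue j)) k))))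
    (All.++⁺ (All-concatMap _ columnPairs (λ (x , y) xy → All-translates (main x y) (λ t → main-unique t (pairs-≢ (Unique.allFin⁺ (r + r)) xy))))
      (All.++⁺ (All-concatMap _ (allFin r) (λ i _ → All-translates (special i) (special-unique i)))
               (All-translates rotation rotation-unique)))
    cover length-system
    where
    special-length : ∀ i t → length (special i t) ≡ k
    special-length i t = cong suc (trans (length-++ (applyUpTo (specialA i t) (suc M))) (trans (cong₂ _+_ (length-applyUpTo (specialA i t) (suc M)) (length-applyUpTo (specialB i t) (suc M))) (double M)))
      where
      double : ∀ m → suc m + suc m ≡ 2 + m * 2
      double = solve-∀

-- Cycle systems of all orders 2kr + 1

cycleSystem : ∀ k r → 3 ≤ k → 1 ≤ r → CycleSystem k (suc (r * (2 * k)))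
cycleSystem k (suc r′) 3≤k _ with even-or-odd k 3≤k
... | inj₂ (j , refl) = subst₂ CycleSystem (odd-size j) (cong suc (odd-order (suc r′) j)) (OddSystem.oddSystem j r′)
  where
  odd-size : ∀ j → 3 + j * 2 ≡ 2 * j + 3
  odd-size = solve-∀
  odd-order : ∀ r j → (r + r) * (3 + j * 2) ≡ r * (2 * (2 * j + 3))
  odd-order = solve-∀
... | inj₁ (j , refl) = subst₂ CycleSystem (*-comm (suc (suc j)) 2) (cong suc (even-order (suc r′) j)) (byHalf (half (suc (suc j))) refl)
  where
  even-order : ∀ r j → r * (suc (suc j) * 4) ≡ r * (2 * (2 * suc (suc j)))
  even-order = solve-∀
  byHalf : ∀ {p} → Half p → p ≡ suc (suc j) → CycleSystem (suc (suc j) * 2) (suc (suc r′ * (suc (suc j) * 4)))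
  byHalf (even zero) ()
  -- With p = 2 + j the jump index `q` is p/2 rounded up, so J = 2p + 1 - 2q is p + 1 for even p and
  -- p for odd p.
  byHalf (even (suc i)) eq = EvenSystem.evenSystem (suc j) (suc i) (suc (suc (suc j))) (suc r′) (s≤s z≤n)
    (≤-trans (s≤s (s≤s (m≤m*n i 2))) (≤-reflexive eq)) (trans (cong (suc (suc (suc j)) +_) q+q) (shift j)) (inj₁ q+q)
    where
    double : ∀ i → suc i + suc i ≡ suc i * 2
    double = solve-∀
    q+q : suc i + suc i ≡ suc (suc j)
    q+q = trans (double i) eq
    shift : ∀ j → suc (suc (suc j)) + suc (suc j) ≡ suc (suc (suc j) + suc (suc j))
    shift = solve-∀
  byHalf (odd zero) ()
  byHalf (odd (suc i)) eq = EvenSystem.evenSystem (suc j) (suc (suc i)) (suc (suc j)) (suc r′) (s≤s z≤n)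
    (≤-trans (s≤s (s≤s (s≤s (m≤m*n i 2)))) (≤-reflexive eq)) (trans (cong (suc (suc j) +_) q+q) (+-suc (suc (suc j)) (suc (suc j)))) (inj₂ q+q)
    where
    double : ∀ i → suc (suc i) + suc (suc i) ≡ suc (suc (suc i * 2))
    double = solve-∀
    q+q : suc (suc i) + suc (suc i) ≡ suc (suc (suc j))
    q+q = trans (double i) (cong suc eq)

-- The extremal function

argmax : ∀ L (F : Vec Bool L → ℕ) → ∃ λ b → ∀ b′ → F b′ ≤ F b
argmax zero    F = [] , λ { [] → ≤-refl }
argmax (suc L) F with argmax L (λ b → F (true ∷ b)) | argmax L (λ b → F (false ∷ b))
... | b₁ , max₁ | b₀ , max₀ with ≤-total (F (true ∷ b₁)) (F (false ∷ b₀))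
...   | inj₁ le = false ∷ b₀ , λ { (true ∷ b) → ≤-trans (max₁ b) le ; (false ∷ b) → max₀ b }
...   | inj₂ le = true ∷ b₁ , λ { (true ∷ b) → max₁ b ; (false ∷ b) → ≤-trans (max₀ b) le }

module Extremal (k : ℕ) (3≤k : 3 ≤ k) where

  2≤k : 2 ≤ k
  2≤k = ≤-trans (n≤1+n 2) 3≤k

  record Indexed (n : ℕ) : Set where
    field
      system : CycleSystem k n
      index  : Fin (length (CycleSystem.cycles system))

    open Orientation system index 3≤k public

    τ : Vec Bool L → ℕ
    τ b = proj₁ (τ-exists (tour b) k 2≤k)

    τ-spec : ∀ b → IsTau (tour b) k (τ b)
    τ-spec b = proj₂ (τ-exists (tour b) k 2≤k)

    -- `good-orientation` depends on the precision `m`, whereas one function of `n` is wanted. An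
    -- orientation that maximises `τ` serves every `m` at once.
    best : Vec Bool L
    best = proj₁ (argmax L τ)

    best-max : ∀ b → τ b ≤ τ best
    best-max = proj₂ (argmax L τ)

  -- The bound 2 ≤ n makes the cycle system nonempty, so that it has a cycle to serve as `i₀`; it is
  -- also the threshold in the theorem.
  Admissible : ℕ → Set
  Admissible n = 2 ≤ n × 2 * k ∣ n ∸ 1

  admissible? : ∀ n → Dec (Admissible n)
  admissible? n = (2 ≤? n) ×-dec (2 * k ∣? n ∸ 1)

  indexed : ∀ n → Admissible n → Indexed n
  indexed (suc n) (s≤s 1≤n , divides r refl) = record { system = system ; index = fromℕ< nonempty }
    where
    1≤r : 1 ≤ r
    1≤r = n≢0⇒n>0 λ { refl → case 1≤n of λ () }
    system : CycleSystem k (suc (r * (2 * k)))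
    system = cycleSystem k r 3≤k 1≤r
    open CycleSystem system
    nonempty : 0 < length cycles
    nonempty = n≢0⇒n>0 λ eq → <⇒≢ (*-mono-≤ (s≤s (z≤n {r * (2 * k)})) 1≤n)
      (trans (sym (trans (cong (λ l → 2 * (k * l)) eq) (cong (2 *_) (*-zeroʳ k)))) count)

  -- At inadmissible `n` the default is n²/4 rounded down, so that the asymptotics hold along all
  -- `n`.
  extremalBy : ∀ n → Dec (Admissible n) → ℕ
  extremalBy n (yes adm) = Indexed.τ (indexed n adm) (Indexed.best (indexed n adm))
  extremalBy n (no _)    = n * n DivMod./ 4

  extremal : ℕ → ℕ
  extremal n = extremalBy n (admissible? n)

  deficit : ∀ m x y → 4 * y ≤ x → m * x ≤ suc m * (4 * y) → suc m * ∣ 4 * y - x ∣ ≤ x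
  deficit m x y le low = +-cancelˡ-≤ (m * x) _ _ (begin
    m * x + suc m * ∣ 4 * y - x ∣            ≤⟨ +-monoˡ-≤ _ low ⟩
    suc m * (4 * y) + suc m * ∣ 4 * y - x ∣  ≡⟨ *-distribˡ-+ (suc m) (4 * y) _ ⟨
    suc m * (4 * y + ∣ 4 * y - x ∣)          ≡⟨ cong (λ z → suc m * (4 * y + z)) (m≤n⇒∣m-n∣≡n∸m le) ⟩
    suc m * (4 * y + (x ∸ 4 * y))            ≡⟨ cong (suc m *_) (m+[n∸m]≡n le) ⟩
    suc m * x                                ≡⟨ +-comm x (m * x) ⟩
    m * x + x                                ∎)
    where open ≤-Reasoning

  extremal-asymptotic : ∀ m → ∃ λ M → ∀ n → M ≤ n → suc m * ∣ 4 * extremal n - n * n ∣ ≤ n * n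
  -- The summand `suc m * 3` pays for the rounding of the default values, an error of at most 3
  -- after multiplication by 4.
  extremal-asymptotic m = proj₁ orientation + suc m * 3 , λ n M≤n → bound n M≤n (admissible? n)
    where
    orientation = good-orientation k m 3≤k
    N = proj₁ orientation
    tight : ∀ n → N ≤ n → (I : Indexed n) → let open Indexed I in suc m * ∣ 4 * τ best - n * n ∣ ≤ n * n
    tight n N≤n I = deficit m (n * n) (τ best) (τ-upper (tour best) k 2≤k (tour-tournament best) (τ-spec best))
        (below (proj₂ orientation n system index N≤n))
      where
      open Indexed I
      below : (∃ λ b → ∀ S → IsTransversal (tour b) k S → m * (n * n) ≤ suc m * (4 * length S)) → m * (n * n) ≤ suc m * (4 * τ best)
      below (b , low) = let S , transversal , len = proj₁ (τ-spec b) in ≤-trans (low S transversal)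
        (*-monoʳ-≤ (suc m) (*-monoʳ-≤ 4 (≤-trans (≤-reflexive len) (best-max b))))
    floor : ∀ n → suc m * 3 ≤ n → suc m * ∣ 4 * (n * n DivMod./ 4) - n * n ∣ ≤ n * n
    floor n 3m≤n = begin
        suc m * ∣ 4 * (n * n DivMod./ 4) - n * n ∣   ≡⟨ cong (suc m *_) remainder ⟩
        suc m * (n * n % 4)                   ≤⟨ *-monoʳ-≤ (suc m) (s≤s⁻¹ (m%n<n (n * n) 4)) ⟩
        suc m * 3                             ≤⟨ 3m≤n ⟩
        n                                     ≤⟨ m≤m*n n n {{>-nonZero (≤-trans (s≤s z≤n) 3m≤n)}} ⟩
        n * n                                 ∎
      where
      open ≤-Reasoning
      remainder : ∣ 4 * (n * n DivMod./ 4) - n * n ∣ ≡ n * n % 4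
      remainder = trans (cong (λ z → ∣ 4 * (n * n DivMod./ 4) - z ∣) (trans (m≡m%n+[m/n]*n (n * n) 4) (trans (+-comm (n * n % 4) _) (cong (_+ n * n % 4) (*-comm (n * n DivMod./ 4) 4)))))
        (∣m-m+n∣≡n (4 * (n * n DivMod./ 4)) (n * n % 4))
    bound : ∀ n → N + suc m * 3 ≤ n → (d : Dec (Admissible n)) → suc m * ∣ 4 * extremalBy n d - n * n ∣ ≤ n * n
    bound n M≤n (yes adm) = tight n (≤-trans (m≤m+n N _) M≤n) (indexed n adm)
    bound n M≤n (no _)    = floor n (≤-trans (m≤n+m (suc m * 3) N) M≤n)

  Realises : ∀ n → ℕ → Set
  Realises n t = Σ (Digraph n) λ T → IsTournament T × IsRegular T
    × (∃ λ ν → 2 * k * ν ≡ n * (n ∸ 1) × IsNu T k ν × IsNuStar T k ((ℤ.+ ν) ℚ./ 1)) × IsTau T k t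

  best-realises : ∀ {n} (I : Indexed n) → Realises n (Indexed.τ I (Indexed.best I))
  best-realises {n} I = tour best , tour-tournament best , decomposition-regular dec (tour-tournament best)
      , (L , trans (*-assoc 2 k L) (CycleSystem.count system) , subst (IsNu (tour best) k) (tour-parts best) (decomposition-ν dec)
           , subst (λ l → IsNuStar (tour best) k ((ℤ.+ l) ℚ./ 1)) (tour-parts best) (decomposition-ν* dec))
      , τ-spec best
    where
    open Indexed I
    instance
      k≢0 : NonZero k
      k≢0 = >-nonZero (≤-trans (s≤s z≤n) 3≤k)
    dec : Decomposition (tour best) k
    dec = tour-decomposition best

  extremal-realised : ∀ n → Admissible n → Realises n (extremal n)
  extremal-realised n adm = go (admissible? n)
    where
    go : (d : Dec (Admissible n)) → Realises n (extremalBy n d)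
    go (yes adm′) = best-realises (indexed n adm′)
    go (no ¬adm)  = contradiction adm ¬adm

open import Data.Integer using (+_)
open import Data.Rational using (_/_)

theorem1p6 : (k : ℕ) → 3 ≤ k →
    Σ (ℕ → ℕ) λ f →
    (∀ (m : ℕ) → ∃ λ M → ∀ (n : ℕ) → M ≤ n →
    suc m * ∣ 4 * f n - n * n ∣ ≤ n * n)
    × (∃ λ N → ∀ (n : ℕ) → N ≤ n → 1 ≤ n → 2 * k ∣ n ∸ 1 →
    Σ (Digraph n) λ T →
    IsTournament T × IsRegular T
    × (∃ λ ν → 2 * k * ν ≡ n * (n ∸ 1) × IsNu T k ν × IsNuStar T k ((+ ν) / 1))
    × IsTau T k (f n))
theorem1p6 k 3≤k = extremal , extremal-asymptotic , 2 , λ n 2≤n _ div → extremal-realised n (2≤n , div)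
  where open Extremal k 3≤k
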